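{- (a) If $1/\sqrt{n}\le\varepsilon<1/2$, then $$A^\varepsilon(n,2)\ge\Omega\left(\frac{\log n\cdot\varepsilon^{ -2}}{\log(\varepsilon^{ -1})}\right).$$ (b) For all $\varepsilon>0$, $$A^\varepsilon(n,2)\le O\left(\log n\cdot\varepsilon^{ -2}\right).$$
   Context: For a homogeneous $g\in\mathbb{C}[x_1,\ldots,x_n]_2$, the Waring rank $\mathbf{R}(g)$ is the minimum $r$ such that $g=\ell_1^2+\cdots+\ell_r^2$ for some complex linear forms $\ell_i$. For $0\le\varepsilon<1$, $A^\varepsilon(n,2)$ is the minimum of $\mathbf{R}(g)$ over all $g\in\mathbb{R}[x_1,\ldots,x_n]_2$ whose set of monomials with nonzero coefficient is exactly $\{x_ix_j:1\le i<j\le n\}$ and whose nonzero coefficients lie in $[1-\varepsilon,1+\varepsilon]$; $\varepsilon$ is understood to lie in this range. The constants implied by $\Omega$ and $O$ are absolute. -}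

module Defs where

import Algebra.Definitions.RawSemiring
open import Data.Empty using (⊥-elim)
open import Data.Fin.Base as Fin using (Fin)
import Data.Fin.Properties as Fin
import Data.Integer.Base as ℤ
import Data.Integer.Properties as ℤ
open import Data.Nat.Base as ℕ using (ℕ; zero; suc)
import Data.Nat.Coprimality as Coprimality
import Data.Nat.Properties as ℕ
open import Data.Product.Base using (Σ; ∃-syntax; _×_; _,_; proj₁; proj₂)
open import Data.Rational.Base
  using (ℚ; mkℚ; 0ℚ; 1ℚ; ½; _/_; 1/_; _+_; _*_; _-_; -_; ∣_∣; _≤_; _<_; *≤*;
         +-*-rawSemiring; ≢-nonZero; positive; nonNegative; _⊓_)
open import Data.Rational.Properties
open import Data.Rational.Solver using (module +-*-Solver)
open import Data.Sum.Base using (inj₁; inj₂)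
open import Data.Vec.Functional using (foldr)
open import Function.Base using (_∘_)
open import Function.Bundles using (_⇔_)
open import Relation.Binary.PropositionalEquality
  using (_≡_; refl; sym; trans; cong; cong₂; subst; subst₂; module ≡-Reasoning)
open import Relation.Nullary.Decidable using (yes; no)
open import Relation.Nullary.Negation using (¬_)

open Algebra.Definitions.RawSemiring +-*-rawSemiring using (_^_)
open +-*-Solver

private variable
  p q r s δ ρ : ℚ

fromℕ : ℕ → ℚ
fromℕ n = ℤ.+ n / 1

-- Total reciprocal, with recip 0 = 0.
recip : ℚ → ℚ
recip p with p ≟ 0ℚ
... | yes _   = 0ℚ
... | no  p≢0 = (1/ p) {{≢-nonZero p≢0}}

0<1 : 0ℚ < 1ℚ
0<1 = positive⁻¹ 1ℚ

0<½ : 0ℚ < ½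
0<½ = positive⁻¹ ½

0≤*0≤ : 0ℚ ≤ p → 0ℚ ≤ q → 0ℚ ≤ p * q
0≤*0≤ {p} {q} 0≤p 0≤q =
  subst (_≤ p * q) (*-zeroʳ p) (*-monoˡ-≤-nonNeg p {{nonNegative 0≤p}} 0≤q)

0<*0< : 0ℚ < p → 0ℚ < q → 0ℚ < p * q
0<*0< {p} {q} 0<p 0<q =
  subst (_< p * q) (*-zeroʳ p) (*-monoʳ-<-pos p {{positive 0<p}} 0<q)

*-mono-≤ : 0ℚ ≤ p → p ≤ q → 0ℚ ≤ r → r ≤ s → p * r ≤ q * s
*-mono-≤ {p} {q} {r} {s} 0≤p p≤q 0≤r r≤s = ≤-trans
  (*-monoʳ-≤-nonNeg r {{nonNegative 0≤r}} p≤q)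
  (*-monoˡ-≤-nonNeg q {{nonNegative (≤-trans 0≤p p≤q)}} r≤s)

0≤-⇒≤ : 0ℚ ≤ q - p → p ≤ q
0≤-⇒≤ {q} {p} h = subst₂ _≤_ (+-identityʳ p)
  (solve 2 (λ p q → p :+ (q :- p) := q) refl p q) (+-monoʳ-≤ p h)

≤⇒0≤- : p ≤ q → 0ℚ ≤ q - p
≤⇒0≤- {p} {q} h = subst (_≤ q - p) (+-inverseʳ p) (+-monoˡ-≤ (- p) h)

<⇒0<- : p < q → 0ℚ < q - p
<⇒0<- {p} {q} h = subst (_< q - p) (+-inverseʳ p) (+-monoˡ-< (- p) h)

p≤p+q : 0ℚ ≤ q → p ≤ p + q
p≤p+q {q} {p} h = subst (_≤ p + q) (+-identityʳ p) (+-monoʳ-≤ p h)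

p<p+q : 0ℚ < q → p < p + q
p<p+q {q} {p} h = subst (_< p + q) (+-identityʳ p) (+-monoʳ-< p h)

0<+0≤ : 0ℚ < p → 0ℚ ≤ q → 0ℚ < p + q
0<+0≤ 0<p 0≤q = <-≤-trans 0<p (p≤p+q 0≤q)

0<⊓ : 0ℚ < p → 0ℚ < q → 0ℚ < p ⊓ q
0<⊓ {p} {q} 0<p 0<q with ⊓-sel p q
... | inj₁ eq = subst (0ℚ <_) (sym eq) 0<p
... | inj₂ eq = subst (0ℚ <_) (sym eq) 0<q

∣p∣≤ : p ≤ q → - p ≤ q → ∣ p ∣ ≤ q
∣p∣≤ {p} {q} h h′ with ∣p∣≡p∨∣p∣≡-p p
... | inj₁ eq = subst (_≤ q) (sym eq) h
... | inj₂ eq = subst (_≤ q) (sym eq) h′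

p≤∣p∣ : ∀ p → p ≤ ∣ p ∣
p≤∣p∣ p with ≤-total 0ℚ p
... | inj₁ 0≤p = ≤-reflexive (sym (0≤p⇒∣p∣≡p 0≤p))
... | inj₂ p≤0 = ≤-trans p≤0 (0≤∣p∣ p)

-p≤∣p∣ : ∀ p → - p ≤ ∣ p ∣
-p≤∣p∣ p = subst (- p ≤_) (∣-p∣≡∣p∣ p) (p≤∣p∣ (- p))

∣p-q∣≡∣q-p∣ : ∀ p q → ∣ p - q ∣ ≡ ∣ q - p ∣
∣p-q∣≡∣q-p∣ p q = trans (sym (∣-p∣≡∣p∣ (p - q)))
  (cong ∣_∣ (solve 2 (λ p q → :- (p :- q) := q :- p) refl p q))

p*recip : 0ℚ < p → p * recip p ≡ 1ℚ
p*recip {p} 0<p with p ≟ 0ℚ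
... | yes p≡0 = ⊥-elim (<-irrefl (sym p≡0) 0<p)
... | no  p≢0 = *-inverseʳ p {{≢-nonZero p≢0}}

0<recip : 0ℚ < p → 0ℚ < recip p
0<recip {p} 0<p = ≰⇒> λ h → <-irrefl refl (<-≤-trans 0<1 (subst₂ _≤_ (p*recip 0<p)
  (*-zeroʳ p) (*-monoˡ-≤-nonNeg p {{nonNegative (<⇒≤ 0<p)}} h)))

recip-anti : 0ℚ < p → p ≤ q → recip q ≤ recip p
recip-anti {p} {q} 0<p p≤q = subst₂ _≤_
  (trans (cong (_* recip q) (p*recip 0<p)) (*-identityˡ _))
  (trans (solve 3 (λ q x y → q :* x :* y := q :* y :* x) refl q (recip p) (recip q))
    (trans (cong (_* recip p) (p*recip 0<q)) (*-identityˡ _)))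
  (*-monoʳ-≤-nonNeg (recip q) {{nonNegative (<⇒≤ (0<recip 0<q))}}
    (*-monoʳ-≤-nonNeg (recip p) {{nonNegative (<⇒≤ (0<recip 0<p))}} p≤q))
  where 0<q = <-≤-trans 0<p p≤q

fromℕ≡mkℚ : ∀ n → fromℕ n ≡ mkℚ (ℤ.+ n) 0 (Coprimality.sym (Coprimality.1-coprimeTo n))
fromℕ≡mkℚ n = fromℚᵘ-toℚᵘ (mkℚ (ℤ.+ n) 0 (Coprimality.sym (Coprimality.1-coprimeTo n)))

fromℕ-suc : ∀ n → fromℕ (suc n) ≡ 1ℚ + fromℕ n
fromℕ-suc n = sym (trans (cong (1ℚ +_) (fromℕ≡mkℚ n))
  (cong (λ z → (ℤ.+ 1 ℤ.+ z) / 1) (ℤ.*-identityʳ (ℤ.+ n))))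

0≤fromℕ : ∀ n → 0ℚ ≤ fromℕ n
0≤fromℕ zero    = ≤-refl
0≤fromℕ (suc n) = subst (0ℚ ≤_) (sym (fromℕ-suc n)) (≤-trans (<⇒≤ 0<1) (p≤p+q (0≤fromℕ n)))

0<fromℕ : ∀ n → 0ℚ < fromℕ (suc n)
0<fromℕ n = subst (0ℚ <_) (sym (fromℕ-suc n)) (0<+0≤ 0<1 (0≤fromℕ n))

fromℕ-+ : ∀ m n → fromℕ (m ℕ.+ n) ≡ fromℕ m + fromℕ n
fromℕ-+ zero    n = sym (+-identityˡ (fromℕ n))
fromℕ-+ (suc m) n = trans (fromℕ-suc (m ℕ.+ n)) (trans (cong (1ℚ +_) (fromℕ-+ m n))
  (trans (sym (+-assoc 1ℚ (fromℕ m) (fromℕ n))) (cong (_+ fromℕ n) (sym (fromℕ-suc m)))))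

fromℕ-* : ∀ m n → fromℕ (m ℕ.* n) ≡ fromℕ m * fromℕ n
fromℕ-* zero    n = sym (*-zeroˡ (fromℕ n))
fromℕ-* (suc m) n = trans (fromℕ-+ n (m ℕ.* n)) (trans (cong (fromℕ n +_) (fromℕ-* m n))
  (trans (solve 2 (λ a b → b :+ a :* b := (con 1ℚ :+ a) :* b) refl (fromℕ m) (fromℕ n))
    (cong (_* fromℕ n) (sym (fromℕ-suc m)))))

fromℕ-mono : ∀ {m n} → m ℕ.≤ n → fromℕ m ≤ fromℕ n
fromℕ-mono {m} {n} m≤n = subst (fromℕ m ≤_)
  (trans (sym (fromℕ-+ m (n ℕ.∸ m))) (cong fromℕ (ℕ.m+[n∸m]≡n m≤n))) (p≤p+q (0≤fromℕ (n ℕ.∸ m)))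

archimedean : ∀ q → ∃[ n ] q ≤ fromℕ n
archimedean (mkℚ (ℤ.+ n) d c) = n , subst (mkℚ (ℤ.+ n) d c ≤_) (sym (fromℕ≡mkℚ n))
  (*≤* (ℤ.*-monoˡ-≤-nonNeg (ℤ.+ n) (ℤ.+≤+ (ℕ.s≤s ℕ.z≤n))))
archimedean (mkℚ ℤ.-[1+ n ] d c) = 0 , *≤* ℤ.-≤+

recip-small : 0ℚ < δ → ∃[ N ] ∀ n → N ℕ.≤ n → recip (fromℕ (suc n)) ≤ δ
recip-small {δ} 0<δ with archimedean (recip δ)
... | N , h = N , λ n N≤n → subst₂ _≤_
  (trans (cong (_* recip (fromℕ (suc n))) (p*recip 0<δ)) (*-identityˡ _))
  (trans (*-assoc δ _ _) (trans (cong (δ *_) (p*recip (0<fromℕ n))) (*-identityʳ δ)))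
  (*-monoʳ-≤-nonNeg _ {{nonNegative (<⇒≤ (0<recip (0<fromℕ n)))}}
    (*-monoˡ-≤-nonNeg δ {{nonNegative (<⇒≤ 0<δ)}}
      (≤-trans h (fromℕ-mono (ℕ.m≤n⇒m≤1+n N≤n)))))

≤⊔ˡ : ∀ {m n o} → m ℕ.⊔ n ℕ.≤ o → m ℕ.≤ o
≤⊔ˡ {m} {n} = ℕ.m⊔n≤o⇒m≤o m n

≤⊔ʳ : ∀ {m n o} → m ℕ.⊔ n ℕ.≤ o → n ℕ.≤ o
≤⊔ʳ {m} {n} = ℕ.m⊔n≤o⇒n≤o m n

-- Cauchy sequences are not quotiented: equality of reals is _≈ℝ_ below.
Eventually : (ℕ → Set) → Set
Eventually P = ∃[ N ] ∀ n → N ℕ.≤ n → P n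

Cauchy : (ℕ → ℚ) → Set
Cauchy x = ∀ δ → 0ℚ < δ → ∃[ N ] ∀ m n → N ℕ.≤ m → N ℕ.≤ n → ∣ x m - x n ∣ ≤ δ

record ℝ : Set where
  constructor mkℝ
  field
    seq    : ℕ → ℚ
    cauchy : Cauchy seq
open ℝ

infix 4 _≈ℝ_ _≤ℝ_ _<ℝ_

_≈ℝ_ _≤ℝ_ _<ℝ_ : ℝ → ℝ → Set
x ≈ℝ y = ∀ δ → 0ℚ < δ → Eventually λ n → ∣ seq x n - seq y n ∣ ≤ δ
x ≤ℝ y = ∀ δ → 0ℚ < δ → Eventually λ n → seq x n ≤ seq y n + δ
x <ℝ y = ∃[ δ ] 0ℚ < δ × Eventually λ n → seq x n + δ ≤ seq y n

scaled-cauchy : ∀ {x} K → 0ℚ < K →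
  (∀ δ → 0ℚ < δ → ∃[ N ] ∀ m n → N ℕ.≤ m → N ℕ.≤ n → ∣ x m - x n ∣ ≤ K * δ) → Cauchy x
scaled-cauchy {x} K 0<K h δ 0<δ with h (recip K * δ) (0<*0< (0<recip 0<K) 0<δ)
... | N , hN = N , λ m n N≤m N≤n → subst (∣ x m - x n ∣ ≤_)
  (trans (sym (*-assoc K (recip K) δ)) (trans (cong (_* δ) (p*recip 0<K)) (*-identityˡ δ)))
  (hN m n N≤m N≤n)

fromℚ : ℚ → ℝ
fromℚ q = mkℝ (λ _ → q) λ δ 0<δ → 0 , λ _ _ _ _ →
  subst (λ p → ∣ p ∣ ≤ δ) (sym (+-inverseʳ q)) (<⇒≤ 0<δ)

0ℝ 1ℝ ½ℝ 2ℝ : ℝ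
0ℝ = fromℚ 0ℚ
1ℝ = fromℚ 1ℚ
½ℝ = fromℚ ½
2ℝ = fromℚ (fromℕ 2)

ℕtoℝ : ℕ → ℝ
ℕtoℝ n = fromℚ (fromℕ n)

infixl 6 _+ℝ_ _-ℝ_
infixl 7 _*ℝ_
infixl 7 _/ℝ_[_]
infix  8 -ℝ_

_+ℝ_ : ℝ → ℝ → ℝ
x +ℝ y = mkℝ (λ n → seq x n + seq y n) (scaled-cauchy {λ n → seq x n + seq y n} (1ℚ + 1ℚ) (positive⁻¹ (1ℚ + 1ℚ)) λ δ 0<δ →
  let N₁ , h₁ = cauchy x δ 0<δ
      N₂ , h₂ = cauchy y δ 0<δ
  in N₁ ℕ.⊔ N₂ , λ m n N≤m N≤n → subst₂ _≤_
    (cong ∣_∣ (solve 4 (λ a b c d → (a :- c) :+ (b :- d) := (a :+ b) :- (c :+ d)) refl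
      (seq x m) (seq y m) (seq x n) (seq y n)))
    (solve 1 (λ δ → δ :+ δ := (con 1ℚ :+ con 1ℚ) :* δ) refl δ)
    (≤-trans (∣p+q∣≤∣p∣+∣q∣ (seq x m - seq x n) (seq y m - seq y n))
      (+-mono-≤ (h₁ m n (≤⊔ˡ N≤m) (≤⊔ˡ N≤n))
                (h₂ m n (≤⊔ʳ {N₁} N≤m) (≤⊔ʳ {N₁} N≤n)))))

-ℝ_ : ℝ → ℝ
-ℝ x = mkℝ (λ n → - seq x n) λ δ 0<δ →
  let N , h = cauchy x δ 0<δ
  in N , λ m n N≤m N≤n → subst (_≤ δ)
    (trans (sym (∣-p∣≡∣p∣ (seq x m - seq x n)))
      (cong ∣_∣ (solve 2 (λ a b → :- (a :- b) := (:- a) :- (:- b)) refl (seq x m) (seq x n))))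
    (h m n N≤m N≤n)

_-ℝ_ : ℝ → ℝ → ℝ
x -ℝ y = x +ℝ (-ℝ y)

bounded : ∀ x → ∃[ B ] 0ℚ < B × Eventually λ n → ∣ seq x n ∣ ≤ B
bounded x =
  let N , h = cauchy x 1ℚ 0<1
      a     = seq x N
  in 1ℚ + ∣ a ∣ , 0<+0≤ 0<1 (0≤∣p∣ a) , N , λ n N≤n → ≤-trans
    (subst (λ p → ∣ p ∣ ≤ ∣ seq x n - a ∣ + ∣ a ∣)
      (solve 2 (λ b a → b :- a :+ a := b) refl (seq x n) a)
      (∣p+q∣≤∣p∣+∣q∣ (seq x n - a) a))
    (+-monoˡ-≤ ∣ a ∣ (h n N N≤n ℕ.≤-refl))

∣ab-cd∣≤ : ∀ {a b c d A B} → ∣ a ∣ ≤ A → ∣ d ∣ ≤ B → ∣ b - d ∣ ≤ δ → ∣ a - c ∣ ≤ δ →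
  ∣ a * b - c * d ∣ ≤ (A + B) * δ
∣ab-cd∣≤ {δ} {a} {b} {c} {d} {A} {B} ha hd hbd hac = subst₂ _≤_
  (cong ∣_∣ (solve 4 (λ a b c d → a :* (b :- d) :+ d :* (a :- c) := a :* b :- c :* d) refl a b c d))
  (sym (*-distribʳ-+ δ A B))
  (≤-trans (∣p+q∣≤∣p∣+∣q∣ (a * (b - d)) (d * (a - c)))
    (+-mono-≤
      (subst (_≤ A * δ) (sym (∣p*q∣≡∣p∣*∣q∣ a (b - d)))
        (*-mono-≤ (0≤∣p∣ a) ha (0≤∣p∣ (b - d)) hbd))
      (subst (_≤ B * δ) (sym (∣p*q∣≡∣p∣*∣q∣ d (a - c)))
        (*-mono-≤ (0≤∣p∣ d) hd (0≤∣p∣ (a - c)) hac))))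

_*ℝ_ : ℝ → ℝ → ℝ
x *ℝ y = mkℝ (λ n → seq x n * seq y n)
  (let A , 0<A , M₁ , hA = bounded x
       B , 0<B , M₂ , hB = bounded y
   in scaled-cauchy {λ n → seq x n * seq y n} (A + B) (0<+0≤ 0<A (<⇒≤ 0<B)) λ δ 0<δ →
     let N₁ , h₁ = cauchy x δ 0<δ
         N₂ , h₂ = cauchy y δ 0<δ
     in (M₁ ℕ.⊔ M₂) ℕ.⊔ (N₁ ℕ.⊔ N₂) , λ m n N≤m N≤n →
       let M≤m = ≤⊔ˡ {M₁ ℕ.⊔ M₂} N≤m
           M≤n = ≤⊔ˡ {M₁ ℕ.⊔ M₂} N≤n
           K≤m = ≤⊔ʳ {M₁ ℕ.⊔ M₂} N≤m
           K≤n = ≤⊔ʳ {M₁ ℕ.⊔ M₂} N≤n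
       in ∣ab-cd∣≤ {a = seq x m} {seq y m} {seq x n} {seq y n} (hA m (≤⊔ˡ M≤m)) (hB n (≤⊔ʳ {M₁} M≤n))
            (h₂ m n (≤⊔ʳ {N₁} K≤m) (≤⊔ʳ {N₁} K≤n)) (h₁ m n (≤⊔ˡ K≤m) (≤⊔ˡ K≤n)))

0<ℝ-bound : ∀ {x} → 0ℝ <ℝ x → ∃[ δ ] 0ℚ < δ × Eventually λ n → δ ≤ seq x n
0<ℝ-bound {x} (δ , 0<δ , N , h) = δ , 0<δ , N , λ n N≤n →
  subst (_≤ seq x n) (+-identityˡ δ) (h n N≤n)

bound-0<ℝ : ∀ {x} → ∃[ δ ] 0ℚ < δ × Eventually (λ n → δ ≤ seq x n) → 0ℝ <ℝ x
bound-0<ℝ {x} (δ , 0<δ , N , h) = δ , 0<δ , N , λ n N≤n →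
  subst (_≤ seq x n) (sym (+-identityˡ δ)) (h n N≤n)

<⇒≤ℝ : ∀ {x y} → x <ℝ y → x ≤ℝ y
<⇒≤ℝ (δ , 0<δ , N , h) δ′ 0<δ′ = N , λ n N≤n →
  ≤-trans (p≤p+q (<⇒≤ 0<δ)) (≤-trans (h n N≤n) (p≤p+q (<⇒≤ 0<δ′)))

<ℝ-trans : ∀ {x y z} → x <ℝ y → y <ℝ z → x <ℝ z
<ℝ-trans {x} {y} {z} (δ , 0<δ , N , h) (δ′ , 0<δ′ , N′ , h′) = δ , 0<δ , N ℕ.⊔ N′ , λ n N≤n →
  ≤-trans (h n (≤⊔ˡ N≤n)) (≤-trans (p≤p+q (<⇒≤ 0<δ′)) (h′ n (≤⊔ʳ {N} N≤n)))

½<1 : ½ℝ <ℝ 1ℝ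
½<1 = ½ , 0<½ , 0 , λ _ _ → ≤-refl

0<1+ : ∀ {x} → 0ℝ <ℝ x → 0ℝ <ℝ x +ℝ 1ℝ
0<1+ {x} p with 0<ℝ-bound {x} p
... | δ , 0<δ , N , h = bound-0<ℝ {x +ℝ 1ℝ}
  (δ , 0<δ , N , λ n N≤n → ≤-trans (h n N≤n) (p≤p+q (<⇒≤ 0<1)))

0<*ℝ : ∀ {x y} → 0ℝ <ℝ x → 0ℝ <ℝ y → 0ℝ <ℝ x *ℝ y
0<*ℝ {x} {y} p q with 0<ℝ-bound {x} p | 0<ℝ-bound {y} q
... | δ , 0<δ , N , h | δ′ , 0<δ′ , N′ , h′ = bound-0<ℝ {x *ℝ y}
  (δ * δ′ , 0<*0< 0<δ 0<δ′ , N ℕ.⊔ N′ , λ n N≤n →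
    *-mono-≤ (<⇒≤ 0<δ) (h n (≤⊔ˡ N≤n)) (<⇒≤ 0<δ′) (h′ n (≤⊔ʳ {N} N≤n)))

-- The hypothesis only enters the proof of convergence.
inv : (x : ℝ) → 0ℝ <ℝ x → ℝ
inv x 0<x = mkℝ (λ n → recip (seq x n)) 
  (let d , 0<d , M , h = 0<ℝ-bound {x} 0<x
       R = recip d
    in scaled-cauchy {recip ∘ seq x} (R * R) (0<*0< (0<recip 0<d) (0<recip 0<d)) (λ δ 0<δ →
      let N , hN = cauchy x δ 0<δ
      in M ℕ.⊔ N , λ m n N≤m N≤n →
        let a   = seq x m
            b   = seq x n
            d≤a = h m (≤⊔ˡ N≤m)
            d≤b = h n (≤⊔ˡ N≤n)
            0<a = <-≤-trans 0<d d≤a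
            0<b = <-≤-trans 0<d d≤b
            0<u = 0<recip 0<a
            0<v = 0<recip 0<b
        in subst (_≤ R * R * δ)
             (trans (cong (_* ∣ b - a ∣) (sym (0≤p⇒∣p∣≡p (<⇒≤ (0<*0< 0<u 0<v)))))
             (trans (sym (∣p*q∣≡∣p∣*∣q∣ (recip a * recip b) (b - a)))
               (cong ∣_∣ (recip-difference 0<a 0<b))))
             (*-mono-≤ (<⇒≤ (0<*0< 0<u 0<v))
               (*-mono-≤ (<⇒≤ 0<u) (recip-anti 0<d d≤a) (<⇒≤ 0<v) (recip-anti 0<d d≤b))
               (0≤∣p∣ (b - a)) (hN n m (≤⊔ʳ {M} N≤n) (≤⊔ʳ {M} N≤m)))))
  where
  recip-difference : 0ℚ < p → 0ℚ < q → recip p * recip q * (q - p) ≡ recip p - recip q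
  recip-difference {p} {q} 0<p 0<q = trans
    (solve 4 (λ p q u v → u :* v :* (q :- p) := u :* (q :* v) :- v :* (p :* u)) refl
      p q (recip p) (recip q))
    (cong₂ _-_ (trans (cong (recip p *_) (p*recip 0<q)) (*-identityʳ (recip p)))
               (trans (cong (recip q *_) (p*recip 0<p)) (*-identityʳ (recip q))))

0<inv : ∀ {x} (0<x : 0ℝ <ℝ x) → 0ℝ <ℝ inv x 0<x
0<inv {x} 0<x =
  let δ , 0<δ , N , h  = 0<ℝ-bound {x} 0<x
      B , 0<B , M , hB = bounded x
  in bound-0<ℝ {inv x 0<x} (recip B , 0<recip 0<B , N ℕ.⊔ M , λ n N≤n → recip-anti
       (<-≤-trans 0<δ (h n (≤⊔ˡ N≤n)))
       (≤-trans (p≤∣p∣ (seq x n)) (hB n (≤⊔ʳ {N} N≤n))))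

_/ℝ_[_] : ∀ x y → 0ℝ <ℝ y → ℝ
x /ℝ y [ 0<y ] = x *ℝ inv y 0<y

1+≤recip : 0ℚ < p → 0ℚ ≤ δ → p + δ ≤ 1ℚ → 1ℚ + δ ≤ recip p
1+≤recip {p} {δ} 0<p 0≤δ p+δ≤1 = ≤-trans
  (+-monoʳ-≤ 1ℚ (subst (_≤ recip p * δ) (*-identityˡ δ)
    (*-monoʳ-≤-nonNeg δ {{nonNegative 0≤δ}} 1≤u)))
  (subst₂ _≤_
    (trans (*-distribʳ-+ (recip p) p δ) (cong₂ _+_ (p*recip 0<p) (*-comm δ (recip p))))
    (*-identityˡ (recip p))
    (*-monoʳ-≤-nonNeg (recip p) {{nonNegative 0≤u}} p+δ≤1))
  where
  0≤u : 0ℚ ≤ recip p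
  0≤u = <⇒≤ (0<recip 0<p)
  1≤u : 1ℚ ≤ recip p
  1≤u = subst₂ _≤_ (p*recip 0<p) (*-identityˡ (recip p))
    (*-monoʳ-≤-nonNeg (recip p) {{nonNegative 0≤u}} (≤-trans (p≤p+q {δ} {p} 0≤δ) p+δ≤1))

1<inv : ∀ {x} (0<x : 0ℝ <ℝ x) → x <ℝ 1ℝ → 1ℝ <ℝ inv x 0<x
1<inv {x} 0<x (δ , 0<δ , M , hM) =
  let d , 0<d , N , h = 0<ℝ-bound {x} 0<x
  in δ , 0<δ , M ℕ.⊔ N , λ n N≤n →
       1+≤recip (<-≤-trans 0<d (h n (≤⊔ʳ {M} N≤n))) (<⇒≤ 0<δ) (hM n (≤⊔ˡ N≤n))

-- Logarithm: log x = 2 artanh ((x - 1) / (x + 1)) for x > 0,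
-- where artanh z = Σₖ z²ᵏ⁺¹ / (2k + 1) for ∣z∣ < 1.
∣_∣<1 : ℝ → Set
∣ z ∣<1 = ∃[ ρ ] ρ < 1ℚ × Eventually λ n → ∣ seq z n ∣ ≤ ρ

artanhTerm artanhSum : ℕ → ℚ → ℚ
artanhTerm k z = z ^ suc (2 ℕ.* k) * recip (fromℕ (suc (2 ℕ.* k)))
artanhSum zero    z = 0ℚ
artanhSum (suc n) z = artanhSum n z + artanhTerm n z

0≤^ : 0ℚ ≤ p → ∀ n → 0ℚ ≤ p ^ n
0≤^ 0≤p zero    = <⇒≤ 0<1
0≤^ 0≤p (suc n) = 0≤*0≤ 0≤p (0≤^ 0≤p n)

^-anti : 0ℚ ≤ p → p ≤ 1ℚ → ∀ m n → p ^ (m ℕ.+ n) ≤ p ^ n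
^-anti         0≤p p≤1 zero    n = ≤-refl
^-anti {p = p} 0≤p p≤1 (suc m) n = ≤-trans
  (subst (p * p ^ (m ℕ.+ n) ≤_) (*-identityˡ (p ^ (m ℕ.+ n)))
    (*-monoʳ-≤-nonNeg (p ^ (m ℕ.+ n)) {{nonNegative (0≤^ 0≤p (m ℕ.+ n))}} p≤1))
  (^-anti 0≤p p≤1 m n)

∣^∣≤ : ∣ p ∣ ≤ ρ → ∀ n → ∣ p ^ n ∣ ≤ ρ ^ n
∣^∣≤         h zero    = ≤-refl
∣^∣≤ {p} {ρ} h (suc n) = subst (_≤ ρ * ρ ^ n) (sym (∣p*q∣≡∣p∣*∣q∣ p (p ^ n)))
  (*-mono-≤ (0≤∣p∣ p) h (0≤∣p∣ (p ^ n)) (∣^∣≤ h n))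

bernoulli : 0ℚ ≤ ρ → ρ < 1ℚ → ∀ n → ρ ^ n * (1ℚ + fromℕ n * (1ℚ - ρ)) ≤ 1ℚ
bernoulli {ρ} 0≤ρ ρ<1 zero    = ≤-reflexive (trans (*-identityˡ (1ℚ + 0ℚ * (1ℚ - ρ)))
  (trans (cong (1ℚ +_) (*-zeroˡ (1ℚ - ρ))) (+-identityʳ 1ℚ)))
bernoulli {ρ} 0≤ρ ρ<1 (suc n) = ≤-trans
  (subst₂ _≤_
    (trans (solve 3 (λ a b c → b :* (a :* c) := a :* b :* c) refl
             ρ (ρ ^ n) (1ℚ + (1ℚ + fromℕ n) * (1ℚ - ρ)))
      (cong (λ N → ρ ^ suc n * (1ℚ + N * (1ℚ - ρ))) (sym (fromℕ-suc n))))
    refl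
    (*-monoˡ-≤-nonNeg (ρ ^ n) {{nonNegative (0≤^ 0≤ρ n)}} step))
  (bernoulli 0≤ρ ρ<1 n)
  where
  h N : ℚ
  h = 1ℚ - ρ
  N = fromℕ n
  0≤h : 0ℚ ≤ h
  0≤h = <⇒≤ (<⇒0<- ρ<1)
  step : ρ * (1ℚ + (1ℚ + N) * h) ≤ 1ℚ + N * h
  step = 0≤-⇒≤ (subst (0ℚ ≤_)
    (solve 2 (λ r N → (con 1ℚ :- r) :* (con 1ℚ :- r) :* (con 1ℚ :+ N) :=
      (con 1ℚ :+ N :* (con 1ℚ :- r)) :- r :* (con 1ℚ :+ (con 1ℚ :+ N) :* (con 1ℚ :- r))) refl ρ N)
    (0≤*0≤ (0≤*0≤ 0≤h 0≤h) (<⇒≤ (0<+0≤ 0<1 (0≤fromℕ n)))))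

^-small : 0ℚ ≤ ρ → ρ < 1ℚ → 0ℚ < δ → ∃[ N ] ρ ^ N ≤ δ
^-small {ρ} {δ} 0≤ρ ρ<1 0<δ = N , (begin
  x                            ≡⟨ *-identityʳ x ⟨
  x * 1ℚ                       ≤⟨ *-monoˡ-≤-nonNeg x {{nonNegative 0≤x}} 1≤ ⟩
  x * (δ * h * fromℕ N)        ≡⟨ solve 4 (λ x d h N → x :* (d :* h :* N) := d :* (x :* (N :* h)))
                                    refl x δ h (fromℕ N) ⟩
  δ * (x * (fromℕ N * h))      ≤⟨ *-monoˡ-≤-nonNeg δ {{nonNegative (<⇒≤ 0<δ)}}
                                    (*-monoˡ-≤-nonNeg x {{nonNegative 0≤x}} Nh≤) ⟩
  δ * (x * (1ℚ + fromℕ N * h)) ≤⟨ *-monoˡ-≤-nonNeg δ {{nonNegative (<⇒≤ 0<δ)}}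
                                    (bernoulli 0≤ρ ρ<1 N) ⟩
  δ * 1ℚ                       ≡⟨ *-identityʳ δ ⟩
  δ                            ∎)
  where
  open ≤-Reasoning
  h : ℚ
  h = 1ℚ - ρ
  0<δh : 0ℚ < δ * h
  0<δh = 0<*0< 0<δ (<⇒0<- ρ<1)
  N : ℕ
  N = proj₁ (archimedean (recip (δ * h)))
  x : ℚ
  x = ρ ^ N
  0≤x : 0ℚ ≤ x
  0≤x = 0≤^ 0≤ρ N
  1≤ : 1ℚ ≤ δ * h * fromℕ N
  1≤ = subst (_≤ δ * h * fromℕ N) (p*recip 0<δh)
    (*-monoˡ-≤-nonNeg (δ * h) {{nonNegative (<⇒≤ 0<δh)}} (proj₂ (archimedean (recip (δ * h)))))
  Nh≤ : fromℕ N * h ≤ 1ℚ + fromℕ N * h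
  Nh≤ = subst (_≤ 1ℚ + fromℕ N * h) (+-identityˡ (fromℕ N * h))
    (+-monoˡ-≤ (fromℕ N * h) (<⇒≤ 0<1))

geometric : ∀ (F : ℕ → ℚ) C → (∀ n → ∣ F (suc n) - F n ∣ ≤ C * ρ ^ n) → ρ < 1ℚ →
  ∀ d n → ∣ F (d ℕ.+ n) - F n ∣ * (1ℚ - ρ) ≤ C * (ρ ^ n - ρ ^ (d ℕ.+ n))
geometric {ρ} F C hF ρ<1 zero n = ≤-reflexive (trans
  (cong (λ p → ∣ p ∣ * (1ℚ - ρ)) (+-inverseʳ (F n)))
  (trans (*-zeroˡ (1ℚ - ρ))
    (sym (trans (cong (C *_) (+-inverseʳ (ρ ^ n))) (*-zeroʳ C)))))
geometric {ρ} F C hF ρ<1 (suc d) n = begin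
  ∣ F (suc k) - F n ∣ * h                       ≤⟨ mono triangle ⟩
  (∣ F (suc k) - F k ∣ + ∣ F k - F n ∣) * h     ≡⟨ *-distribʳ-+ h (∣ F (suc k) - F k ∣) (∣ F k - F n ∣) ⟩
  ∣ F (suc k) - F k ∣ * h + ∣ F k - F n ∣ * h   ≤⟨ +-mono-≤ (mono (hF k)) (geometric F C hF ρ<1 d n) ⟩
  C * ρ ^ k * h + C * (ρ ^ n - ρ ^ k)           ≡⟨ solve 4 (λ C r a b →
                                                     C :* b :* (con 1ℚ :- r) :+ C :* (a :- b) :=
                                                     C :* (a :- r :* b)) refl C ρ (ρ ^ n) (ρ ^ k) ⟩
  C * (ρ ^ n - ρ * ρ ^ k)                       ∎
  where
  open ≤-Reasoning
  k : ℕ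
  k = d ℕ.+ n
  h : ℚ
  h = 1ℚ - ρ
  mono : p ≤ q → p * h ≤ q * h
  mono = *-monoʳ-≤-nonNeg h {{nonNegative (<⇒≤ (<⇒0<- ρ<1))}}
  triangle : ∣ F (suc k) - F n ∣ ≤ ∣ F (suc k) - F k ∣ + ∣ F k - F n ∣
  triangle = subst (λ p → ∣ p ∣ ≤ ∣ F (suc k) - F k ∣ + ∣ F k - F n ∣)
    (solve 3 (λ a b c → (a :- b) :+ (b :- c) := a :- c) refl (F (suc k)) (F k) (F n))
    (∣p+q∣≤∣p∣+∣q∣ (F (suc k) - F k) (F k - F n))

0≤recip : ∀ n → 0ℚ ≤ recip (fromℕ (suc n))
0≤recip n = <⇒≤ (0<recip (0<fromℕ n))

recip≤1 : ∀ n → recip (fromℕ (suc n)) ≤ 1ℚ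
recip≤1 n = recip-anti 0<1 (fromℕ-mono {1} {suc n} (ℕ.s≤s ℕ.z≤n))

module _ (0≤ρ : 0ℚ ≤ ρ) (ρ<1 : ρ < 1ℚ) where

  private
    h : ℚ
    h = 1ℚ - ρ
    0≤h : 0ℚ ≤ h
    0≤h = <⇒≤ (<⇒0<- ρ<1)

  ^2k≤^k : ∀ k → ρ ^ (2 ℕ.* k) ≤ ρ ^ k
  ^2k≤^k k = subst (λ j → ρ ^ j ≤ ρ ^ k) (ℕ.+-comm (k ℕ.+ 0) k) (^-anti 0≤ρ (<⇒≤ ρ<1) (k ℕ.+ 0) k)

  ∣term∣≤ : ∀ {z} → ∣ z ∣ ≤ ρ → ∀ k → ∣ artanhTerm k z ∣ ≤ ρ ^ k
  ∣term∣≤ {z} hz k = begin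
    ∣ z ^ j * u ∣     ≡⟨ ∣p*q∣≡∣p∣*∣q∣ (z ^ j) u ⟩
    ∣ z ^ j ∣ * ∣ u ∣ ≡⟨ cong (∣ z ^ j ∣ *_) (0≤p⇒∣p∣≡p (0≤recip (2 ℕ.* k))) ⟩
    ∣ z ^ j ∣ * u     ≤⟨ *-mono-≤ (0≤∣p∣ (z ^ j)) (∣^∣≤ hz j) (0≤recip (2 ℕ.* k)) (recip≤1 (2 ℕ.* k)) ⟩
    ρ ^ j * 1ℚ        ≡⟨ *-identityʳ (ρ ^ j) ⟩
    ρ ^ j             ≤⟨ ^-anti 0≤ρ (<⇒≤ ρ<1) 1 (2 ℕ.* k) ⟩
    ρ ^ (2 ℕ.* k)     ≤⟨ ^2k≤^k k ⟩
    ρ ^ k             ∎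
    where
    open ≤-Reasoning
    j : ℕ
    j = suc (2 ℕ.* k)
    u : ℚ
    u = recip (fromℕ j)

  module _ {a b : ℚ} (ha : ∣ a ∣ ≤ ρ) (hb : ∣ b ∣ ≤ ρ) where

    ^-lipschitz : ∀ m → ∣ a ^ suc m - b ^ suc m ∣ ≤ fromℕ (suc m) * (ρ ^ m * ∣ a - b ∣)
    ^-lipschitz zero    = ≤-reflexive (trans
      (cong₂ (λ p q → ∣ p - q ∣) (*-identityʳ a) (*-identityʳ b))
      (sym (trans (*-identityˡ (1ℚ * ∣ a - b ∣)) (*-identityˡ ∣ a - b ∣))))
    ^-lipschitz (suc m) = begin
      ∣ a * A - b * B ∣                             ≡⟨ cong ∣_∣ (solve 4 (λ a b A B →
                                                         a :* A :- b :* B :=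
                                                         a :* (A :- B) :+ (a :- b) :* B) refl a b A B) ⟩
      ∣ a * (A - B) + (a - b) * B ∣                 ≤⟨ ∣p+q∣≤∣p∣+∣q∣ (a * (A - B)) ((a - b) * B) ⟩
      ∣ a * (A - B) ∣ + ∣ (a - b) * B ∣             ≡⟨ cong₂ _+_ (∣p*q∣≡∣p∣*∣q∣ a (A - B))
                                                                 (∣p*q∣≡∣p∣*∣q∣ (a - b) B) ⟩
      ∣ a ∣ * ∣ A - B ∣ + D * ∣ B ∣                 ≤⟨ +-mono-≤
                                                         (*-mono-≤ (0≤∣p∣ a) ha (0≤∣p∣ (A - B)) (^-lipschitz m))
                                                         (*-monoˡ-≤-nonNeg D {{∣-∣-nonNeg (a - b)}}
                                                           (∣^∣≤ hb (suc m))) ⟩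
      ρ * (M * (ρ ^ m * D)) + D * (ρ * ρ ^ m)       ≡⟨ solve 4 (λ r M x D →
                                                         r :* (M :* (x :* D)) :+ D :* (r :* x) :=
                                                         (con 1ℚ :+ M) :* (r :* x :* D)) refl ρ M (ρ ^ m) D ⟩
      (1ℚ + M) * (ρ * ρ ^ m * D)                    ≡⟨ cong (_* (ρ * ρ ^ m * D)) (fromℕ-suc (suc m)) ⟨
      fromℕ (suc (suc m)) * (ρ * ρ ^ m * D)         ∎
      where
      open ≤-Reasoning
      A B D M : ℚ
      A = a ^ suc m
      B = b ^ suc m
      D = ∣ a - b ∣
      M = fromℕ (suc m)

    term-lipschitz : ∀ k → ∣ artanhTerm k a - artanhTerm k b ∣ ≤ ∣ a - b ∣ * ρ ^ k
    term-lipschitz k = begin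
      ∣ A * u - B * u ∣                  ≡⟨ cong ∣_∣ (solve 3 (λ A B u → A :* u :- B :* u := (A :- B) :* u)
                                              refl A B u) ⟩
      ∣ (A - B) * u ∣                    ≡⟨ ∣p*q∣≡∣p∣*∣q∣ (A - B) u ⟩
      ∣ A - B ∣ * ∣ u ∣                  ≡⟨ cong (∣ A - B ∣ *_) (0≤p⇒∣p∣≡p (0≤recip (2 ℕ.* k))) ⟩
      ∣ A - B ∣ * u                      ≤⟨ *-monoʳ-≤-nonNeg u {{nonNegative (0≤recip (2 ℕ.* k))}}
                                              (^-lipschitz (2 ℕ.* k)) ⟩
      M * (x * D) * u                    ≡⟨ solve 4 (λ M x D u → M :* (x :* D) :* u := D :* x :* (M :* u))
                                              refl M x D u ⟩
      D * x * (M * u)                    ≡⟨ cong (D * x *_) (p*recip (0<fromℕ (2 ℕ.* k))) ⟩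
      D * x * 1ℚ                         ≡⟨ *-identityʳ (D * x) ⟩
      D * x                              ≤⟨ *-monoˡ-≤-nonNeg D {{∣-∣-nonNeg (a - b)}} (^2k≤^k k) ⟩
      D * ρ ^ k                          ∎
      where
      open ≤-Reasoning
      A B D M x u : ℚ
      A = a ^ suc (2 ℕ.* k)
      B = b ^ suc (2 ℕ.* k)
      D = ∣ a - b ∣
      M = fromℕ (suc (2 ℕ.* k))
      x = ρ ^ (2 ℕ.* k)
      u = recip M

    sum-lipschitz : ∀ n → ∣ artanhSum n a - artanhSum n b ∣ * h ≤ ∣ a - b ∣
    sum-lipschitz n = begin
      ∣ F n ∣ * h                        ≡⟨ cong (λ p → ∣ p ∣ * h) (+-identityʳ (F n)) ⟨
      ∣ F n - F 0 ∣ * h                  ≡⟨ cong (λ j → ∣ F j - F 0 ∣ * h) (ℕ.+-identityʳ n) ⟨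
      ∣ F (n ℕ.+ 0) - F 0 ∣ * h          ≤⟨ geometric F D step ρ<1 n 0 ⟩
      D * (1ℚ - ρ ^ (n ℕ.+ 0))           ≤⟨ *-monoˡ-≤-nonNeg D {{∣-∣-nonNeg (a - b)}}
                                              (+-monoʳ-≤ 1ℚ (neg-antimono-≤ (0≤^ 0≤ρ (n ℕ.+ 0)))) ⟩
      D * (1ℚ - 0ℚ)                      ≡⟨ *-identityʳ D ⟩
      D                                  ∎
      where
      open ≤-Reasoning
      F : ℕ → ℚ
      F j = artanhSum j a - artanhSum j b
      D : ℚ
      D = ∣ a - b ∣
      step : ∀ j → ∣ F (suc j) - F j ∣ ≤ D * ρ ^ j
      step j = subst (λ p → ∣ p ∣ ≤ D * ρ ^ j)
        (solve 4 (λ S t S′ t′ → t :- t′ := ((S :+ t) :- (S′ :+ t′)) :- (S :- S′)) refl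
          (artanhSum j a) (artanhTerm j a) (artanhSum j b) (artanhTerm j b))
        (term-lipschitz j)

  sum-tail : ∀ {z} → ∣ z ∣ ≤ ρ → ∀ {N n} → N ℕ.≤ n →
    ∣ artanhSum n z - artanhSum N z ∣ * h ≤ ρ ^ N
  sum-tail {z} hz {N} {n} N≤n = subst (λ j → ∣ F j - F N ∣ * h ≤ ρ ^ N) (ℕ.m∸n+n≡m N≤n) (begin
    ∣ F (d ℕ.+ N) - F N ∣ * h            ≤⟨ geometric F 1ℚ step ρ<1 d N ⟩
    1ℚ * (ρ ^ N - ρ ^ (d ℕ.+ N))         ≡⟨ *-identityˡ (ρ ^ N - ρ ^ (d ℕ.+ N)) ⟩
    ρ ^ N - ρ ^ (d ℕ.+ N)                ≤⟨ +-monoʳ-≤ (ρ ^ N) (neg-antimono-≤ (0≤^ 0≤ρ (d ℕ.+ N))) ⟩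
    ρ ^ N - 0ℚ                           ≡⟨ +-identityʳ (ρ ^ N) ⟩
    ρ ^ N                                ∎)
    where
    open ≤-Reasoning
    d : ℕ
    d = n ℕ.∸ N
    F : ℕ → ℚ
    F j = artanhSum j z
    step : ∀ j → ∣ F (suc j) - F j ∣ ≤ 1ℚ * ρ ^ j
    step j = subst₂ _≤_
      (cong ∣_∣ (solve 2 (λ S t → t := (S :+ t) :- S) refl (F j) (artanhTerm j z)))
      (sym (*-identityˡ (ρ ^ j))) (∣term∣≤ hz j)

artanh-cauchy : ∀ z → ∣ z ∣<1 → Cauchy λ n → artanhSum n (seq z n)
artanh-cauchy z (ρ , ρ<1 , M , hM) =
  scaled-cauchy {x} (recip h * fromℕ 3) (0<*0< (0<recip 0<h) (0<fromℕ 2)) λ δ 0<δ →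
    let N₁ , h₁ = cauchy z δ 0<δ
        N₂ , h₂ = ^-small 0≤ρ ρ<1 0<δ
        N       = M ℕ.⊔ N₁ ℕ.⊔ N₂
        ρᴺ≤δ : ρ ^ N ≤ δ
        ρᴺ≤δ = ≤-trans (subst (λ j → ρ ^ j ≤ ρ ^ N₂) (ℕ.m∸n+n≡m (ℕ.m≤n⊔m (M ℕ.⊔ N₁) N₂))
                 (^-anti 0≤ρ (<⇒≤ ρ<1) (N ℕ.∸ N₂) N₂)) h₂
    in N , λ m n N≤m N≤n →
      let K≤m = ≤⊔ˡ {M ℕ.⊔ N₁} N≤m
          K≤n = ≤⊔ˡ {M ℕ.⊔ N₁} N≤n
          hm  = hM m (≤⊔ˡ {M} K≤m)
          hn  = hM n (≤⊔ˡ {M} K≤n)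
      in combine N m n
           (≤-trans (sum-tail 0≤ρ ρ<1 hm N≤m) ρᴺ≤δ)
           (≤-trans (sum-lipschitz 0≤ρ ρ<1 hm hn N) (h₁ m n (≤⊔ʳ {M} K≤m) (≤⊔ʳ {M} K≤n)))
           (≤-trans (sum-tail 0≤ρ ρ<1 hn N≤n) ρᴺ≤δ)
  where
  open ≤-Reasoning
  x : ℕ → ℚ
  x n = artanhSum n (seq z n)
  h : ℚ
  h = 1ℚ - ρ
  0<h : 0ℚ < h
  0<h = <⇒0<- ρ<1
  0≤ρ : 0ℚ ≤ ρ
  0≤ρ = ≤-trans (0≤∣p∣ (seq z M)) (hM M ℕ.≤-refl)
  combine : ∀ {δ} N m n →
    ∣ artanhSum m (seq z m) - artanhSum N (seq z m) ∣ * h ≤ δ →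
    ∣ artanhSum N (seq z m) - artanhSum N (seq z n) ∣ * h ≤ δ →
    ∣ artanhSum n (seq z n) - artanhSum N (seq z n) ∣ * h ≤ δ →
    ∣ x m - x n ∣ ≤ recip h * fromℕ 3 * δ
  combine {δ} N m n e₁ e₂ e₃ = begin
    ∣ a - d ∣                                             ≡⟨ *-identityʳ ∣ a - d ∣ ⟨
    ∣ a - d ∣ * 1ℚ                                        ≡⟨ cong (∣ a - d ∣ *_) (p*recip 0<h) ⟨
    ∣ a - d ∣ * (h * recip h)                             ≡⟨ *-assoc ∣ a - d ∣ h (recip h) ⟨
    ∣ a - d ∣ * h * recip h                               ≤⟨ *-monoʳ-≤-nonNeg (recip h)
                                                               {{nonNegative (<⇒≤ (0<recip 0<h))}} bound ⟩
    (δ + δ + δ) * recip h                                 ≡⟨ solve 2 (λ δ u → (δ :+ δ :+ δ) :* u :=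
                                                               u :* con (fromℕ 3) :* δ) refl δ (recip h) ⟩
    recip h * fromℕ 3 * δ                                 ∎
    where
    a b c d : ℚ
    a = artanhSum m (seq z m)
    b = artanhSum N (seq z m)
    c = artanhSum N (seq z n)
    d = artanhSum n (seq z n)
    triangle : ∣ a - d ∣ ≤ ∣ a - b ∣ + ∣ b - c ∣ + ∣ d - c ∣
    triangle = begin
      ∣ a - d ∣                         ≡⟨ cong ∣_∣ (solve 4 (λ a b c d →
                                             a :- d := ((a :- b) :+ (b :- c)) :+ (c :- d)) refl a b c d) ⟩
      ∣ (a - b) + (b - c) + (c - d) ∣   ≤⟨ ∣p+q∣≤∣p∣+∣q∣ ((a - b) + (b - c)) (c - d) ⟩
      ∣ (a - b) + (b - c) ∣ + ∣ c - d ∣ ≤⟨ +-mono-≤ (∣p+q∣≤∣p∣+∣q∣ (a - b) (b - c))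
                                             (≤-reflexive (∣p-q∣≡∣q-p∣ c d)) ⟩
      ∣ a - b ∣ + ∣ b - c ∣ + ∣ d - c ∣ ∎
    bound : ∣ a - d ∣ * h ≤ δ + δ + δ
    bound = begin
      ∣ a - d ∣ * h                                 ≤⟨ *-monoʳ-≤-nonNeg h {{nonNegative (<⇒≤ 0<h)}} triangle ⟩
      (∣ a - b ∣ + ∣ b - c ∣ + ∣ d - c ∣) * h       ≡⟨ solve 4 (λ p q r h → (p :+ q :+ r) :* h :=
                                                         p :* h :+ q :* h :+ r :* h) refl
                                                         (∣ a - b ∣) (∣ b - c ∣) (∣ d - c ∣) h ⟩
      ∣ a - b ∣ * h + ∣ b - c ∣ * h + ∣ d - c ∣ * h ≤⟨ +-mono-≤ (+-mono-≤ e₁ e₂) e₃ ⟩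
      δ + δ + δ                                     ∎

artanh : (z : ℝ) → ∣ z ∣<1 → ℝ
artanh z ∣z∣<1 = mkℝ (λ n → artanhSum n (seq z n)) (artanh-cauchy z ∣z∣<1)

p≤artanhSum : 0ℚ ≤ p → ∀ n → p ≤ artanhSum (suc n) p
p≤artanhSum {p} 0≤p zero    = ≤-reflexive (sym (trans (+-identityˡ (p * 1ℚ * 1ℚ))
  (trans (*-identityʳ (p * 1ℚ)) (*-identityʳ p))))
p≤artanhSum {p} 0≤p (suc n) = ≤-trans (p≤artanhSum 0≤p n)
  (p≤p+q (0≤*0≤ (0≤^ 0≤p (suc (2 ℕ.* suc n))) (0≤recip (2 ℕ.* suc n))))

0<artanh : ∀ {z} (∣z∣<1 : ∣ z ∣<1) → 0ℝ <ℝ z → 0ℝ <ℝ artanh z ∣z∣<1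
0<artanh {z} ∣z∣<1 0<z =
  let δ , 0<δ , N , h = 0<ℝ-bound {z} 0<z
  in bound-0<ℝ {artanh z ∣z∣<1} (δ , 0<δ , suc N , λ where
       (suc n) N≤n → ≤-trans (h (suc n) (ℕ.≤-trans (ℕ.n≤1+n N) N≤n))
         (p≤artanhSum (≤-trans (<⇒≤ 0<δ) (h (suc n) (ℕ.≤-trans (ℕ.n≤1+n N) N≤n))) n))

cayley : (x : ℝ) → 0ℝ <ℝ x → ℝ
cayley x 0<x = (x -ℝ 1ℝ) *ℝ inv (x +ℝ 1ℝ) (0<1+ {x} 0<x)

cayley-bound : ∀ {a d η} → 0ℚ < d → d ≤ a → 0ℚ < η → η ≤ recip (a + 1ℚ) →
  ∣ (a - 1ℚ) * recip (a + 1ℚ) ∣ ≤ 1ℚ - η * (d ⊓ 1ℚ)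
cayley-bound {a} {d} {η} 0<d d≤a 0<η η≤u = ∣p∣≤
  (0≤-⇒≤ (subst (0ℚ ≤_)
    (trans (solve 3 (λ a u σ → u :+ (u :- σ) := ((a :+ con 1ℚ) :* u :- σ) :- (a :- con 1ℚ) :* u)
             refl a u σ)
      (cong (λ p → (p - σ) - (a - 1ℚ) * u) eq))
    (≤-trans 0≤u (p≤p+q (≤⇒0≤- σ≤u)))))
  (0≤-⇒≤ (subst (0ℚ ≤_)
    (trans (solve 3 (λ a u σ → u :* a :+ (u :* a :- σ) :=
                               ((a :+ con 1ℚ) :* u :- σ) :- (:- ((a :- con 1ℚ) :* u))) refl a u σ)
      (cong (λ p → (p - σ) - (- ((a - 1ℚ) * u))) eq))
    (≤-trans (0≤*0≤ 0≤u 0≤a) (p≤p+q (≤⇒0≤- σ≤ua)))))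
  where
  u σ : ℚ
  u = recip (a + 1ℚ)
  σ = η * (d ⊓ 1ℚ)
  0≤a : 0ℚ ≤ a
  0≤a = ≤-trans (<⇒≤ 0<d) d≤a
  0≤u : 0ℚ ≤ u
  0≤u = ≤-trans (<⇒≤ 0<η) η≤u
  0≤m : 0ℚ ≤ d ⊓ 1ℚ
  0≤m = <⇒≤ (0<⊓ 0<d 0<1)
  eq : (a + 1ℚ) * u ≡ 1ℚ
  eq = p*recip (<-≤-trans 0<d (≤-trans d≤a (p≤p+q (<⇒≤ 0<1))))
  σ≤u : σ ≤ u
  σ≤u = subst (σ ≤_) (*-identityʳ u) (*-mono-≤ (<⇒≤ 0<η) η≤u 0≤m (p⊓q≤q d 1ℚ))
  σ≤ua : σ ≤ u * a
  σ≤ua = *-mono-≤ (<⇒≤ 0<η) η≤u 0≤m (≤-trans (p⊓q≤p d 1ℚ) d≤a)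

∣cayley∣<1 : ∀ x (0<x : 0ℝ <ℝ x) → ∣ cayley x 0<x ∣<1
∣cayley∣<1 x 0<x =
  let d , 0<d , N , h = 0<ℝ-bound {x} 0<x
      η , 0<η , M , k = 0<ℝ-bound {inv (x +ℝ 1ℝ) (0<1+ {x} 0<x)} (0<inv {x +ℝ 1ℝ} (0<1+ {x} 0<x))
      σ = η * (d ⊓ 1ℚ)
  in 1ℚ - σ
     , subst (1ℚ - σ <_) (+-identityʳ 1ℚ)
         (+-monoʳ-< 1ℚ (neg-antimono-< (0<*0< 0<η (0<⊓ 0<d 0<1))))
     , N ℕ.⊔ M , λ n N≤n →
         cayley-bound 0<d (h n (≤⊔ˡ N≤n)) 0<η (k n (≤⊔ʳ {N} N≤n))

log : (x : ℝ) → 0ℝ <ℝ x → ℝ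
log x 0<x = 2ℝ *ℝ artanh (cayley x 0<x) (∣cayley∣<1 x 0<x)

0<2ℝ : 0ℝ <ℝ 2ℝ
0<2ℝ = bound-0<ℝ {2ℝ} (fromℕ 2 , 0<fromℕ 1 , 0 , λ _ _ → ≤-refl)

0<log : ∀ {x} (0<x : 0ℝ <ℝ x) → 1ℝ <ℝ x → 0ℝ <ℝ log x 0<x
0<log {x} 0<x (δ , 0<δ , N , h) =
  0<*ℝ {2ℝ} {artanh (cayley x 0<x) (∣cayley∣<1 x 0<x)} 0<2ℝ
    (0<artanh {cayley x 0<x} (∣cayley∣<1 x 0<x)
      (0<*ℝ {x -ℝ 1ℝ} {inv (x +ℝ 1ℝ) (0<1+ {x} 0<x)}
        (bound-0<ℝ {x -ℝ 1ℝ} (δ , 0<δ , N , λ n N≤n →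
          subst (_≤ seq x n - 1ℚ) (solve 1 (λ δ → con 1ℚ :+ δ :- con 1ℚ := δ) refl δ)
            (+-monoˡ-≤ (- 1ℚ) (h n N≤n))))
        (0<inv {x +ℝ 1ℝ} (0<1+ {x} 0<x))))

isqrtStep : ℕ → ℕ → ℕ
isqrtStep m r with suc r ℕ.* suc r ℕ.≤? m
... | yes _ = suc r
... | no  _ = r

isqrt : ℕ → ℕ
isqrt zero    = 0
isqrt (suc m) = isqrtStep (suc m) (isqrt m)

isqrt-lower : ∀ m → isqrt m ℕ.* isqrt m ℕ.≤ m
isqrt-lower zero    = ℕ.z≤n
isqrt-lower (suc m) with suc (isqrt m) ℕ.* suc (isqrt m) ℕ.≤? suc m
... | yes h = h
... | no  _ = ℕ.m≤n⇒m≤1+n (isqrt-lower m)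

isqrt-upper : ∀ m → m ℕ.< suc (isqrt m) ℕ.* suc (isqrt m)
isqrt-upper zero    = ℕ.s≤s ℕ.z≤n
isqrt-upper (suc m) with suc (isqrt m) ℕ.* suc (isqrt m) ℕ.≤? suc m
... | yes _ = ℕ.≤-<-trans (isqrt-upper m)
                (ℕ.*-mono-< (ℕ.n<1+n (suc (isqrt m))) (ℕ.n<1+n (suc (isqrt m))))
... | no ¬h = ℕ.≰⇒> ¬h

sqrtApprox : ℕ → ℕ → ℚ
sqrtApprox n k = fromℕ (isqrt (n ℕ.* (suc k ℕ.* suc k))) * recip (fromℕ (suc k))

module _ (n k : ℕ) where

  private
    m : ℕ
    m = n ℕ.* (suc k ℕ.* suc k)
    q₀ u K R N : ℚ
    q₀ = sqrtApprox n k
    K = fromℕ (suc k)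
    u = recip K
    R = fromℕ (isqrt m)
    N = fromℕ n
    0<u : 0ℚ < u
    0<u = 0<recip (0<fromℕ k)
    0≤uu : 0ℚ ≤ u * u
    0≤uu = <⇒≤ (0<*0< 0<u 0<u)
    Ku≡1 : K * u ≡ 1ℚ
    Ku≡1 = p*recip (0<fromℕ k)

    mu²≡n : fromℕ m * (u * u) ≡ N
    mu²≡n = begin
      fromℕ m * (u * u)           ≡⟨ cong (_* (u * u)) (trans (fromℕ-* n (suc k ℕ.* suc k))
                                       (cong (N *_) (fromℕ-* (suc k) (suc k)))) ⟩
      N * (K * K) * (u * u)       ≡⟨ solve 3 (λ N K u → N :* (K :* K) :* (u :* u) :=
                                       N :* ((K :* u) :* (K :* u))) refl N K u ⟩
      N * ((K * u) * (K * u))     ≡⟨ cong (λ p → N * (p * p)) Ku≡1 ⟩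
      N * (1ℚ * 1ℚ)               ≡⟨ *-identityʳ N ⟩
      N                           ∎
      where open ≡-Reasoning

  0≤sqrtApprox : 0ℚ ≤ q₀
  0≤sqrtApprox = 0≤*0≤ (0≤fromℕ (isqrt m)) (<⇒≤ 0<u)

  sqrtApprox-lower : q₀ * q₀ ≤ N
  sqrtApprox-lower = subst₂ _≤_
    (trans (cong (_* (u * u)) (fromℕ-* (isqrt m) (isqrt m)))
      (solve 2 (λ R u → R :* R :* (u :* u) := (R :* u) :* (R :* u)) refl R u))
    mu²≡n
    (*-monoʳ-≤-nonNeg (u * u) {{nonNegative 0≤uu}} (fromℕ-mono (isqrt-lower m)))

  sqrtApprox-upper : N < (q₀ + u) * (q₀ + u)
  sqrtApprox-upper = subst₂ _<_ mu²≡n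
    (trans (cong (_* (u * u)) (trans (fromℕ-* (suc (isqrt m)) (suc (isqrt m)))
             (cong (λ p → p * p) (fromℕ-suc (isqrt m)))))
      (solve 2 (λ R u → (con 1ℚ :+ R) :* (con 1ℚ :+ R) :* (u :* u) :=
        (R :* u :+ u) :* (R :* u :+ u)) refl R u))
    (*-monoˡ-<-pos (u * u) {{positive (0<*0< 0<u 0<u)}}
      (<-≤-trans (subst (fromℕ m <_) (sym (trans (fromℕ-suc m) (+-comm 1ℚ (fromℕ m)))) (p<p+q 0<1))
        (fromℕ-mono (isqrt-upper m))))

square-cancel-< : 0ℚ ≤ q → p * p < q * q → p < q
square-cancel-< {q} {p} 0≤q h = ≰⇒> λ q≤p → <-irrefl refl (<-≤-trans h (*-mono-≤ 0≤q q≤p 0≤q q≤p))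

0≤sqrtApprox+ : ∀ n k → 0ℚ ≤ sqrtApprox n k + recip (fromℕ (suc k))
0≤sqrtApprox+ n k = ≤-trans (0≤sqrtApprox n k) (p≤p+q (0≤recip k))

√ : ℕ → ℝ
√ n = mkℝ (sqrtApprox n) λ δ 0<δ →
  let N , h = recip-small 0<δ
  in N , λ k l N≤k N≤l → ∣p∣≤ (close k l (h l N≤l))
       (subst (_≤ δ) (solve 2 (λ a b → b :- a := :- (a :- b)) refl (sqrtApprox n k) (sqrtApprox n l))
         (close l k (h k N≤k)))
  where
  close : ∀ {δ} k l → recip (fromℕ (suc l)) ≤ δ → sqrtApprox n k - sqrtApprox n l ≤ δ
  close {δ} k l h = ≤-trans
    (subst (sqrtApprox n k - sqrtApprox n l ≤_)
      (solve 2 (λ b u → (b :+ u) :- b := u) refl (sqrtApprox n l) (recip (fromℕ (suc l))))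
      (+-monoˡ-≤ (- sqrtApprox n l) (<⇒≤ (square-cancel-< {p = sqrtApprox n k} (0≤sqrtApprox+ n l)
        (≤-<-trans (sqrtApprox-lower n k) (sqrtApprox-upper n l))))))
    h

0<√ : ∀ n .{{_ : ℕ.NonZero n}} → 0ℝ <ℝ √ n
0<√ (suc n) = bound-0<ℝ {√ (suc n)} (½ , 0<½ , 1 , λ where
  (suc k) _ →
    let a = sqrtApprox (suc n) (suc k)
        u = recip (fromℕ (suc (suc k)))
        1<a+u : 1ℚ < a + u
        1<a+u = square-cancel-< (0≤sqrtApprox+ (suc n) (suc k))
          (≤-<-trans (fromℕ-mono {1} {suc n} (ℕ.s≤s ℕ.z≤n)) (sqrtApprox-upper (suc n) (suc k)))
        u≤½ : u ≤ ½
        u≤½ = recip-anti (0<fromℕ 1) (fromℕ-mono {2} {suc (suc k)} (ℕ.s≤s (ℕ.s≤s ℕ.z≤n)))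
    in ≤-trans
         (+-monoʳ-≤ 1ℚ (neg-antimono-≤ u≤½))
         (subst (1ℚ - u ≤_) (solve 2 (λ a u → (a :+ u) :- u := a) refl a u)
           (+-monoˡ-≤ (- u) (<⇒≤ 1<a+u))))

0<ℕtoℝ : ∀ n .{{_ : ℕ.NonZero n}} → 0ℝ <ℝ ℕtoℝ n
0<ℕtoℝ (suc n) = bound-0<ℝ {ℕtoℝ (suc n)} (fromℕ (suc n) , 0<fromℕ n , 0 , λ _ _ → ≤-refl)

infix 4 _≈ℂ_
infixl 6 _+ℂ_
infixl 7 _*ℂ_

record ℂ : Set where
  constructor _+i_
  field
    re im : ℝ
open ℂ

_≈ℂ_ : ℂ → ℂ → Set
z ≈ℂ w = re z ≈ℝ re w × im z ≈ℝ im w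

_+ℂ_ _*ℂ_ : ℂ → ℂ → ℂ
z +ℂ w = (re z +ℝ re w) +i (im z +ℝ im w)
z *ℂ w = (re z *ℝ re w -ℝ im z *ℝ im w) +i (re z *ℝ im w +ℝ im z *ℝ re w)

ℝtoℂ : ℝ → ℂ
ℝtoℂ x = x +i 0ℝ

0ℂ : ℂ
0ℂ = ℝtoℂ 0ℝ

-- K[x₁,…,xₙ]₂ in the monomial basis: g i j i≤j is the coefficient of xᵢxⱼ.
Form₂ : Set → ℕ → Set
Form₂ K n = (i j : Fin n) → .(i Fin.≤ j) → K

LinearForm : ℕ → Set
LinearForm n = Fin n → ℂ

_·_ : ∀ {n} → LinearForm n → LinearForm n → Form₂ ℂ n
(ℓ · m) i j _ with i Fin.≟ j
... | yes _ = ℓ i *ℂ m i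
... | no  _ = ℓ i *ℂ m j +ℂ ℓ j *ℂ m i

sumOfSquares : ∀ {n r} → (Fin r → LinearForm n) → Form₂ ℂ n
sumOfSquares ℓ i j i≤j = foldr _+ℂ_ 0ℂ λ k → (ℓ k · ℓ k) i j i≤j

complexify : ∀ {n} → Form₂ ℝ n → Form₂ ℂ n
complexify g i j i≤j = ℝtoℂ (g i j i≤j)

IsSumOfSquares : ∀ {n} → Form₂ ℂ n → ℕ → Set
IsSumOfSquares {n} g r = ∃[ ℓ ] ∀ i j .(i≤j : i Fin.≤ j) →
  g i j i≤j ≈ℂ sumOfSquares {n} {r} ℓ i j i≤j

IsMinimum : (ℕ → Set) → ℕ → Set
IsMinimum P m = P m × (∀ k → P k → m ℕ.≤ k)

WaringRank≡ : ∀ {n} → Form₂ ℂ n → ℕ → Set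
WaringRank≡ g = IsMinimum (IsSumOfSquares g)

record Admissible (ε : ℝ) {n} (g : Form₂ ℝ n) : Set where
  field
    support : ∀ i j .(i≤j : i Fin.≤ j) → (¬ g i j i≤j ≈ℝ 0ℝ) ⇔ (i Fin.< j)
    range   : ∀ i j .(i≤j : i Fin.≤ j) → ¬ g i j i≤j ≈ℝ 0ℝ →
              1ℝ -ℝ ε ≤ℝ g i j i≤j × g i j i≤j ≤ℝ 1ℝ +ℝ ε

-- A relation rather than a function: constructively, an inhabited set of
-- naturals need not have a minimum.
A^_[_,2]≡_ : ℝ → ℕ → ℕ → Set
A^ ε [ n ,2]≡ a =
  IsMinimum (λ r → Σ (Form₂ ℝ n) λ g → Admissible ε g × WaringRank≡ (complexify g) r) a

{-# OPTIONS --safe #-}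

-- Everything happens on the rational terms of the Cauchy sequences.
--
-- Lower bound.  Let g have coefficients in [1 - ε, 1 + ε] and be a sum of r
-- complex squares.  Taking real parts, the matrix B with diagonal 1 and
-- entries 1 - gᵢⱼ elsewhere has entries affine in 2r vectors, and is close to
-- the identity.  Its k-th entrywise power has rank at most (2r + k choose k),
-- since its columns are polynomials of degree ≤ k in those vectors, while a
-- matrix with unit diagonal satisfies (trace X)² ≤ rank X · ∑ Xᵢⱼ².  Choosing
-- k with ε⁻²ᵏ ≈ n (dyadically: 2⁻ʲ ≥ ε, q = 4ʲ, qᵏ ≤ n < qᵏ⁺¹) gives
-- qᵏ ≤ 2 (2r + k choose k), which forces r = Ω(k q).
--
-- Upper bound.  Choose sign vectors v₁, …, vₙ of length d = O(ε⁻² log n)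
-- greedily so that all ∣⟨vᵢ, vⱼ⟩∣ ≤ ε d, and take
-- g = ½ ((∑ xᵢ)² - (1/d) ∑ₖ (∑ᵢ vᵢₖ xᵢ)²), whose xᵢ² coefficients vanish.

module Submission where

open import Defs
open import Data.Nat.Base using (ℕ; NonZero)
open import Data.Product.Base using (_×_; ∃-syntax)

import Algebra.Definitions.RawSemiring
import Algebra.Properties.CommutativeSemiring.Exp
import Algebra.Properties.Semiring.Sum
open import Algebra.Bundles using (CommutativeRing)
open import Data.Empty using (⊥-elim)
open import Data.Fin.Base as Fin using (Fin; zero; suc; punchIn)
import Data.Fin.Properties as Finₚ using (<-cmp; <-irrefl; punchInᵢ≢i; _≟_; _≤?_; ≤∧≢⇒<)
open import Data.Nat.Base as ℕ using (zero; suc)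
import Data.Nat.Properties as ℕ
  using (*-assoc; *-cancelʳ-≤; *-cancelˡ-≤; *-comm; *-distribʳ-+; *-identityʳ; *-identityˡ; *-mono-≤;
         *-monoʳ-≤; *-monoˡ-<; *-monoˡ-≤; +-cancelʳ-≤; +-comm; +-identityʳ; +-mono-≤; +-monoʳ-≤; +-monoˡ-≤;
         +-suc; <⇒≤; <⇒≱; [m*n]*[o*p]≡[m*o]*[n*p]; ^-*-assoc; ^-distribˡ-+-*; ^-identityʳ;
         ^-monoʳ-<; ^-monoʳ-≤; ^-monoˡ-<; ^-monoˡ-≤; m*n≢0; m+[n∸m]≡n; m^n>0; m^n≢0; m∸n+n≡m; m≤m+n;
         m≤m⊔n; m≤n+m; m≤n⇒m≤1+n; m≤n⊔m; n<1+n; n≤1+n; suc-pred; ≤-<-trans; module ≤-Reasoning;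
         ≤-antisym; ≤-refl; ≤-reflexive; ≤-trans; _≤?_; ≮⇒≥; ≰⇒>)
open import Data.Nat.Solver renaming (module +-*-Solver to ℕ-Solver)
open import Data.Product.Base using (Σ; _,_; proj₁; proj₂)
open import Data.Rational.Base
  using (ℚ; 0ℚ; 1ℚ; ½; _+_; _*_; _-_; -_; ∣_∣; _≤_; _<_; +-*-rawSemiring; positive; nonNegative)
open import Data.Rational.Properties
  using (*-assoc; *-cancelʳ-≤-pos; *-cancelˡ-≤-pos; *-comm; *-distribʳ-+; *-identityʳ; *-identityˡ;
         *-monoʳ-≤-nonNeg; *-monoˡ-≤-nonNeg; *-zeroʳ; *-zeroˡ; +-assoc; +-comm; +-identityʳ; +-identityˡ;
         +-inverseʳ; +-mono-<; +-mono-≤; +-monoʳ-<; +-monoʳ-≤; +-monoˡ-<; +-monoˡ-≤; +-*-commutativeRing;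
         0≤p⇒∣p∣≡p; 0≤∣p∣; ∣p*q∣≡∣p∣*∣q∣; ∣p+q∣≤∣p∣+∣q∣; <-cmp; <-irrefl; <-≤-trans; ≤-<-trans; <⇒≤;
         neg-antimono-<; neg-antimono-≤; positive⁻¹; _≤?_; ≤-antisym; ≤-refl; ≤-reflexive; ≤-total;
         ≤-trans; ≮⇒≥; ≰⇒>; module ≤-Reasoning)
open import Data.Rational.Solver using (module +-*-Solver)
open import Data.Sum.Base using (_⊎_; inj₁; inj₂)
open import Data.Vec.Functional using (foldr; _∷_)
open import Function.Base using (_∘_)
open import Function.Bundles using (Equivalence; mk⇔)
open import Relation.Binary.Definitions using (Tri; tri<; tri≈; tri>)
open import Relation.Binary.PropositionalEquality
  using (_≡_; _≢_; refl; sym; trans; cong; cong₂; subst; subst₂; module ≡-Reasoning)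
open import Relation.Nullary.Decidable using (yes; no; decidable-stable; recompute)
open import Relation.Nullary.Negation using (¬_)

open ℝ
open ℂ
open Algebra.Definitions.RawSemiring +-*-rawSemiring using (_^_)
open Algebra.Properties.Semiring.Sum (CommutativeRing.semiring +-*-commutativeRing)
  using (sum; sum-cong-≗; ∑-distrib-+; ∑-comm; *-distribˡ-sum; *-distribʳ-sum; sum-remove)
open Algebra.Properties.CommutativeSemiring.Exp (CommutativeRing.commutativeSemiring +-*-commutativeRing)
  using (^-distrib-*; ^-homo-*; ^-assocʳ)
open +-*-Solver using (solve; con; _:=_; _:+_; _:*_; _:-_; :-_)

-- Without powers, the trace inequality gives only r = Ω(ε⁻²), as an approximate identity may have
-- rank about ε⁻² for every n. The entrywise power k squeezes the off-diagonal entries to about εᵏ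
-- at the cost of a larger dimension. It pays until n ε²ᵏ is about 1, that is for k about log n /
-- log(ε⁻²), which is where the denominator log(ε⁻¹) comes from. The hypothesis 1/√n ≤ ε guarantees
-- k ≥ 1. Order on the reals is undecidable and a Waring rank need not be computable. Hence strict
-- inequalities are kept with a rational gap that absorbs the errors of approximation, dyadic scales
-- are located only up to a factor 4, and minima are used only through decidable conclusions.
-- Logarithms enter only through doubling: one factor 2 in x changes the partial sums of artanh((x -
-- 1) / (x + 1)) by at most 1 and, far enough out, by at least 1/8. These two numbers and the factor
-- 4 in the scale account for most of the constants 2⁻¹⁴ and 1664.

private variable
  m n r s k : ℕ

-- Ranks of rational matrices

Matrix : ℕ → Set
Matrix n = Fin n → Fin n → ℚ

1^ : ∀ k → 1ℚ ^ k ≡ 1ℚ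
1^ zero    = refl
1^ (suc k) = trans (*-identityˡ (1ℚ ^ k)) (1^ k)

0≤² : ∀ p → 0ℚ ≤ p * p
0≤² p with ≤-total 0ℚ p
... | inj₁ 0≤p = 0≤*0≤ 0≤p 0≤p
... | inj₂ p≤0 = subst (0ℚ ≤_) (solve 1 (λ p → :- p :* :- p := p :* p) refl p)
  (0≤*0≤ (neg-antimono-≤ p≤0) (neg-antimono-≤ p≤0))

0≤⇒0≡∨0< : ∀ {p} → 0ℚ ≤ p → p ≡ 0ℚ ⊎ 0ℚ < p
0≤⇒0≡∨0< {p} 0≤p with p ≤? 0ℚ
... | yes p≤0 = inj₁ (≤-antisym p≤0 0≤p)
... | no  p≰0 = inj₂ (≰⇒> p≰0)

sum-mono : {f g : Fin n → ℚ} → (∀ i → f i ≤ g i) → sum f ≤ sum g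
sum-mono {zero}  f≤g = ≤-refl
sum-mono {suc n} {f} {g} f≤g = +-mono-≤ (f≤g zero) (sum-mono {f = f ∘ suc} {g ∘ suc} (f≤g ∘ suc))

sum-const : ∀ n c → sum {n} (λ _ → c) ≡ fromℕ n * c
sum-const zero    c = sym (*-zeroˡ c)
sum-const (suc n) c = trans (cong (c +_) (sum-const n c))
  (trans (solve 2 (λ n c → c :+ n :* c := (con 1ℚ :+ n) :* c) refl (fromℕ n) c)
    (cong (_* c) (sym (fromℕ-suc n))))

0≤sum : {f : Fin n → ℚ} → (∀ i → 0ℚ ≤ f i) → 0ℚ ≤ sum f
0≤sum {n} {f} 0≤f = subst (_≤ sum f) (trans (sum-const n 0ℚ) (*-zeroʳ (fromℕ n))) (sum-mono {f = λ _ → 0ℚ} {f} 0≤f)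

sum≡0 : {f : Fin n → ℚ} → (∀ i → f i ≡ 0ℚ) → sum f ≡ 0ℚ
sum≡0 {n} {f} f≡0 = trans (sum-cong-≗ {x = f} {λ _ → 0ℚ} f≡0) (trans (sum-const n 0ℚ) (*-zeroʳ (fromℕ n)))

sum²≡0 : ∀ {n} (w : Fin n → ℚ) → sum (λ i → w i * w i) ≡ 0ℚ → ∀ i → w i ≡ 0ℚ
sum²≡0 {suc n} w eq = λ where
    zero    → head≡0
    (suc i) → sum²≡0 (w ∘ suc) tail≡0 i
  where
  a b : ℚ
  a = w zero * w zero
  b = sum (λ i → w (suc i) * w (suc i))
  0≤b : 0ℚ ≤ b
  0≤b = 0≤sum {f = λ i → w (suc i) * w (suc i)} λ i → 0≤² (w (suc i))
  a≡0 : a ≡ 0ℚ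
  a≡0 = ≤-antisym (subst (a ≤_) eq (p≤p+q 0≤b)) (0≤² (w zero))
  tail≡0 : b ≡ 0ℚ
  tail≡0 = trans (sym (+-identityˡ b)) (trans (cong (_+ b) (sym a≡0)) eq)
  head≡0 : w zero ≡ 0ℚ
  head≡0 with <-cmp 0ℚ (w zero)
  ... | tri< 0<w _ _ = ⊥-elim (<-irrefl (sym a≡0) (0<*0< 0<w 0<w))
  ... | tri≈ _ 0≡w _ = sym 0≡w
  ... | tri> _ _ w<0 = ⊥-elim (<-irrefl
    (sym (trans (solve 1 (λ p → :- p :* :- p := p :* p) refl (w zero)) a≡0))
    (0<*0< (neg-antimono-< w<0) (neg-antimono-< w<0)))

-- Rank is recorded as a decomposition into outer products w vᵀ. The vectors may be zero or
-- dependent, so r is only an upper bound and no elimination is ever performed.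
data Rank≤ {n} : ℕ → Matrix n → Set where
  zero : ∀ {X} → (∀ i j → X i j ≡ 0ℚ) → Rank≤ 0 X
  suc  : ∀ {r X Y} (w v : Fin n → ℚ) → (∀ i j → X i j ≡ w i * v j + Y i j) →
         Rank≤ r Y → Rank≤ (suc r) X

Rank≤-resp : {X Y : Matrix n} → (∀ i j → X i j ≡ Y i j) → Rank≤ r X → Rank≤ r Y
Rank≤-resp X≡Y (zero X≡0)      = zero λ i j → trans (sym (X≡Y i j)) (X≡0 i j)
Rank≤-resp X≡Y (suc w v eq rY) = suc w v (λ i j → trans (sym (X≡Y i j)) (eq i j)) rY

Rank≤-+ : {X Y : Matrix n} → Rank≤ r X → Rank≤ s Y → Rank≤ (r ℕ.+ s) (λ i j → X i j + Y i j)
Rank≤-+ {Y = Y} (zero X≡0) rY = Rank≤-resp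
  (λ i j → sym (trans (cong (_+ Y i j) (X≡0 i j)) (+-identityˡ (Y i j)))) rY
Rank≤-+ {Y = Y} (suc {Y = Z} w v eq rZ) rY = suc w v
  (λ i j → trans (cong (_+ Y i j) (eq i j)) (+-assoc (w i * v j) (Z i j) (Y i j))) (Rank≤-+ rZ rY)

-- A linear map applied to every column acts on an outer product w vᵀ through w alone. It is used
-- for scaling rows and for projecting away from a vector.
Rank≤-left : {X Y : Matrix n} (φ : (Fin n → ℚ) → (Fin n → ℚ)) →
  (∀ {f g} → (∀ i → f i ≡ g i) → ∀ i → φ f i ≡ φ g i) →
  (∀ i → φ (λ _ → 0ℚ) i ≡ 0ℚ) →
  (∀ f g c i → φ (λ l → f l * c + g l) i ≡ φ f i * c + φ g i) →
  (∀ i j → Y i j ≡ φ (λ l → X l j) i) → Rank≤ r X → Rank≤ r Y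
Rank≤-left φ φ-cong φ-0 φ-linear Y≡ (zero X≡0) = zero λ i j →
  trans (Y≡ i j) (trans (φ-cong (λ l → X≡0 l j) i) (φ-0 i))
Rank≤-left φ φ-cong φ-0 φ-linear Y≡ (suc {Y = Z} w v eq rZ) = suc (φ w) v
  (λ i j → trans (Y≡ i j) (trans (φ-cong (λ l → eq l j) i) (φ-linear w (λ l → Z l j) (v j) i)))
  (Rank≤-left φ φ-cong φ-0 φ-linear (λ i j → refl) rZ)

Rank≤-rows : {X : Matrix n} (w : Fin n → ℚ) → Rank≤ r X → Rank≤ r (λ i j → w i * X i j)
Rank≤-rows w = Rank≤-left (λ f i → w i * f i)
  (λ f≡g i → cong (w i *_) (f≡g i))
  (λ i → *-zeroʳ (w i))
  (λ f g c i → solve 4 (λ w f g c → w :* (f :* c :+ g) := w :* f :* c :+ w :* g) refl (w i) (f i) (g i) c)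
  (λ i j → refl)

trace frobenius² : Matrix n → ℚ
trace X      = sum λ i → X i i
frobenius² X = sum λ i → sum λ j → X i j * X i j

module _ {n} (w : Fin n → ℚ) where

  private
    t : ℚ
    t = recip (sum λ i → w i * w i)

  dot : (Fin n → ℚ) → ℚ
  dot f = sum λ i → w i * f i

  dot-linear : ∀ f g c → dot (λ l → f l * c + g l) ≡ dot f * c + dot g
  dot-linear f g c = trans
    (sum-cong-≗ λ i → solve 4 (λ w f g c → w :* (f :* c :+ g) := w :* f :* c :+ w :* g) refl (w i) (f i) (g i) c)
    (trans (∑-distrib-+ (λ i → w i * f i * c) (λ i → w i * g i))
      (cong (_+ dot g) (sym (*-distribʳ-sum c (λ i → w i * f i)))))

  project : (Fin n → ℚ) → (Fin n → ℚ)
  project f i = f i - w i * (t * dot f)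

  dot-cong : ∀ {f g} → (∀ i → f i ≡ g i) → dot f ≡ dot g
  dot-cong f≡g = sum-cong-≗ λ i → cong (w i *_) (f≡g i)

  project-cong : ∀ {f g} → (∀ i → f i ≡ g i) → ∀ i → project f i ≡ project g i
  project-cong f≡g i = cong₂ (λ a b → a - w i * (t * b)) (f≡g i) (dot-cong f≡g)

  project-linear : ∀ f g c i → project (λ l → f l * c + g l) i ≡ project f i * c + project g i
  project-linear f g c i = trans (cong (λ d → f i * c + g i - w i * (t * d)) (dot-linear f g c))
    (solve 7 (λ a b c w t x y → a :* c :+ b :- w :* (t :* (x :* c :+ y)) :=
      (a :- w :* (t :* x)) :* c :+ (b :- w :* (t :* y))) refl (f i) (g i) c (w i) t (dot f) (dot g))

  project-0 : ∀ i → project (λ _ → 0ℚ) i ≡ 0ℚ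
  project-0 i = trans (cong (λ d → 0ℚ - w i * (t * d)) (sum≡0 {f = λ l → w l * 0ℚ} λ l → *-zeroʳ (w l)))
    (solve 2 (λ w t → con 0ℚ :- w :* (t :* con 0ℚ) := con 0ℚ) refl (w i) t)

  dot² : ℚ
  dot² = dot w

  0≤dot² : 0ℚ ≤ dot²
  0≤dot² = 0≤sum {f = λ i → w i * w i} λ i → 0≤² (w i)

  -- For w = 0 the convention `recip 0ℚ ≡ 0ℚ` makes the left side 0, and `dot f` vanishes as well.
  -- So `project` is the orthogonal projection away from w in every case, being the identity when w
  -- = 0.
  dot*recip : ∀ f → dot² * (t * dot f) ≡ dot f
  dot*recip f with 0≤⇒0≡∨0< 0≤dot²
  ... | inj₁ eq = trans (cong (_* (t * dot f)) eq) (trans (*-zeroˡ (t * dot f)) (sym (sum≡0 {f = λ i → w i * f i}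
    λ i → trans (cong (_* f i) (sum²≡0 w eq i)) (*-zeroˡ (f i)))))
  ... | inj₂ 0<dot² = trans (sym (*-assoc dot² t (dot f)))
    (trans (cong (_* dot f) (p*recip 0<dot²)) (*-identityˡ (dot f)))

  dot-project : ∀ f → dot (project f) ≡ 0ℚ
  dot-project f = trans
    (trans (sum-cong-≗ λ i → cong (w i *_) (solve 3 (λ a w c → a :- w :* c := w :* (:- c) :+ a) refl
        (f i) (w i) (t * dot f)))
      (dot-linear w f (- (t * dot f))))
    (trans (solve 3 (λ a b c → a :* (:- c) :+ b := b :- a :* c) refl dot² (dot f) (t * dot f))
      (trans (cong (λ a → dot f - a) (dot*recip f)) (+-inverseʳ (dot f))))

  project-self : ∀ i → project w i ≡ 0ℚ
  project-self i with 0≤⇒0≡∨0< 0≤dot²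
  ... | inj₁ eq = trans (cong (λ a → a - a * (t * dot w)) (sum²≡0 w eq i))
    (solve 1 (λ c → con 0ℚ :- con 0ℚ :* c := con 0ℚ) refl (t * dot w))
  ... | inj₂ 0<dot² = trans (cong (λ a → w i - w i * a)
      (trans (*-comm t (dot w)) (p*recip 0<dot²)))
    (solve 1 (λ c → c :- c :* con 1ℚ := con 0ℚ) refl (w i))

  -- The difference of the two sides is `dot²` times the squared norm of `project u`.
  cauchy-schwarz : ∀ u → dot u * dot u ≤ dot² * sum (λ i → u i * u i)
  cauchy-schwarz u = 0≤-⇒≤ (subst (0ℚ ≤_)
    (trans (cong (dot² *_) norm)
      (trans (solve 4 (λ W U x t → W :* (U :+ (x :* con 1ℚ :+ con 0ℚ) :* (:- (t :* x))) :=
          W :* U :- W :* (t :* x) :* x) refl dot² U (dot u) t)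
        (cong (λ a → dot² * U - a * dot u) (dot*recip u))))
    (0≤*0≤ 0≤dot² (0≤sum {f = λ i → p i * p i} λ i → 0≤² (p i))))
    where
    c U : ℚ
    c = t * dot u
    U = sum λ i → u i * u i
    p : Fin n → ℚ
    p = project u
    norm : sum (λ i → p i * p i) ≡ U + (dot u * 1ℚ + 0ℚ) * (- c)
    norm = trans
      (sum-cong-≗ λ i → solve 3 (λ u w c → (u :- w :* c) :* (u :- w :* c) :=
        u :* u :+ w :* (u :* con 1ℚ :+ (u :- w :* c)) :* (:- c)) refl (u i) (w i) c)
      (trans (∑-distrib-+ (λ i → u i * u i) (λ i → w i * (u i * 1ℚ + p i) * (- c)))
        (cong (U +_) (trans (sym (*-distribʳ-sum (- c) (λ i → w i * (u i * 1ℚ + p i))))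
          (cong (_* (- c)) (trans (dot-linear u p 1ℚ) (cong (dot u * 1ℚ +_) (dot-project u)))))))

-- Gram–Schmidt without normalisation: X is split as w vᵀ + X′ with the
-- columns of X′ orthogonal to w, and X′ still has rank ≤ r.
trace²≤ : {X : Matrix n} → Rank≤ r X → trace X * trace X ≤ fromℕ r * frobenius² X
trace²≤ {n} {X = X} (zero X≡0) = ≤-reflexive (trans
  (cong (λ a → a * a) (sum≡0 {f = λ i → X i i} λ i → X≡0 i i)) (sym (*-zeroˡ (frobenius² X))))
trace²≤ {n} {suc r} {X} (suc {Y = Y} w v eq rY) = subst₂ (λ a b → a * a ≤ b)
  (sym trace-split)
  (sym (cong₂ _*_ (fromℕ-suc r) frobenius-split))
  (combine {dot w u} {trace X′} {dot w w * dot u u} {frobenius² X′} (fromℕ r) (0≤fromℕ r) (cauchy-schwarz w u) (trace²≤ rX′)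
    (0≤*0≤ (0≤dot² w) (0≤dot² u)) (0≤sum {f = λ i → sum λ j → X′ i j * X′ i j} λ i →
      0≤sum {f = λ j → X′ i j * X′ i j} λ j → 0≤² (X′ i j)))
  where
  X′ : Matrix n
  X′ i j = project w (λ l → X l j) i
  u : Fin n → ℚ
  u j = recip (dot w w) * dot w (λ l → X l j)
  X≡ : ∀ i j → X i j ≡ w i * u j + X′ i j
  X≡ i j = solve 2 (λ a b → a := b :+ (a :- b)) refl (X i j) (w i * u j)
  ⊥w : ∀ j → dot w (λ i → X′ i j) ≡ 0ℚ
  ⊥w j = dot-project w (λ l → X l j)
  rX′ : Rank≤ r X′
  rX′ = Rank≤-left (project w) (project-cong w) (project-0 w) (project-linear w)
    (λ i j → trans (project-cong w (λ l → eq l j) i)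
      (trans (project-linear w w (λ l → Y l j) (v j) i)
        (trans (cong (λ a → a * v j + project w (λ l → Y l j) i) (project-self w i))
          (solve 2 (λ c d → con 0ℚ :* c :+ d := d) refl (v j) (project w (λ l → Y l j) i))))) rY
  trace-split : trace X ≡ dot w u + trace X′
  trace-split = trans (sum-cong-≗ λ i → X≡ i i) (∑-distrib-+ (λ i → w i * u i) (λ i → X′ i i))
  column : ∀ j → sum (λ i → X i j * X i j) ≡ dot w w * (u j * u j) + sum (λ i → X′ i j * X′ i j)
  column j = trans (sum-cong-≗ λ i → trans (cong (λ a → a * a) (X≡ i j))
      (solve 3 (λ w u x → (w :* u :+ x) :* (w :* u :+ x) :=
        w :* (w :* (u :* u) :+ x :* (con (fromℕ 2) :* u)) :+ x :* x) refl (w i) (u j) (X′ i j)))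
    (trans (∑-distrib-+ (λ i → w i * (w i * (u j * u j) + X′ i j * (fromℕ 2 * u j))) (λ i → X′ i j * X′ i j))
      (cong (_+ sum (λ i → X′ i j * X′ i j)) (trans (dot-linear w w (λ i → X′ i j * (fromℕ 2 * u j)) (u j * u j))
        (trans (cong (dot w w * (u j * u j) +_) (trans
            (sum-cong-≗ λ i → sym (*-assoc (w i) (X′ i j) (fromℕ 2 * u j)))
            (trans (sym (*-distribʳ-sum (fromℕ 2 * u j) (λ i → w i * X′ i j)))
              (trans (cong (_* (fromℕ 2 * u j)) (⊥w j)) (*-zeroˡ (fromℕ 2 * u j))))))
          (+-identityʳ (dot w w * (u j * u j)))))))
  frobenius-split : frobenius² X ≡ dot w w * dot u u + frobenius² X′
  frobenius-split = trans (∑-comm (λ i j → X i j * X i j)) (trans (sum-cong-≗ column)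
    (trans (∑-distrib-+ (λ j → dot w w * (u j * u j)) (λ j → sum (λ i → X′ i j * X′ i j)))
      (cong₂ _+_ (sym (*-distribˡ-sum (dot w w) (λ j → u j * u j))) (sym (∑-comm (λ i j → X′ i j * X′ i j))))))
  -- For R > 0, R times the difference of the two sides is (R x - y)² plus nonnegative multiples of
  -- X - x² and R Y - y². This requires dividing by R, so R = 0 is separate; there y = 0.
  combine : ∀ {x y X Y} R → 0ℚ ≤ R → x * x ≤ X → y * y ≤ R * Y → 0ℚ ≤ X → 0ℚ ≤ Y →
    (x + y) * (x + y) ≤ (1ℚ + R) * (X + Y)
  combine {x} {y} {X} {Y} R 0≤R hx hy 0≤X 0≤Y with 0≤⇒0≡∨0< 0≤R
  ... | inj₁ refl = subst₂ _≤_
    (sym (trans (cong (λ z → (x + z) * (x + z)) y≡0) (cong₂ _*_ (+-identityʳ x) (+-identityʳ x))))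
    (sym (*-identityˡ (X + Y)))
    (≤-trans hx (p≤p+q 0≤Y))
    where
    y≡0 : y ≡ 0ℚ
    y≡0 = sum²≡0 {1} (λ _ → y) (trans (+-identityʳ (y * y))
      (≤-antisym (subst (y * y ≤_) (*-zeroˡ Y) hy) (0≤² y))) zero
  ... | inj₂ 0<R = *-cancelˡ-≤-pos R {{positive 0<R}} (0≤-⇒≤ (subst (0ℚ ≤_)
    (solve 5 (λ x y R X Y → (R :* x :- y) :* (R :* x :- y) :+ (R :* (con 1ℚ :+ R) :* (X :- x :* x)
        :+ (con 1ℚ :+ R) :* (R :* Y :- y :* y)) :=
      R :* ((con 1ℚ :+ R) :* (X :+ Y)) :- R :* ((x :+ y) :* (x :+ y))) refl x y R X Y)
    (≤-trans (0≤² (R * x - y)) (p≤p+q (≤-trans (0≤*0≤ (0≤*0≤ 0≤R 0≤1+R) (≤⇒0≤- hx))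
      (p≤p+q (0≤*0≤ 0≤1+R (≤⇒0≤- hy))))))))
    where
    0≤1+R : 0ℚ ≤ 1ℚ + R
    0≤1+R = <⇒≤ (0<+0≤ 0<1 0≤R)

-- Rank of matrices whose columns are polynomials in few vectors

-- The columns of X are polynomials of degree ≤ k in the vectors u₀, …, uₘ₋₁,
-- multiplied entrywise.
data Polynomial {n} : (m : ℕ) → (Fin m → Fin n → ℚ) → ℕ → Matrix n → Set where
  const₀ : ∀ {u k} {X : Matrix n} (v : Fin n → ℚ) → (∀ i j → X i j ≡ v j) → Polynomial zero u k X
  const₁ : ∀ {m u} {X : Matrix n} (v : Fin n → ℚ) → (∀ i j → X i j ≡ v j) → Polynomial (suc m) u zero X
  horner : ∀ {m u k} {X Y Z : Matrix n} → (∀ i j → X i j ≡ Y i j + u zero i * Z i j) →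
           Polynomial m (u ∘ suc) (suc k) Y → Polynomial (suc m) u k Z →
           Polynomial (suc m) u (suc k) X

-- Pascal's recursion for the binomial coefficient (m + k choose k), with the same cases as
-- `Polynomial`: `horner` splits off either a variable or a degree.
dimension : ℕ → ℕ → ℕ
dimension zero    k       = 1
dimension (suc m) zero    = 1
dimension (suc m) (suc k) = dimension m (suc k) ℕ.+ dimension (suc m) k

Polynomial⇒Rank≤ : ∀ {u} {X : Matrix n} → Polynomial m u k X → Rank≤ (dimension m k) X
Polynomial⇒Rank≤ (const₀ v eq) = suc (λ _ → 1ℚ) v
  (λ i j → trans (eq i j) (solve 1 (λ a → a := con 1ℚ :* a :+ con 0ℚ) refl (v j))) (zero λ _ _ → refl)
Polynomial⇒Rank≤ (const₁ v eq) = suc (λ _ → 1ℚ) v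
  (λ i j → trans (eq i j) (solve 1 (λ a → a := con 1ℚ :* a :+ con 0ℚ) refl (v j))) (zero λ _ _ → refl)
Polynomial⇒Rank≤ {u = u} (horner eq pY pZ) = Rank≤-resp (λ i j → sym (eq i j))
  (Rank≤-+ (Polynomial⇒Rank≤ pY) (Rank≤-rows (u zero) (Polynomial⇒Rank≤ pZ)))

Polynomial-const : ∀ m k {u} {X : Matrix n} (v : Fin n → ℚ) → (∀ i j → X i j ≡ v j) → Polynomial m u k X
Polynomial-const zero    k       v eq = const₀ v eq
Polynomial-const (suc m) zero    v eq = const₁ v eq
Polynomial-const (suc m) (suc k) {u} v eq = horner
  (λ i j → trans (eq i j) (solve 2 (λ a w → a := a :+ w :* con 0ℚ) refl (v j) (u zero i)))
  (Polynomial-const m (suc k) {X = λ i j → v j} v (λ i j → refl))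
  (Polynomial-const (suc m) k {X = λ i j → 0ℚ} (λ _ → 0ℚ) (λ i j → refl))

Polynomial-+ : ∀ {u} {X Y : Matrix n} → Polynomial m u k X → Polynomial m u k Y →
  Polynomial m u k (λ i j → X i j + Y i j)
Polynomial-+ (const₀ v eq) (const₀ w eq′) = const₀ (λ j → v j + w j) (λ i j → cong₂ _+_ (eq i j) (eq′ i j))
Polynomial-+ (const₁ v eq) (const₁ w eq′) = const₁ (λ j → v j + w j) (λ i j → cong₂ _+_ (eq i j) (eq′ i j))
Polynomial-+ {u = u} (horner {Y = Y} {Z} eq pY pZ) (horner {Y = Y′} {Z′} eq′ pY′ pZ′) = horner
  (λ i j → trans (cong₂ _+_ (eq i j) (eq′ i j))
    (solve 5 (λ w a b c d → (a :+ w :* b) :+ (c :+ w :* d) := (a :+ c) :+ w :* (b :+ d)) refl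
      (u zero i) (Y i j) (Z i j) (Y′ i j) (Z′ i j)))
  (Polynomial-+ pY pY′) (Polynomial-+ pZ pZ′)

-- A factor depending on j alone is absorbed in the coefficients, which may vary from column to
-- column, and so costs no degree.
Polynomial-columns : ∀ {u} {X : Matrix n} (c : Fin n → ℚ) → Polynomial m u k X →
  Polynomial m u k (λ i j → c j * X i j)
Polynomial-columns c (const₀ v eq) = const₀ (λ j → c j * v j) (λ i j → cong (c j *_) (eq i j))
Polynomial-columns c (const₁ v eq) = const₁ (λ j → c j * v j) (λ i j → cong (c j *_) (eq i j))
Polynomial-columns {u = u} c (horner {Y = Y} {Z} eq pY pZ) = horner
  (λ i j → trans (cong (c j *_) (eq i j))
    (solve 4 (λ w a b c → c :* (a :+ w :* b) := c :* a :+ w :* (c :* b)) refl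
      (u zero i) (Y i j) (Z i j) (c j)))
  (Polynomial-columns c pY) (Polynomial-columns c pZ)

Polynomial-suc : ∀ {u} {X : Matrix n} → Polynomial m u k X → Polynomial m u (suc k) X
Polynomial-suc (const₀ v eq)     = const₀ v eq
Polynomial-suc (const₁ v eq)     = Polynomial-const _ 1 v eq
Polynomial-suc (horner eq pY pZ) = horner eq (Polynomial-suc pY) (Polynomial-suc pZ)

Polynomial-var : ∀ {u} {X : Matrix n} a → Polynomial m u k X → Polynomial m u (suc k) (λ i j → u a i * X i j)
Polynomial-var {m = suc m} {k} {u = u} {X} zero pX = horner
  (λ i j → sym (+-identityˡ (u zero i * X i j)))
  (Polynomial-const m (suc k) {X = λ i j → 0ℚ} (λ _ → 0ℚ) (λ i j → refl)) pX
Polynomial-var {u = u} (suc a) (const₁ v eq) = horner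
  (λ i j → trans (cong (u (suc a) i *_) (eq i j))
    (solve 3 (λ x y w → x :* y := x :* y :+ w :* con 0ℚ) refl (u (suc a) i) (v j) (u zero i)))
  (Polynomial-var a (Polynomial-const _ 0 {X = λ i j → v j} v (λ i j → refl)))
  (const₁ {X = λ i j → 0ℚ} (λ _ → 0ℚ) (λ i j → refl))
Polynomial-var {u = u} (suc a) (horner {Y = Y} {Z} eq pY pZ) = horner
  (λ i j → trans (cong (u (suc a) i *_) (eq i j))
    (solve 4 (λ x a w b → x :* (a :+ w :* b) := x :* a :+ w :* (x :* b)) refl
      (u (suc a) i) (Y i j) (u zero i) (Z i j)))
  (Polynomial-var a pY) (Polynomial-var (suc a) pZ)

Polynomial-resp : ∀ {u} {X Y : Matrix n} → (∀ i j → Y i j ≡ X i j) → Polynomial m u k X → Polynomial m u k Y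
Polynomial-resp Y≡X (const₀ v eq)     = const₀ v λ i j → trans (Y≡X i j) (eq i j)
Polynomial-resp Y≡X (const₁ v eq)     = const₁ v λ i j → trans (Y≡X i j) (eq i j)
Polynomial-resp Y≡X (horner eq pY pZ) = horner (λ i j → trans (Y≡X i j) (eq i j)) pY pZ

Polynomial-sum : ∀ {u p} {X : Fin p → Matrix n} → (∀ a → Polynomial m u k (X a)) →
  Polynomial m u k (λ i j → sum λ a → X a i j)
Polynomial-sum {m = m} {k} {p = zero}  pX = Polynomial-const m k (λ _ → 0ℚ) (λ i j → refl)
Polynomial-sum             {p = suc p} pX = Polynomial-+ (pX zero) (Polynomial-sum (pX ∘ suc))

affine : (u y : Fin m → Fin n → ℚ) → Matrix n
affine u y i j = 1ℚ + sum λ a → u a i * y a j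

affine^ : ∀ (u y : Fin m → Fin n → ℚ) k → Polynomial m u k (λ i j → affine u y i j ^ k)
affine^ {m} u y zero    = Polynomial-const m 0 (λ _ → 1ℚ) (λ i j → refl)
affine^ {m} {n} u y (suc k) = Polynomial-resp
  (λ i j → trans (*-distribʳ-+ (P i j) 1ℚ (sum λ a → u a i * y a j))
    (cong₂ _+_ (*-identityˡ (P i j)) (trans (*-distribʳ-sum (P i j) (λ a → u a i * y a j))
      (sum-cong-≗ λ a → *-assoc (u a i) (y a j) (P i j)))))
  (Polynomial-+ (Polynomial-suc pP) (Polynomial-sum λ a → Polynomial-var a (Polynomial-columns (y a) pP)))
  where
  P : Matrix n
  P i j = affine u y i j ^ k
  pP : Polynomial m u k P
  pP = affine^ u y k

-- Rank of matrices close to the identity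

sum-row≤ : ∀ {τ} (i : Fin n) {f : Fin n → ℚ} → f i ≡ 1ℚ → 0ℚ ≤ τ → (∀ j → i ≢ j → f j ≤ τ) →
  sum f ≤ 1ℚ + fromℕ n * τ
sum-row≤ {suc n} {τ} i {f} fi≡1 0≤τ f≤τ = subst₂ _≤_ (sym (sum-remove {i = i} f))
  (cong (1ℚ +_) (trans (cong (τ +_) (sum-const n τ))
    (trans (solve 2 (λ n c → c :+ n :* c := (con 1ℚ :+ n) :* c) refl (fromℕ n) τ)
      (cong (_* τ) (sym (fromℕ-suc n))))))
  (+-mono-≤ (≤-reflexive fi≡1) (≤-trans (sum-mono {f = f ∘ punchIn i} {g = λ _ → τ}
    (λ j → f≤τ (punchIn i j) (Finₚ.punchInᵢ≢i i j ∘ sym)))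
    (subst (_≤ τ + sum {n} (λ _ → τ)) (+-identityˡ _) (+-monoˡ-≤ _ 0≤τ))))

-- In `trace²≤` the trace is n and each row adds at most 1 + n τ to the Frobenius norm, so that n² ≤
-- r n (1 + n τ); one factor n cancels.
n≤rank : ∀ {τ} {X : Matrix n} → Rank≤ r X → (∀ i → X i i ≡ 1ℚ) → 0ℚ ≤ τ →
  (∀ i j → i ≢ j → X i j * X i j ≤ τ) → fromℕ n ≤ fromℕ r * (1ℚ + fromℕ n * τ)
n≤rank {zero} {r} {τ} rX diag 0≤τ off = 0≤*0≤ (0≤fromℕ r) (≤-trans (<⇒≤ 0<1) (p≤p+q (≤-reflexive (sym (*-zeroˡ τ)))))
n≤rank {n@(suc n′)} {r} {τ} {X} rX diag 0≤τ off = *-cancelˡ-≤-pos N {{positive (0<fromℕ n′)}}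
  (≤-trans
    (subst (λ t → t * t ≤ fromℕ r * frobenius² X) tr (trace²≤ rX))
    (subst (fromℕ r * frobenius² X ≤_)
      (trans (cong (fromℕ r *_) (sum-const n (1ℚ + N * τ)))
        (solve 3 (λ R N b → R :* (N :* b) := N :* (R :* b)) refl (fromℕ r) N (1ℚ + N * τ)))
      (*-monoˡ-≤-nonNeg (fromℕ r) {{nonNegative (0≤fromℕ r)}}
        (sum-mono {f = λ i → sum λ j → X i j * X i j} {λ _ → 1ℚ + N * τ} λ i →
          sum-row≤ i {λ j → X i j * X i j} (cong (λ a → a * a) (diag i)) 0≤τ (off i)))))
  where
  N : ℚ
  N = fromℕ n
  tr : trace X ≡ N
  tr = trans (sum-cong-≗ diag) (trans (sum-const n 1ℚ) (*-identityʳ N))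

-- Dividing each row by its diagonal entry does not change the rank.
n≤dimension : ∀ {ρ} (u y : Fin m → Fin n → ℚ) → 0ℚ ≤ ρ → (∀ i → 0ℚ < affine u y i i) →
  (∀ i j → i ≢ j → ∣ affine u y i j ∣ ≤ ρ * affine u y i i) →
  ∀ k → fromℕ n ≤ fromℕ (dimension m k) * (1ℚ + fromℕ n * (ρ ^ k * ρ ^ k))
n≤dimension {m} {n} {ρ} u y 0≤ρ 0<B off k = n≤rank {X = λ i j → T i j ^ k}
  (Rank≤-resp (λ i j → sym (^-distrib-* (recip (B i i)) (B i j) k))
    (Rank≤-rows (λ i → recip (B i i) ^ k) (Polynomial⇒Rank≤ (affine^ u y k))))
  (λ i → trans (cong (_^ k) (trans (*-comm (recip (B i i)) (B i i)) (p*recip (0<B i)))) (1^ k))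
  (0≤² (ρ ^ k))
  (λ i j i≢j → subst (_≤ ρ ^ k * ρ ^ k) (∣p∣*∣p∣≡p*p (T i j ^ k))
    (*-mono-≤ (0≤∣p∣ _) (∣^∣≤ (T≤ i j i≢j) k) (0≤∣p∣ _) (∣^∣≤ (T≤ i j i≢j) k)))
  where
  B T : Matrix n
  B = affine u y
  T i j = recip (B i i) * B i j
  ∣p∣*∣p∣≡p*p : ∀ p → ∣ p ∣ * ∣ p ∣ ≡ p * p
  ∣p∣*∣p∣≡p*p p = trans (sym (∣p*q∣≡∣p∣*∣q∣ p p)) (0≤p⇒∣p∣≡p (0≤² p))
  T≤ : ∀ i j → i ≢ j → ∣ T i j ∣ ≤ ρ
  T≤ i j i≢j = subst₂ _≤_
    (trans (cong (_* ∣ B i j ∣) (sym (0≤p⇒∣p∣≡p 0≤t))) (sym (∣p*q∣≡∣p∣*∣q∣ (recip (B i i)) (B i j))))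
    (trans (solve 3 (λ t r b → t :* (r :* b) := r :* (b :* t)) refl (recip (B i i)) ρ (B i i))
      (trans (cong (ρ *_) (p*recip (0<B i))) (*-identityʳ ρ)))
    (*-monoˡ-≤-nonNeg (recip (B i i)) {{nonNegative 0≤t}} (off i j i≢j))
    where
    0≤t : 0ℚ ≤ recip (B i i)
    0≤t = <⇒≤ (0<recip (0<B i))

-- From the binomial dimension to a linear bound on r

-- The left side is one term of the binomial expansion of the right side, obtained here from
-- Pascal's recursion. The weights a and b are free to be tuned; they become q - 3 and 3.
dimension≤ : ∀ a b m k → dimension m k ℕ.* (a ℕ.^ m ℕ.* b ℕ.^ k) ℕ.≤ (a ℕ.+ b) ℕ.^ (m ℕ.+ k)
dimension≤ a b zero    k       = ℕ.≤-trans (ℕ.≤-reflexive (trans (ℕ.*-identityˡ _) (ℕ.*-identityˡ _)))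
  (ℕ.^-monoˡ-≤ k (ℕ.m≤n+m b a))
dimension≤ a b (suc m) zero    = ℕ.≤-trans
  (ℕ.≤-reflexive (trans (ℕ.*-identityˡ _) (trans (ℕ.*-identityʳ _) (cong (a ℕ.^_) (sym (ℕ.+-identityʳ (suc m)))))))
  (ℕ.^-monoˡ-≤ (suc m ℕ.+ 0) (ℕ.m≤m+n a b))
dimension≤ a b (suc m) (suc k) = begin
  (d₁ ℕ.+ d₂) ℕ.* (a ℕ.* x ℕ.* (b ℕ.* y))                             ≡⟨ ℕ-Solver.solve 6
    (λ a b x y d₁ d₂ → (d₁ :+ᴺ d₂) :*ᴺ (a :*ᴺ x :*ᴺ (b :*ᴺ y)) :=ᴺ
      a :*ᴺ (d₁ :*ᴺ (x :*ᴺ (b :*ᴺ y))) :+ᴺ b :*ᴺ (d₂ :*ᴺ (a :*ᴺ x :*ᴺ y))) refl a b x y d₁ d₂ ⟩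
  a ℕ.* (d₁ ℕ.* (x ℕ.* (b ℕ.* y))) ℕ.+ b ℕ.* (d₂ ℕ.* (a ℕ.* x ℕ.* y)) ≤⟨ ℕ.+-mono-≤
    (ℕ.*-monoʳ-≤ a (dimension≤ a b m (suc k))) (ℕ.*-monoʳ-≤ b (dimension≤ a b (suc m) k)) ⟩
  a ℕ.* c ℕ.^ (m ℕ.+ suc k) ℕ.+ b ℕ.* c ℕ.^ (suc m ℕ.+ k)             ≡⟨ cong
    (λ e → a ℕ.* c ℕ.^ (m ℕ.+ suc k) ℕ.+ b ℕ.* c ℕ.^ e) (sym (ℕ.+-suc m k)) ⟩
  a ℕ.* c ℕ.^ (m ℕ.+ suc k) ℕ.+ b ℕ.* c ℕ.^ (m ℕ.+ suc k)             ≡⟨ ℕ.*-distribʳ-+ _ a b ⟨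
  c ℕ.^ (suc m ℕ.+ suc k)                                             ∎
  where
  open ℕ.≤-Reasoning
  open ℕ-Solver using () renaming (_:+_ to _:+ᴺ_; _:*_ to _:*ᴺ_; _:=_ to _:=ᴺ_)
  c x y d₁ d₂ : ℕ
  c = a ℕ.+ b
  x = a ℕ.^ m
  y = b ℕ.^ k
  d₁ = dimension m (suc k)
  d₂ = dimension (suc m) k

^-distribʳ-* : ∀ k m n → (m ℕ.* n) ℕ.^ k ≡ m ℕ.^ k ℕ.* n ℕ.^ k
^-distribʳ-* zero    m n = refl
^-distribʳ-* (suc k) m n = trans (cong (m ℕ.* n ℕ.*_) (^-distribʳ-* k m n))
  (ℕ.[m*n]*[o*p]≡[m*o]*[n*p] m n (m ℕ.^ k) (n ℕ.^ k))

module _ (p′ : ℕ) where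

  private
    p q a : ℕ
    p = suc p′
    q = 4 ℕ.* p
    a = 1 ℕ.+ 4 ℕ.* p′
    open ℕ-Solver using () renaming (_:+_ to _:+ᴺ_; _:*_ to _:*ᴺ_; _:=_ to _:=ᴺ_; con to conᴺ)
    a+3≡q : a ℕ.+ 3 ≡ q
    a+3≡q = ℕ-Solver.solve 1 (λ p → conᴺ 1 :+ᴺ conᴺ 4 :*ᴺ p :+ᴺ conᴺ 3 :=ᴺ conᴺ 4 :*ᴺ (conᴺ 1 :+ᴺ p)) refl p′
    a≤q : a ℕ.≤ q
    a≤q = subst (a ℕ.≤_) a+3≡q (ℕ.m≤m+n a 3)

  -- Bernoulli's inequality (1 - 3 / q)ᵗ ≥ 1 - 3 t / q, cleared of denominators.
  bernoulli-ℕ : ∀ t → q ℕ.^ t ℕ.* q ℕ.≤ a ℕ.^ t ℕ.* q ℕ.+ 3 ℕ.* t ℕ.* q ℕ.^ t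
  bernoulli-ℕ zero    = ℕ.m≤m+n _ _
  bernoulli-ℕ (suc t) = begin
    q ℕ.* x ℕ.* q                                            ≡⟨ ℕ.*-assoc q x q ⟩
    q ℕ.* (x ℕ.* q)                                          ≤⟨ ℕ.*-monoʳ-≤ q (bernoulli-ℕ t) ⟩
    q ℕ.* (y ℕ.* q ℕ.+ 3 ℕ.* t ℕ.* x)                        ≡⟨ cong (λ c → c ℕ.* (y ℕ.* q ℕ.+ 3 ℕ.* t ℕ.* x)) (sym a+3≡q) ⟩
    (a ℕ.+ 3) ℕ.* (y ℕ.* q ℕ.+ 3 ℕ.* t ℕ.* x)                ≡⟨ ℕ-Solver.solve 5 (λ a y q t x →
      (a :+ᴺ conᴺ 3) :*ᴺ (y :*ᴺ q :+ᴺ conᴺ 3 :*ᴺ t :*ᴺ x) :=ᴺ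
      a :*ᴺ y :*ᴺ q :+ᴺ (conᴺ 3 :*ᴺ (y :*ᴺ q) :+ᴺ conᴺ 3 :*ᴺ t :*ᴺ ((a :+ᴺ conᴺ 3) :*ᴺ x))) refl a y q t x ⟩
    a ℕ.* y ℕ.* q ℕ.+ (3 ℕ.* (y ℕ.* q) ℕ.+ 3 ℕ.* t ℕ.* ((a ℕ.+ 3) ℕ.* x)) ≤⟨ ℕ.+-monoʳ-≤ (a ℕ.* y ℕ.* q)
      (ℕ.+-mono-≤ (ℕ.*-monoʳ-≤ 3 (ℕ.*-monoˡ-≤ q (ℕ.^-monoˡ-≤ t a≤q)))
        (ℕ.≤-reflexive (cong (λ c → 3 ℕ.* t ℕ.* (c ℕ.* x)) a+3≡q))) ⟩
    a ℕ.* y ℕ.* q ℕ.+ (3 ℕ.* (x ℕ.* q) ℕ.+ 3 ℕ.* t ℕ.* (q ℕ.* x)) ≡⟨ ℕ-Solver.solve 4 (λ z q t x →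
      z :+ᴺ (conᴺ 3 :*ᴺ (x :*ᴺ q) :+ᴺ conᴺ 3 :*ᴺ t :*ᴺ (q :*ᴺ x)) :=ᴺ
      z :+ᴺ conᴺ 3 :*ᴺ (conᴺ 1 :+ᴺ t) :*ᴺ (q :*ᴺ x)) refl (a ℕ.* y ℕ.* q) q t x ⟩
    a ℕ.* y ℕ.* q ℕ.+ 3 ℕ.* suc t ℕ.* (q ℕ.* x)              ∎
    where
    open ℕ.≤-Reasoning
    x y : ℕ
    x = q ℕ.^ t
    y = a ℕ.^ t

  -- Bernoulli's inequality at t = p: since q = 4 p, it says (1 - 3 / q)ᵖ ≥ 1 - 3 / 4.
  q^p≤4a^p : q ℕ.^ p ℕ.≤ 4 ℕ.* a ℕ.^ p
  q^p≤4a^p = ℕ.*-cancelˡ-≤ p (ℕ.+-cancelʳ-≤ (3 ℕ.* p ℕ.* q ℕ.^ p) _ _ (subst₂ ℕ._≤_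
    (ℕ-Solver.solve 2 (λ x p → x :*ᴺ (conᴺ 4 :*ᴺ p) :=ᴺ p :*ᴺ x :+ᴺ conᴺ 3 :*ᴺ p :*ᴺ x) refl (q ℕ.^ p) p)
    (ℕ-Solver.solve 3 (λ x p y → y :*ᴺ (conᴺ 4 :*ᴺ p) :+ᴺ conᴺ 3 :*ᴺ p :*ᴺ x :=ᴺ
      p :*ᴺ (conᴺ 4 :*ᴺ y) :+ᴺ conᴺ 3 :*ᴺ p :*ᴺ x) refl (q ℕ.^ p) p (a ℕ.^ p))
    (bernoulli-ℕ p)))

  -- With s = q / 3, the bound dimension m k ≤ sᵏ (1 + 1 / (s - 1))ᵐ turns the
  -- hypothesis into 3ᵏ / 2 ≤ (1 - 3 / q)⁻²ʳ, where (1 - 3 / q)⁻ᵖ ≤ 4.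
  dimension-lower : ∀ r k .{{_ : NonZero k}} → q ℕ.^ k ℕ.≤ 2 ℕ.* dimension (r ℕ.* 2) k → p ℕ.* k ℕ.≤ 8 ℕ.* r
  dimension-lower r k h = ℕ.≮⇒≥ λ 8r<pk → ℕ.<⇒≱ 16*4^k<81^k (81^k≤ (ℕ.<⇒≤ 8r<pk))
    where
    open ℕ.≤-Reasoning
    h₁ : 3 ℕ.^ k ℕ.* a ℕ.^ (r ℕ.* 2) ℕ.≤ 2 ℕ.* q ℕ.^ (r ℕ.* 2)
    h₁ = ℕ.*-cancelˡ-≤ (q ℕ.^ k) {{ℕ.m^n≢0 q k}} (begin
      Q ℕ.* (3 ℕ.^ k ℕ.* A)                   ≤⟨ ℕ.*-monoˡ-≤ (3 ℕ.^ k ℕ.* A) h ⟩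
      2 ℕ.* D ℕ.* (3 ℕ.^ k ℕ.* A)             ≡⟨ ℕ-Solver.solve 3 (λ D x A →
        conᴺ 2 :*ᴺ D :*ᴺ (x :*ᴺ A) :=ᴺ conᴺ 2 :*ᴺ (D :*ᴺ (A :*ᴺ x))) refl D (3 ℕ.^ k) A ⟩
      2 ℕ.* (D ℕ.* (A ℕ.* 3 ℕ.^ k))           ≤⟨ ℕ.*-monoʳ-≤ 2 (dimension≤ a 3 (r ℕ.* 2) k) ⟩
      2 ℕ.* (a ℕ.+ 3) ℕ.^ (r ℕ.* 2 ℕ.+ k)     ≡⟨ cong (λ c → 2 ℕ.* c ℕ.^ (r ℕ.* 2 ℕ.+ k)) a+3≡q ⟩
      2 ℕ.* q ℕ.^ (r ℕ.* 2 ℕ.+ k)             ≡⟨ cong (2 ℕ.*_) (ℕ.^-distribˡ-+-* q (r ℕ.* 2) k) ⟩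
      2 ℕ.* (q ℕ.^ (r ℕ.* 2) ℕ.* Q)           ≡⟨ ℕ-Solver.solve 2 (λ x Q →
        conᴺ 2 :*ᴺ (x :*ᴺ Q) :=ᴺ Q :*ᴺ (conᴺ 2 :*ᴺ x)) refl (q ℕ.^ (r ℕ.* 2)) Q ⟩
      Q ℕ.* (2 ℕ.* q ℕ.^ (r ℕ.* 2))           ∎)
      where
      Q A D : ℕ
      Q = q ℕ.^ k
      A = a ℕ.^ (r ℕ.* 2)
      D = dimension (r ℕ.* 2) k
    ^4 : ∀ x → (x ℕ.^ (r ℕ.* 2)) ℕ.^ 4 ≡ x ℕ.^ (8 ℕ.* r)
    ^4 x = trans (ℕ.^-*-assoc x (r ℕ.* 2) 4)
      (cong (x ℕ.^_) (ℕ-Solver.solve 1 (λ r → r :*ᴺ conᴺ 2 :*ᴺ conᴺ 4 :=ᴺ conᴺ 8 :*ᴺ r) refl r))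
    -- The fourth power opens a numerical gap. If 8 r ≤ p k, then (q / a)⁸ʳ ≤ 4ᵏ and hence 81ᵏ ≤ 16
    -- · 4ᵏ, whereas 16 · 4ᵏ ≤ 64ᵏ < 81ᵏ for k ≥ 1.
    h₄ : 81 ℕ.^ k ℕ.* a ℕ.^ (8 ℕ.* r) ℕ.≤ 16 ℕ.* q ℕ.^ (8 ℕ.* r)
    h₄ = subst₂ ℕ._≤_
      (trans (^-distribʳ-* 4 (3 ℕ.^ k) (a ℕ.^ (r ℕ.* 2))) (cong₂ ℕ._*_
        (trans (ℕ.^-*-assoc 3 k 4) (trans (cong (3 ℕ.^_) (ℕ.*-comm k 4)) (sym (ℕ.^-*-assoc 3 4 k)))) (^4 a)))
      (trans (^-distribʳ-* 4 2 (q ℕ.^ (r ℕ.* 2))) (cong (16 ℕ.*_) (^4 q)))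
      (ℕ.^-monoˡ-≤ 4 h₁)
    81^k≤ : 8 ℕ.* r ℕ.≤ p ℕ.* k → 81 ℕ.^ k ℕ.≤ 16 ℕ.* 4 ℕ.^ k
    81^k≤ 8r≤pk = ℕ.*-cancelʳ-≤ _ _ (q ℕ.^ (8 ℕ.* r ℕ.+ e)) {{ℕ.m^n≢0 q (8 ℕ.* r ℕ.+ e)}} (begin
      81 ℕ.^ k ℕ.* q ℕ.^ (8 ℕ.* r ℕ.+ e)                          ≡⟨ cong (λ c → 81 ℕ.^ k ℕ.* q ℕ.^ c) e≡ ⟩
      81 ℕ.^ k ℕ.* q ℕ.^ (p ℕ.* k)                                ≤⟨ ℕ.*-monoʳ-≤ (81 ℕ.^ k) (subst₂ ℕ._≤_
        (ℕ.^-*-assoc q p k)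
        (trans (^-distribʳ-* k 4 (a ℕ.^ p)) (cong (4 ℕ.^ k ℕ.*_) (ℕ.^-*-assoc a p k)))
        (ℕ.^-monoˡ-≤ k q^p≤4a^p)) ⟩
      81 ℕ.^ k ℕ.* (4 ℕ.^ k ℕ.* a ℕ.^ (p ℕ.* k))                  ≡⟨ cong (λ c → 81 ℕ.^ k ℕ.* (4 ℕ.^ k ℕ.* c))
        (trans (cong (a ℕ.^_) (sym e≡)) (ℕ.^-distribˡ-+-* a (8 ℕ.* r) e)) ⟩
      81 ℕ.^ k ℕ.* (4 ℕ.^ k ℕ.* (a ℕ.^ (8 ℕ.* r) ℕ.* a ℕ.^ e))    ≡⟨ ℕ-Solver.solve 4 (λ x f y z →
        x :*ᴺ (f :*ᴺ (y :*ᴺ z)) :=ᴺ f :*ᴺ (x :*ᴺ y :*ᴺ z)) refl (81 ℕ.^ k) (4 ℕ.^ k) (a ℕ.^ (8 ℕ.* r)) (a ℕ.^ e) ⟩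
      4 ℕ.^ k ℕ.* (81 ℕ.^ k ℕ.* a ℕ.^ (8 ℕ.* r) ℕ.* a ℕ.^ e)      ≤⟨ ℕ.*-monoʳ-≤ (4 ℕ.^ k)
        (ℕ.*-mono-≤ h₄ (ℕ.^-monoˡ-≤ e a≤q)) ⟩
      4 ℕ.^ k ℕ.* (16 ℕ.* q ℕ.^ (8 ℕ.* r) ℕ.* q ℕ.^ e)            ≡⟨ ℕ-Solver.solve 3 (λ f y z →
        f :*ᴺ (conᴺ 16 :*ᴺ y :*ᴺ z) :=ᴺ conᴺ 16 :*ᴺ f :*ᴺ (y :*ᴺ z)) refl (4 ℕ.^ k) (q ℕ.^ (8 ℕ.* r)) (q ℕ.^ e) ⟩
      16 ℕ.* 4 ℕ.^ k ℕ.* (q ℕ.^ (8 ℕ.* r) ℕ.* q ℕ.^ e)            ≡⟨ cong (16 ℕ.* 4 ℕ.^ k ℕ.*_)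
        (ℕ.^-distribˡ-+-* q (8 ℕ.* r) e) ⟨
      16 ℕ.* 4 ℕ.^ k ℕ.* q ℕ.^ (8 ℕ.* r ℕ.+ e)                    ∎)
      where
      e : ℕ
      e = p ℕ.* k ℕ.∸ 8 ℕ.* r
      e≡ : 8 ℕ.* r ℕ.+ e ≡ p ℕ.* k
      e≡ = ℕ.m+[n∸m]≡n 8r≤pk
    16*4^k<81^k : 16 ℕ.* 4 ℕ.^ k ℕ.< 81 ℕ.^ k
    16*4^k<81^k = begin-strict
      16 ℕ.* 4 ℕ.^ k        ≤⟨ ℕ.*-monoˡ-≤ (4 ℕ.^ k) (subst (ℕ._≤ 16 ℕ.^ k) (ℕ.^-identityʳ 16)
                                 (ℕ.^-monoʳ-≤ 16 (ℕ.>-nonZero⁻¹ k))) ⟩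
      16 ℕ.^ k ℕ.* 4 ℕ.^ k  ≡⟨ ^-distribʳ-* k 16 4 ⟨
      64 ℕ.^ k              <⟨ ℕ.^-monoˡ-< k (ℕ.m≤m+n 65 16) ⟩
      81 ℕ.^ k              ∎

fromℕ-mono-< : m ℕ.< n → fromℕ m < fromℕ n
fromℕ-mono-< {m} {n} m<n = <-≤-trans
  (subst (fromℕ m <_) (sym (trans (fromℕ-suc m) (+-comm 1ℚ (fromℕ m)))) (p<p+q 0<1))
  (fromℕ-mono m<n)

fromℕ-cancel-≤ : fromℕ m ≤ fromℕ n → m ℕ.≤ n
fromℕ-cancel-≤ h = ℕ.≮⇒≥ λ n<m → <-irrefl refl (<-≤-trans (fromℕ-mono-< n<m) h)

fromℕ-^ : ∀ m k → fromℕ (m ℕ.^ k) ≡ fromℕ m ^ k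
fromℕ-^ m zero    = refl
fromℕ-^ m (suc k) = trans (fromℕ-* m (m ℕ.^ k)) (cong (fromℕ m *_) (fromℕ-^ m k))

½^*2^ : ∀ j → ½ ^ j * fromℕ (2 ℕ.^ j) ≡ 1ℚ
½^*2^ j = trans (cong (½ ^ j *_) (fromℕ-^ 2 j))
  (trans (sym (^-distrib-* ½ (fromℕ 2) j)) (1^ j))

-- For ρ = 2⁻ʲ the squared off-diagonal entries of the k-th power are at most τ = q⁻ᵏ, and qᵏ ≤ n
-- means n τ ≥ 1. Then 1 + n τ ≤ 2 n τ, so n cancels in `n≤dimension` and leaves qᵏ ≤ 2 ·
-- `dimension (r * 2) k`.
approximate-identity-rank : ∀ p′ j k r .{{_ : NonZero k}} .{{_ : NonZero n}} (u y : Fin (r ℕ.* 2) → Fin n → ℚ) →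
  2 ℕ.^ j ℕ.* 2 ℕ.^ j ≡ 4 ℕ.* suc p′ → (4 ℕ.* suc p′) ℕ.^ k ℕ.≤ n →
  (∀ i → 0ℚ < affine u y i i) →
  (∀ i j′ → i ≢ j′ → ∣ affine u y i j′ ∣ ≤ ½ ^ j * affine u y i i) →
  suc p′ ℕ.* k ℕ.≤ 8 ℕ.* r
approximate-identity-rank {n@(suc n′)} p′ j k r u y 4^j≡ Q≤n 0<B off = dimension-lower p′ r k (fromℕ-cancel-≤ {m = q ℕ.^ k} {n = 2 ℕ.* dimension (r ℕ.* 2) k} Q≤2D)
  where
  q : ℕ
  q = 4 ℕ.* suc p′
  ρ τ N D Q : ℚ
  ρ = ½ ^ j
  τ = ρ ^ k * ρ ^ k
  N = fromℕ n
  D = fromℕ (dimension (r ℕ.* 2) k)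
  Q = fromℕ (q ℕ.^ k)
  0≤τ : 0ℚ ≤ τ
  0≤τ = 0≤² (ρ ^ k)
  0≤Q : 0ℚ ≤ Q
  0≤Q = 0≤fromℕ (q ℕ.^ k)
  τQ≡1 : τ * Q ≡ 1ℚ
  τQ≡1 = begin
    ρ ^ k * ρ ^ k * Q                             ≡⟨ cong (ρ ^ k * ρ ^ k *_) (trans (fromℕ-^ q k)
                                                       (cong (_^ k) (trans (cong fromℕ (sym 4^j≡)) (fromℕ-* (2 ℕ.^ j) (2 ℕ.^ j))))) ⟩
    ρ ^ k * ρ ^ k * (t * t) ^ k                   ≡⟨ cong (λ a → ρ ^ k * ρ ^ k * a) (^-distrib-* t t k) ⟩
    ρ ^ k * ρ ^ k * (t ^ k * t ^ k)               ≡⟨ solve 2 (λ a b → a :* a :* (b :* b) := (a :* b) :* (a :* b)) refl (ρ ^ k) (t ^ k) ⟩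
    (ρ ^ k * t ^ k) * (ρ ^ k * t ^ k)             ≡⟨ cong (λ a → a * a) (trans (sym (^-distrib-* ρ t k))
                                                       (trans (cong (_^ k) (½^*2^ j)) (1^ k))) ⟩
    1ℚ                                            ∎
    where
    open ≡-Reasoning
    t : ℚ
    t = fromℕ (2 ℕ.^ j)
  0≤D : 0ℚ ≤ D
  0≤D = 0≤fromℕ (dimension (r ℕ.* 2) k)
  1≤Nτ : 1ℚ ≤ N * τ
  1≤Nτ = subst₂ _≤_ (trans (*-comm Q τ) τQ≡1) refl (*-monoʳ-≤-nonNeg τ {{nonNegative 0≤τ}} (fromℕ-mono {q ℕ.^ k} {n} Q≤n))
  1≤2Dτ : 1ℚ ≤ fromℕ 2 * D * τ
  1≤2Dτ = *-cancelˡ-≤-pos N {{positive (0<fromℕ n′)}} (begin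
    N * 1ℚ                   ≡⟨ *-identityʳ N ⟩
    N                        ≤⟨ n≤dimension u y (0≤^ (<⇒≤ 0<½) j) 0<B off k ⟩
    D * (1ℚ + N * τ)         ≤⟨ *-monoˡ-≤-nonNeg D {{nonNegative 0≤D}} (+-monoˡ-≤ (N * τ) 1≤Nτ) ⟩
    D * (N * τ + N * τ)      ≡⟨ solve 3 (λ D N τ → D :* (N :* τ :+ N :* τ) := N :* (con (fromℕ 2) :* D :* τ)) refl D N τ ⟩
    N * (fromℕ 2 * D * τ)    ∎)
    where open ≤-Reasoning
  Q≤2D : Q ≤ fromℕ (2 ℕ.* dimension (r ℕ.* 2) k)
  Q≤2D = subst₂ _≤_ (*-identityˡ Q)
    (trans (*-assoc (fromℕ 2 * D) τ Q) (trans (cong (fromℕ 2 * D *_) τQ≡1)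
      (trans (*-identityʳ (fromℕ 2 * D)) (sym (fromℕ-* 2 (dimension (r ℕ.* 2) k))))))
    (*-monoʳ-≤-nonNeg Q {{nonNegative 0≤Q}} 1≤2Dτ)

-- Estimates for the logarithm

^-mono-≤ : ∀ {p q} → 0ℚ ≤ p → p ≤ q → ∀ m → p ^ m ≤ q ^ m
^-mono-≤ 0≤p p≤q zero    = ≤-refl
^-mono-≤ 0≤p p≤q (suc m) = *-mono-≤ 0≤p p≤q (0≤^ 0≤p m) (^-mono-≤ 0≤p p≤q m)

artanhSum-mono : ∀ {p q} → 0ℚ ≤ p → p ≤ q → ∀ k → artanhSum k p ≤ artanhSum k q
artanhSum-mono 0≤p p≤q zero    = ≤-refl
artanhSum-mono 0≤p p≤q (suc k) = +-mono-≤ (artanhSum-mono 0≤p p≤q k)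
  (*-monoʳ-≤-nonNeg _ {{nonNegative (0≤recip (2 ℕ.* k))}} (^-mono-≤ 0≤p p≤q (suc (2 ℕ.* k))))

artanhSum-0 : ∀ k → artanhSum k 0ℚ ≡ 0ℚ
artanhSum-0 zero    = refl
artanhSum-0 (suc k) = cong₂ _+_ (artanhSum-0 k)
  (trans (cong (_* recip (fromℕ (suc (2 ℕ.* k)))) (*-zeroˡ (0ℚ ^ (2 ℕ.* k)))) (*-zeroˡ (recip (fromℕ (suc (2 ℕ.* k))))))

cayleyℚ : ℚ → ℚ
cayleyℚ x = (x - 1ℚ) * recip (x + 1ℚ)

module _ {x : ℚ} (1≤x : 1ℚ ≤ x) where

  0<x+1 : 0ℚ < x + 1ℚ
  0<x+1 = <-≤-trans 0<1 (≤-trans 1≤x (p≤p+q (<⇒≤ 0<1)))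

  cayleyℚ≡ : cayleyℚ x ≡ 1ℚ - fromℕ 2 * recip (x + 1ℚ)
  cayleyℚ≡ = trans
    (solve 2 (λ x u → (x :- con 1ℚ) :* u := (x :+ con 1ℚ) :* u :- con (fromℕ 2) :* u) refl x (recip (x + 1ℚ)))
    (cong (_- fromℕ 2 * recip (x + 1ℚ)) (p*recip 0<x+1))

  0≤cayleyℚ : 0ℚ ≤ cayleyℚ x
  0≤cayleyℚ = 0≤*0≤ (≤⇒0≤- 1≤x) (<⇒≤ (0<recip 0<x+1))

  cayleyℚ<1 : cayleyℚ x < 1ℚ
  cayleyℚ<1 = subst (_< 1ℚ) (sym cayleyℚ≡) (subst (1ℚ - fromℕ 2 * recip (x + 1ℚ) <_) (+-identityʳ 1ℚ)
    (+-monoʳ-< 1ℚ (neg-antimono-< (0<*0< (0<fromℕ 1) (0<recip 0<x+1)))))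

  cayleyℚ-mono : ∀ {y} → x ≤ y → cayleyℚ x ≤ cayleyℚ y
  cayleyℚ-mono {y} x≤y = subst₂ _≤_ (sym cayleyℚ≡)
    (sym (trans (solve 2 (λ x u → (x :- con 1ℚ) :* u := (x :+ con 1ℚ) :* u :- con (fromℕ 2) :* u) refl y (recip (y + 1ℚ)))
      (cong (_- fromℕ 2 * recip (y + 1ℚ)) (p*recip (<-≤-trans 0<x+1 (+-monoˡ-≤ 1ℚ x≤y))))))
    (+-monoʳ-≤ 1ℚ (neg-antimono-≤ (*-monoˡ-≤-nonNeg (fromℕ 2) {{nonNegative (0≤fromℕ 2)}}
      (recip-anti 0<x+1 (+-monoˡ-≤ 1ℚ x≤y)))))

  1≤2x : 1ℚ ≤ fromℕ 2 * x
  1≤2x = ≤-trans 1≤x (subst (x ≤_) (solve 1 (λ x → x :+ x := con (fromℕ 2) :* x) refl x)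
    (p≤p+q (≤-trans (<⇒≤ 0<1) 1≤x)))

module _ {x : ℚ} (1≤x : 1ℚ ≤ x) where

  private
    u u′ w z : ℚ
    u  = recip (x + 1ℚ)
    u′ = recip (fromℕ 2 * x + 1ℚ)
    w  = cayleyℚ x
    z  = cayleyℚ (fromℕ 2 * x)
    0<u : 0ℚ < u
    0<u = 0<recip (0<x+1 1≤x)
    0<u′ : 0ℚ < u′
    0<u′ = 0<recip (0<x+1 (1≤2x 1≤x))
    eq : (x + 1ℚ) * u ≡ 1ℚ
    eq = p*recip (0<x+1 1≤x)
    eq′ : (fromℕ 2 * x + 1ℚ) * u′ ≡ 1ℚ
    eq′ = p*recip (0<x+1 (1≤2x 1≤x))
    w≤z : w ≤ z
    w≤z = cayleyℚ-mono 1≤x (subst (x ≤_) (solve 1 (λ x → x :+ x := con (fromℕ 2) :* x) refl x)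
      (p≤p+q (≤-trans (<⇒≤ 0<1) 1≤x)))
    w≡ : w ≡ 1ℚ - fromℕ 2 * u
    w≡ = cayleyℚ≡ 1≤x
    z≡ : z ≡ 1ℚ - fromℕ 2 * u′
    z≡ = cayleyℚ≡ (1≤2x 1≤x)
    0≤w : 0ℚ ≤ w
    0≤w = 0≤cayleyℚ 1≤x
    0≤z : 0ℚ ≤ z
    0≤z = 0≤cayleyℚ (1≤2x 1≤x)

  -- All partial sums are Lipschitz on [0, z] with constant 1 / (1 - z). The increment z - w is at
  -- most 1 - z, because 1 / (x + 1) ≤ 2 / (2 x + 1).
  artanhSum-double≤ : ∀ k → artanhSum k z ≤ artanhSum k w + 1ℚ
  artanhSum-double≤ k = subst₂ _≤_
    (solve 2 (λ a b → a :+ (b :- a) := b) refl (artanhSum k w) (artanhSum k z)) refl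
    (+-monoʳ-≤ (artanhSum k w) (*-cancelʳ-≤-pos (1ℚ - z) {{positive (<⇒0<- (cayleyℚ<1 (1≤2x 1≤x)))}} (begin
      d * (1ℚ - z)                       ≤⟨ *-monoʳ-≤-nonNeg (1ℚ - z) {{nonNegative (<⇒≤ (<⇒0<- (cayleyℚ<1 (1≤2x 1≤x))))}}
                                              (p≤∣p∣ d) ⟩
      ∣ d ∣ * (1ℚ - z)                   ≤⟨ sum-lipschitz 0≤z (cayleyℚ<1 (1≤2x 1≤x)) (≤-reflexive (0≤p⇒∣p∣≡p 0≤z))
                                              (subst (_≤ z) (sym (0≤p⇒∣p∣≡p 0≤w)) w≤z) k ⟩
      ∣ z - w ∣                          ≡⟨ 0≤p⇒∣p∣≡p (≤⇒0≤- w≤z) ⟩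
      z - w                              ≡⟨ cong₂ _-_ z≡ w≡ ⟩
      (1ℚ - fromℕ 2 * u′) - (1ℚ - fromℕ 2 * u) ≤⟨ 0≤-⇒≤ (subst (0ℚ ≤_) key (0≤*0≤ (0≤fromℕ 2) (<⇒≤ (0<*0< 0<u 0<u′)))) ⟩
      1ℚ * (1ℚ - (1ℚ - fromℕ 2 * u′))    ≡⟨ cong (λ a → 1ℚ * (1ℚ - a)) z≡ ⟨
      1ℚ * (1ℚ - z)                      ∎)))
    where
    open ≤-Reasoning
    d : ℚ
    d = artanhSum k z - artanhSum k w
    key : fromℕ 2 * (u * u′) ≡ 1ℚ * (1ℚ - (1ℚ - fromℕ 2 * u′)) - ((1ℚ - fromℕ 2 * u′) - (1ℚ - fromℕ 2 * u))
    key = trans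
      (solve 3 (λ x u v → con (fromℕ 2) :* (u :* v) :=
        con (fromℕ 2) :* (con (fromℕ 2) :* v :* ((x :+ con 1ℚ) :* u) :- u :* ((con (fromℕ 2) :* x :+ con 1ℚ) :* v)))
        refl x u u′)
      (trans (cong₂ (λ s t → fromℕ 2 * (fromℕ 2 * u′ * s - u * t)) eq eq′)
        (solve 2 (λ u v → con (fromℕ 2) :* (con (fromℕ 2) :* v :* con 1ℚ :- u :* con 1ℚ) :=
          con 1ℚ :* (con 1ℚ :- (con 1ℚ :- con (fromℕ 2) :* v)) :-
            ((con 1ℚ :- con (fromℕ 2) :* v) :- (con 1ℚ :- con (fromℕ 2) :* u))) refl u u′))

  -- By convexity of powers, the k-th terms at z and w differ by at least w²ᵏ (z - w). Summing the
  -- geometric series gives (z - w) (1 - w²ᵏ) / (1 - w²), and eventually w²ᵏ ≤ 1/2. What remains is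
  -- (z - w) / (2 (1 - w²)) = (x + 1) / (4 (2 x + 1)) ≥ 1/8.
  artanhSum-double≥ : Eventually λ k → artanhSum k w + ½ ^ 3 ≤ artanhSum k z
  artanhSum-double≥ = K , λ k K≤k → subst₂ _≤_ refl
    (solve 2 (λ a b → a :+ (b :- a) := b) refl (artanhSum k w) (artanhSum k z))
    (+-monoʳ-≤ (artanhSum k w) (*-cancelʳ-≤-pos (1ℚ - w * w) {{positive 0<1-w²}} (begin
      ½ ^ 3 * (1ℚ - w * w)                              ≡⟨ cong (λ a → ½ ^ 3 * (1ℚ - a * a)) w≡ ⟩
      ½ ^ 3 * (1ℚ - (1ℚ - fromℕ 2 * u) * (1ℚ - fromℕ 2 * u)) ≤⟨ 0≤-⇒≤ (subst (0ℚ ≤_) key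
                                                             (0≤*0≤ (0≤*0≤ (<⇒≤ 0<½) (≤-trans (<⇒≤ 0<1) 1≤x))
                                                               (<⇒≤ (0<*0< (0<*0< 0<u 0<u) 0<u′)))) ⟩
      ½ * ((1ℚ - fromℕ 2 * u′) - (1ℚ - fromℕ 2 * u))    ≡⟨ cong₂ (λ a b → ½ * (a - b)) z≡ w≡ ⟨
      ½ * (z - w)                                       ≡⟨ *-comm ½ (z - w) ⟩
      (z - w) * ½                                       ≤⟨ *-monoˡ-≤-nonNeg (z - w) {{nonNegative (≤⇒0≤- w≤z)}}
                                                             (0≤-⇒≤ {1ℚ - (w * w) ^ k} {½} (subst (0ℚ ≤_)
                                                               (solve 1 (λ a → con ½ :- a := con 1ℚ :- a :- con ½) refl ((w * w) ^ k))
                                                               (≤⇒0≤- (small k K≤k)))) ⟩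
      (z - w) * (1ℚ - (w * w) ^ k)                      ≤⟨ convex k ⟩
      (artanhSum k z - artanhSum k w) * (1ℚ - w * w)    ∎)))
    where
    open ≤-Reasoning
    w<1 : w < 1ℚ
    w<1 = cayleyℚ<1 1≤x
    w²<1 : w * w < 1ℚ
    w²<1 = ≤-<-trans (subst (w * w ≤_) (*-identityʳ w) (*-monoˡ-≤-nonNeg w {{nonNegative 0≤w}} (<⇒≤ w<1))) w<1
    0<1-w² : 0ℚ < 1ℚ - w * w
    0<1-w² = <⇒0<- w²<1
    K : ℕ
    K = proj₁ (^-small (0≤² w) w²<1 0<½)
    small : ∀ k → K ℕ.≤ k → (w * w) ^ k ≤ ½
    small k K≤k = ≤-trans (subst (λ j → (w * w) ^ j ≤ (w * w) ^ K) (ℕ.m∸n+n≡m K≤k)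
      (^-anti (0≤² w) (<⇒≤ w²<1) (k ℕ.∸ K) K)) (proj₂ (^-small (0≤² w) w²<1 0<½))
    key : ½ * x * (u * u * u′) ≡
      ½ * ((1ℚ - fromℕ 2 * u′) - (1ℚ - fromℕ 2 * u)) - ½ ^ 3 * (1ℚ - (1ℚ - fromℕ 2 * u) * (1ℚ - fromℕ 2 * u))
    key = trans
      (solve 3 (λ x u v → let s = (x :+ con 1ℚ) :* u; t = (con (fromℕ 2) :* x :+ con 1ℚ) :* v in
        con ½ :* x :* (u :* u :* v) := u :* s :* t :- v :* s :* s :- con ½ :* (u :* s :* t :- u :* u :* t))
        refl x u u′)
      (trans (cong₂ (λ s t → u * s * t - u′ * s * s - ½ * (u * s * t - u * u * t)) eq eq′)
        (solve 2 (λ u v → u :* con 1ℚ :* con 1ℚ :- v :* con 1ℚ :* con 1ℚ :- con ½ :* (u :* con 1ℚ :* con 1ℚ :- u :* u :* con 1ℚ) :=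
          con ½ :* ((con 1ℚ :- con (fromℕ 2) :* v) :- (con 1ℚ :- con (fromℕ 2) :* u)) :-
            con (½ ^ 3) :* (con 1ℚ :- (con 1ℚ :- con (fromℕ 2) :* u) :* (con 1ℚ :- con (fromℕ 2) :* u))) refl u u′))
    ^-convex : ∀ m → fromℕ (suc m) * (w ^ m * (z - w)) ≤ z ^ suc m - w ^ suc m
    ^-convex zero    = ≤-reflexive (solve 2 (λ z w → con (fromℕ 1) :* (con 1ℚ :* (z :- w)) := z :* con 1ℚ :- w :* con 1ℚ) refl z w)
    ^-convex (suc m) = begin
      fromℕ (suc (suc m)) * (w * W * (z - w))          ≡⟨ cong (_* (w * W * (z - w))) (fromℕ-suc (suc m)) ⟩
      (1ℚ + M) * (w * W * (z - w))                     ≡⟨ solve 4 (λ M w W d → (con 1ℚ :+ M) :* (w :* W :* d) :=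
                                                            w :* (M :* (W :* d)) :+ d :* (w :* W)) refl M w W (z - w) ⟩
      w * (M * (W * (z - w))) + (z - w) * (w * W)      ≤⟨ +-monoˡ-≤ ((z - w) * (w * W)) (*-mono-≤ 0≤w w≤z
                                                            (0≤*0≤ (0≤fromℕ (suc m)) (0≤*0≤ (0≤^ 0≤w m) (≤⇒0≤- w≤z))) (^-convex m)) ⟩
      z * (z ^ suc m - w ^ suc m) + (z - w) * (w * W)  ≡⟨ solve 4 (λ z w Z W → z :* (Z :- W) :+ (z :- w) :* W :=
                                                            z :* Z :- w :* W) refl z w (z ^ suc m) (w ^ suc m) ⟩
      z ^ suc (suc m) - w ^ suc (suc m)                ∎
      where
      M W : ℚ
      M = fromℕ (suc m)
      W = w ^ m
    term : ∀ k → (w * w) ^ k * (z - w) ≤ artanhTerm k z - artanhTerm k w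
    term k = begin
      (w * w) ^ k * (z - w)                            ≡⟨ cong (λ a → (a ^ k) * (z - w)) (cong (w *_) (sym (*-identityʳ w))) ⟩
      (w ^ 2) ^ k * (z - w)                            ≡⟨ cong (_* (z - w)) (^-assocʳ w 2 k) ⟩
      w ^ (2 ℕ.* k) * (z - w)                          ≡⟨ *-identityˡ _ ⟨
      1ℚ * (w ^ (2 ℕ.* k) * (z - w))                   ≡⟨ cong (_* (w ^ (2 ℕ.* k) * (z - w))) (p*recip (0<fromℕ (2 ℕ.* k))) ⟨
      M * R * (w ^ (2 ℕ.* k) * (z - w))                ≡⟨ solve 3 (λ M R a → M :* R :* a := M :* a :* R) refl M R (w ^ (2 ℕ.* k) * (z - w)) ⟩
      M * (w ^ (2 ℕ.* k) * (z - w)) * R                ≤⟨ *-monoʳ-≤-nonNeg R {{nonNegative (0≤recip (2 ℕ.* k))}} (^-convex (2 ℕ.* k)) ⟩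
      (z ^ suc (2 ℕ.* k) - w ^ suc (2 ℕ.* k)) * R      ≡⟨ solve 3 (λ a b R → (a :- b) :* R := a :* R :- b :* R) refl
                                                            (z ^ suc (2 ℕ.* k)) (w ^ suc (2 ℕ.* k)) R ⟩
      artanhTerm k z - artanhTerm k w                  ∎
      where
      M R : ℚ
      M = fromℕ (suc (2 ℕ.* k))
      R = recip M
    convex : ∀ k → (z - w) * (1ℚ - (w * w) ^ k) ≤ (artanhSum k z - artanhSum k w) * (1ℚ - w * w)
    convex zero    = ≤-reflexive (solve 2 (λ d v → d :* (con 1ℚ :- con 1ℚ) := (con 0ℚ :- con 0ℚ) :* (con 1ℚ :- v)) refl (z - w) (w * w))
    convex (suc k) = subst₂ _≤_
      (solve 3 (λ d v V → d :* (con 1ℚ :- V) :+ V :* d :* (con 1ℚ :- v) := d :* (con 1ℚ :- v :* V)) refl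
        (z - w) (w * w) ((w * w) ^ k))
      (solve 5 (λ a b c d v → (a :- b) :* v :+ (c :- d) :* v := ((a :+ c) :- (b :+ d)) :* v) refl
        (artanhSum k z) (artanhSum k w) (artanhTerm k z) (artanhTerm k w) (1ℚ - w * w))
      (+-mono-≤ (convex k) (*-monoʳ-≤-nonNeg (1ℚ - w * w) {{nonNegative (<⇒≤ 0<1-w²)}} (term k)))

1≤2^ : ∀ M → 1ℚ ≤ fromℕ (2 ℕ.^ M)
1≤2^ M = fromℕ-mono {1} {2 ℕ.^ M} (ℕ.m^n>0 2 M)

artanhSum-2^≤ : ∀ M k → artanhSum k (cayleyℚ (fromℕ (2 ℕ.^ M))) ≤ fromℕ M
artanhSum-2^≤ zero    k = ≤-reflexive (artanhSum-0 k)
artanhSum-2^≤ (suc M) k = subst₂ (λ a b → artanhSum k (cayleyℚ a) ≤ b)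
  (sym (fromℕ-* 2 (2 ℕ.^ M))) (trans (+-comm (fromℕ M) 1ℚ) (sym (fromℕ-suc M)))
  (≤-trans (artanhSum-double≤ (1≤2^ M) k) (+-monoˡ-≤ 1ℚ (artanhSum-2^≤ M k)))

artanhSum-2^≥ : ∀ M → Eventually λ k → fromℕ M * ½ ^ 3 ≤ artanhSum k (cayleyℚ (fromℕ (2 ℕ.^ M)))
artanhSum-2^≥ zero    = 0 , λ k _ → ≤-reflexive (sym (artanhSum-0 k))
artanhSum-2^≥ (suc M) =
  let N₁ , h₁ = artanhSum-2^≥ M
      N₂ , h₂ = artanhSum-double≥ (1≤2^ M)
  in N₁ ℕ.⊔ N₂ , λ k N≤k → subst₂ (λ a b → b ≤ artanhSum k (cayleyℚ a))
    (sym (fromℕ-* 2 (2 ℕ.^ M)))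
    (trans (solve 2 (λ M h → M :* h :+ h := (con 1ℚ :+ M) :* h) refl (fromℕ M) (½ ^ 3)) (cong (_* ½ ^ 3) (sym (fromℕ-suc M))))
    (≤-trans (+-monoˡ-≤ (½ ^ 3) (h₁ k (≤⊔ˡ N≤k))) (h₂ k (≤⊔ʳ {N₁} N≤k)))

artanhSum≤ : ∀ {x} M k → 1ℚ ≤ x → x ≤ fromℕ (2 ℕ.^ M) → artanhSum k (cayleyℚ x) ≤ fromℕ M
artanhSum≤ M k 1≤x x≤2^M = ≤-trans (artanhSum-mono (0≤cayleyℚ 1≤x) (cayleyℚ-mono 1≤x x≤2^M) k) (artanhSum-2^≤ M k)

artanhSum≥ : ∀ M → Eventually λ k → ∀ x → fromℕ (2 ℕ.^ M) ≤ x → fromℕ M * ½ ^ 3 ≤ artanhSum k (cayleyℚ x)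
artanhSum≥ M =
  let N , h = artanhSum-2^≥ M
  in N , λ k N≤k x 2^M≤x → ≤-trans (h k N≤k)
    (artanhSum-mono (0≤cayleyℚ (1≤2^ M)) (cayleyℚ-mono (1≤2^ M) 2^M≤x) k)

-- The lower bound

eventually-× : ∀ {P Q : ℕ → Set} → Eventually P → Eventually Q → Eventually λ k → P k × Q k
eventually-× (N₁ , h₁) (N₂ , h₂) = N₁ ℕ.⊔ N₂ , λ k N≤k → h₁ k (≤⊔ˡ N≤k) , h₂ k (≤⊔ʳ {N₁} N≤k)

eventually-∀ : ∀ {n} {P : Fin n → ℕ → Set} → (∀ i → Eventually (P i)) → Eventually λ k → ∀ i → P i k
eventually-∀ {zero}  h = 0 , λ _ _ ()
eventually-∀ {suc n} h =
  let N₁ , h₁ = h zero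
      N₂ , h₂ = eventually-∀ (h ∘ suc)
  in N₁ ℕ.⊔ N₂ , λ where
    k N≤k zero    → h₁ k (≤⊔ˡ N≤k)
    k N≤k (suc i) → h₂ k (≤⊔ʳ {N₁} N≤k) i

∣p-q∣≤⇒p≤ : ∀ {p q δ} → ∣ p - q ∣ ≤ δ → p ≤ q + δ
∣p-q∣≤⇒p≤ {p} {q} {δ} h = subst (_≤ q + δ) (solve 2 (λ p q → q :+ (p :- q) := p) refl p q)
  (+-monoʳ-≤ q (≤-trans (p≤∣p∣ (p - q)) h))

∣p-q∣≤⇒q≤ : ∀ {p q δ} → ∣ p - q ∣ ≤ δ → q ≤ p + δ
∣p-q∣≤⇒q≤ {p} {q} {δ} h = ∣p-q∣≤⇒p≤ {q} {p} (subst (_≤ δ) (∣p-q∣≡∣q-p∣ p q) h)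

0<½^ : ∀ j → 0ℚ < ½ ^ j
0<½^ zero    = 0<1
0<½^ (suc j) = 0<*0< 0<½ (0<½^ j)

½^-anti : ∀ {i j} → i ℕ.≤ j → ½ ^ j ≤ ½ ^ i
½^-anti {i} {j} i≤j = subst (λ l → ½ ^ l ≤ ½ ^ i) (ℕ.m∸n+n≡m i≤j) (^-anti (<⇒≤ 0<½) ½≤1 (j ℕ.∸ i) i)
  where
  ½≤1 : ½ ≤ 1ℚ
  ½≤1 = p≤p+q {½} {½} (<⇒≤ 0<½)

-- Comparing ε with ½ʲ⁺¹ is undecidable, so a rational approximation is tested instead and the two
-- conclusions overlap: they leave a factor 4 between the bounds. A positive lower bound on ε
-- supplies the fuel of the search.
dyadic : ∀ ε → 0ℝ <ℝ ε → ∀ j → ε <ℝ fromℚ (½ ^ j) →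
  ∃[ i ] j ℕ.≤ i × ε <ℝ fromℚ (½ ^ i) × Eventually λ n → ½ ^ (2 ℕ.+ i) ≤ seq ε n
dyadic ε 0<ε j ε<½^j = search J j (ℕ.m≤n+m J j) ε<½^j
  where
  δ : ℚ
  δ = proj₁ (0<ℝ-bound {ε} 0<ε)
  J : ℕ
  J = proj₁ (^-small (<⇒≤ 0<½) (p<p+q {½} {½} 0<½) (proj₁ (proj₂ (0<ℝ-bound {ε} 0<ε))))
  ½^J≤δ : ½ ^ J ≤ δ
  ½^J≤δ = proj₂ (^-small (<⇒≤ 0<½) (p<p+q {½} {½} 0<½) (proj₁ (proj₂ (0<ℝ-bound {ε} 0<ε))))
  search : ∀ fuel j → J ℕ.≤ j ℕ.+ fuel → ε <ℝ fromℚ (½ ^ j) →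
    ∃[ i ] j ℕ.≤ i × ε <ℝ fromℚ (½ ^ i) × Eventually λ n → ½ ^ (2 ℕ.+ i) ≤ seq ε n
  search zero    j J≤ ε< = j , ℕ.≤-refl , ε< , proj₁ δ≤ , λ n N≤n → ≤-trans
    (½^-anti (ℕ.≤-trans (subst (J ℕ.≤_) (ℕ.+-identityʳ j) J≤) (ℕ.m≤n+m j 2)))
    (≤-trans ½^J≤δ (proj₂ δ≤ n N≤n))
    where
    δ≤ : Eventually λ n → δ ≤ seq ε n
    δ≤ = proj₂ (proj₂ (0<ℝ-bound {ε} 0<ε))
  search (suc fuel) j J≤ ε< with cauchy ε (½ ^ 4 * ½ ^ j) (0<*0< (0<½^ 4) (0<½^ j))
  -- With t = ½ʲ, the threshold is 3t/8 and the approximation error at most t/16. Below it, 3t/8 +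
  -- t/16 leaves a gap t/16 under t/2; above it, ε stays at least 5t/16 ≥ t/4.
  ... | N , h with seq ε N ≤? fromℕ 3 * ½ ^ 3 * ½ ^ j
  ...   | yes e≤ =
    let i , j<i , rest = search fuel (suc j) (subst (J ℕ.≤_) (ℕ.+-suc j fuel) J≤)
          (½ ^ 4 * ½ ^ j , 0<*0< (0<½^ 4) (0<½^ j) , N , λ n N≤n → subst (seq ε n + ½ ^ 4 * ½ ^ j ≤_)
            (solve 1 (λ t → con (fromℕ 3 * ½ ^ 3) :* t :+ con (½ ^ 4) :* t :+ con (½ ^ 4) :* t := con ½ :* t) refl (½ ^ j))
            (+-monoˡ-≤ (½ ^ 4 * ½ ^ j) (≤-trans (∣p-q∣≤⇒p≤ {seq ε n} {seq ε N} (h n N N≤n ℕ.≤-refl)) (+-monoˡ-≤ (½ ^ 4 * ½ ^ j) e≤))))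
    in i , ℕ.≤-trans (ℕ.n≤1+n j) j<i , rest
  ...   | no  e≰ = j , ℕ.≤-refl , ε< , N , λ n N≤n → +-cancelʳ-≤ (½ ^ 4 * ½ ^ j) (≤-trans
    (subst₂ _≤_ (+-identityʳ (½ ^ (2 ℕ.+ j) + ½ ^ 4 * ½ ^ j)) (solve 1 (λ t → con ½ :* (con ½ :* t) :+ con (½ ^ 4) :* t :+ con (½ ^ 4) :* t :=
        con (fromℕ 3 * ½ ^ 3) :* t) refl (½ ^ j))
      (+-monoʳ-≤ (½ ^ (2 ℕ.+ j) + ½ ^ 4 * ½ ^ j) (<⇒≤ (0<*0< (0<½^ 4) (0<½^ j)))))
    (≤-trans (<⇒≤ (≰⇒> e≰)) (∣p-q∣≤⇒q≤ {seq ε n} {seq ε N} (h n N N≤n ℕ.≤-refl))))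
    where
    +-cancelʳ-≤ : ∀ {a b} c → a + c ≤ b + c → a ≤ b
    +-cancelʳ-≤ {a} {b} c le = subst₂ _≤_ (cancel a) (cancel b) (+-monoˡ-≤ (- c) le)
      where
      cancel : ∀ a → a + c - c ≡ a
      cancel a = solve 2 (λ a c → a :+ c :- c := a) refl a c

⌊log⌋ : ∀ q → 1 ℕ.< q → ∀ n → ∃[ k ] q ℕ.^ k ℕ.≤ suc n × suc n ℕ.< q ℕ.^ suc k
⌊log⌋ q 1<q zero    = 0 , ℕ.≤-refl , subst (1 ℕ.<_) (sym (ℕ.*-identityʳ q)) 1<q
⌊log⌋ q 1<q (suc n) with ⌊log⌋ q 1<q n
... | k , lower , upper with q ℕ.^ suc k ℕ.≤? suc (suc n)
...   | yes h = suc k , h , ℕ.≤-<-trans upper (ℕ.^-monoʳ-< q 1<q (ℕ.n<1+n (suc k)))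
...   | no ¬h = k , ℕ.m≤n⇒m≤1+n lower , ℕ.≰⇒> ¬h

-- Admissibility yields only the double negation for diagonal coefficients. Each inequality between
-- rationals is decidable, hence stable, and the threshold N comes from the Cauchy modulus rather
-- than from the doubly negated hypothesis.
≈0-stable : ∀ x → ¬ ¬ x ≈ℝ 0ℝ → x ≈ℝ 0ℝ
≈0-stable x ¬¬x≈0 δ 0<δ with cauchy x (½ * δ) (0<*0< 0<½ 0<δ)
... | N , h = N , λ n N≤n → decidable-stable (∣ seq x n - 0ℚ ∣ ≤? δ) λ ≰δ → ¬¬x≈0 λ x≈0 →
  let M , h′ = x≈0 (½ * δ) (0<*0< 0<½ 0<δ)
      m = N ℕ.⊔ M
  in ≰δ (subst₂ _≤_
       (cong ∣_∣ (solve 2 (λ a b → (a :- b) :+ (b :- con 0ℚ) := a :- con 0ℚ) refl (seq x n) (seq x m)))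
       (solve 1 (λ d → con ½ :* d :+ con ½ :* d := d) refl δ)
       (≤-trans (∣p+q∣≤∣p∣+∣q∣ (seq x n - seq x m) (seq x m - 0ℚ))
         (+-mono-≤ (h n m N≤n (ℕ.m≤m⊔n N M)) (h′ m (ℕ.m≤n⊔m N M)))))

-- From sums of complex squares to affine real matrices

seq-re-sum : ∀ {r} (f : Fin r → ℂ) k → seq (re (foldr _+ℂ_ 0ℂ f)) k ≡ sum λ i → seq (re (f i)) k
seq-re-sum {zero}  f k = refl
seq-re-sum {suc r} f k = cong (seq (re (f zero)) k +_) (seq-re-sum (f ∘ suc) k)

seq-re-·-≢ : (ℓ : LinearForm n) (i j : Fin n) .(i≤j : i Fin.≤ j) → i ≢ j → ∀ k →
  seq (re ((ℓ · ℓ) i j i≤j)) k ≡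
  fromℕ 2 * (seq (re (ℓ i)) k * seq (re (ℓ j)) k - seq (im (ℓ i)) k * seq (im (ℓ j)) k)
seq-re-·-≢ ℓ i j i≤j i≢j k with i Finₚ.≟ j
... | yes i≡j = ⊥-elim (i≢j i≡j)
... | no  _   = solve 4 (λ a b c d → (a :* b :- c :* d) :+ (b :* a :- d :* c) :=
  con (fromℕ 2) :* (a :* b :- c :* d)) refl (seq (re (ℓ i)) k) (seq (re (ℓ j)) k) (seq (im (ℓ i)) k) (seq (im (ℓ j)) k)

seq-re-·-≡ : (ℓ : LinearForm n) (i : Fin n) .(i≤i : i Fin.≤ i) → ∀ k →
  seq (re ((ℓ · ℓ) i i i≤i)) k ≡ seq (re (ℓ i)) k * seq (re (ℓ i)) k - seq (im (ℓ i)) k * seq (im (ℓ i)) k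
seq-re-·-≡ ℓ i i≤i k with i Finₚ.≟ i
... | yes _   = refl
... | no  i≢i = ⊥-elim (i≢i refl)

-- Pairs are interleaved rather than concatenated because `suc r * 2` computes to `2 + r * 2`, so
-- that sums peel off one pair per step.
interleave : ∀ {A : Set} {r} → (Fin r → A) → (Fin r → A) → Fin (r ℕ.* 2) → A
interleave {r = suc r} f g zero          = f zero
interleave {r = suc r} f g (suc zero)    = g zero
interleave {r = suc r} f g (suc (suc i)) = interleave (f ∘ suc) (g ∘ suc) i

sum-interleave : ∀ {r n} (f g h l : Fin r → Fin n → ℚ) i j →
  sum (λ a → interleave f g a i * interleave h l a j) ≡ sum λ a → f a i * h a j + g a i * l a j
sum-interleave {zero}  f g h l i j = refl
sum-interleave {suc r} f g h l i j = trans
  (sym (+-assoc (f zero i * h zero j) (g zero i * l zero j)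
    (sum λ a → interleave (f ∘ suc) (g ∘ suc) a i * interleave (h ∘ suc) (l ∘ suc) a j)))
  (cong (f zero i * h zero j + g zero i * l zero j +_) (sum-interleave (f ∘ suc) (g ∘ suc) (h ∘ suc) (l ∘ suc) i j))

module _ {n r} (ℓ : Fin r → LinearForm n) (k : ℕ) where

  -- The real part of a product is Re Re - Im Im, so each complex form yields two real vectors.
  -- `right` carries the signs and the factor 2 of a mixed coefficient, turning `affine` into 1
  -- minus that coefficient.
  left right : Fin (r ℕ.* 2) → Fin n → ℚ
  left  = interleave (λ a i → seq (re (ℓ a i)) k) (λ a i → seq (im (ℓ a i)) k)
  right = interleave (λ a i → - (fromℕ 2 * seq (re (ℓ a i)) k)) (λ a i → fromℕ 2 * seq (im (ℓ a i)) k)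

  private
    R I : Fin r → Fin n → ℚ
    R a i = seq (re (ℓ a i)) k
    I a i = seq (im (ℓ a i)) k

  affine≡ : ∀ i j → affine left right i j ≡ 1ℚ - fromℕ 2 * sum λ a → R a i * R a j - I a i * I a j
  affine≡ i j = cong (1ℚ +_) (trans
    (sum-interleave R I (λ a i → - (fromℕ 2 * R a i)) (λ a i → fromℕ 2 * I a i) i j)
    (trans (sum-cong-≗ λ a → solve 4 (λ a b c d → a :* (:- (con (fromℕ 2) :* b)) :+ c :* (con (fromℕ 2) :* d) :=
        con (- fromℕ 2) :* (a :* b :- c :* d)) refl (R a i) (R a j) (I a i) (I a j))
      (trans (sym (*-distribˡ-sum (- fromℕ 2) (λ a → R a i * R a j - I a i * I a j)))
        (solve 1 (λ s → con (- fromℕ 2) :* s := :- (con (fromℕ 2) :* s)) refl (sum λ a → R a i * R a j - I a i * I a j)))))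

  affine-sym : ∀ i j → affine left right i j ≡ affine left right j i
  affine-sym i j = trans (affine≡ i j) (trans
    (cong (λ s → 1ℚ - fromℕ 2 * s) (sum-cong-≗ λ a → cong₂ _-_ (*-comm (R a i) (R a j)) (*-comm (I a i) (I a j))))
    (sym (affine≡ j i)))

  affine-≢ : ∀ i j .(i≤j : i Fin.≤ j) → i ≢ j → affine left right i j ≡ 1ℚ - seq (re (sumOfSquares ℓ i j i≤j)) k
  affine-≢ i j i≤j i≢j = trans (affine≡ i j) (cong (λ s → 1ℚ - s) (sym (trans
    (seq-re-sum (λ a → (ℓ a · ℓ a) i j i≤j) k)
    (trans (sum-cong-≗ λ a → seq-re-·-≢ (ℓ a) i j i≤j i≢j k)
      (sym (*-distribˡ-sum (fromℕ 2) (λ a → R a i * R a j - I a i * I a j)))))))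

  -- The coefficient of xᵢ² is not doubled, unlike that of a mixed monomial, so a factor 2 remains.
  -- It doubles the error 2 τ to the 4 τ in `diagonal`.
  affine-diag : ∀ i .(i≤i : i Fin.≤ i) → affine left right i i ≡ 1ℚ - fromℕ 2 * seq (re (sumOfSquares ℓ i i i≤i)) k
  affine-diag i i≤i = trans (affine≡ i i) (cong (λ s → 1ℚ - fromℕ 2 * s) (sym (trans
    (seq-re-sum (λ a → (ℓ a · ℓ a) i i i≤i) k) (sum-cong-≗ λ a → seq-re-·-≡ (ℓ a) i i≤i k))))

module _ {n r} (ε : ℝ) (g : Form₂ ℝ n) (adm : Admissible ε g) (ℓ : Fin r → LinearForm n)
  (g≈ : ∀ i j .(i≤j : i Fin.≤ j) → complexify g i j i≤j ≈ℂ sumOfSquares ℓ i j i≤j)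
  (τ : ℚ) (0<τ : 0ℚ < τ) where

  open Admissible adm

  private
    B : ℕ → Matrix n
    B k = affine (left ℓ k) (right ℓ k)

  off-diagonal-< : ∀ i j → i Fin.< j → Eventually λ k → ∣ B k i j ∣ ≤ seq ε k + fromℕ 2 * τ
  off-diagonal-< i j i<j =
    let i≤j = ℕ.<⇒≤ i<j
        lower , upper = range i j i≤j (Equivalence.from (support i j i≤j) i<j)
        N , h = eventually-× (lower τ 0<τ) (eventually-× (upper τ 0<τ) (proj₁ (g≈ i j i≤j) τ 0<τ))
    in N , λ k N≤k →
      let l , u , s = h k N≤k
          γ = seq (g i j i≤j) k
          S = seq (re (sumOfSquares ℓ i j i≤j)) k
      in subst (λ b → ∣ b ∣ ≤ seq ε k + fromℕ 2 * τ) (sym (affine-≢ ℓ k i j i≤j (λ i≡j → Finₚ.<-irrefl i≡j i<j)))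
        (∣p∣≤ {1ℚ - S}
          (0≤-⇒≤ (subst (0ℚ ≤_)
            (solve 4 (λ e γ S τ → (γ :+ τ :- (con 1ℚ :+ (:- e))) :+ (S :+ τ :- γ) := e :+ con (fromℕ 2) :* τ :- (con 1ℚ :- S))
              refl (seq ε k) γ S τ)
            (≤-trans (≤⇒0≤- l) (p≤p+q (≤⇒0≤- (∣p-q∣≤⇒p≤ {γ} {S} s))))))
          (0≤-⇒≤ (subst (0ℚ ≤_)
            (solve 4 (λ e γ S τ → (con 1ℚ :+ e :+ τ :- γ) :+ (γ :+ τ :- S) := e :+ con (fromℕ 2) :* τ :- (:- (con 1ℚ :- S)))
              refl (seq ε k) γ S τ)
            (≤-trans (≤⇒0≤- u) (p≤p+q (≤⇒0≤- (∣p-q∣≤⇒q≤ {γ} {S} s)))))))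

  off-diagonal : Eventually λ k → ∀ i j → i ≢ j → ∣ B k i j ∣ ≤ seq ε k + fromℕ 2 * τ
  off-diagonal = eventually-∀ {P = λ i k → ∀ j → i ≢ j → ∣ B k i j ∣ ≤ seq ε k + fromℕ 2 * τ}
    λ i → eventually-∀ {P = λ j k → i ≢ j → ∣ B k i j ∣ ≤ seq ε k + fromℕ 2 * τ} (pair i)
    where
    Bounded : Fin n → Fin n → ℕ → Set
    Bounded i j k = ∣ B k i j ∣ ≤ seq ε k + fromℕ 2 * τ
    pair : ∀ i j → Eventually λ k → i ≢ j → Bounded i j k
    pair i j = case (Finₚ.<-cmp i j)
      where
      case : Tri (i Fin.< j) (i ≡ j) (j Fin.< i) → Eventually λ k → i ≢ j → Bounded i j k
      case (tri< i<j _ _) = proj₁ (off-diagonal-< i j i<j) , λ k N≤k _ → proj₂ (off-diagonal-< i j i<j) k N≤k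
      case (tri≈ _ i≡j _) = 0 , λ k _ i≢j → ⊥-elim (i≢j i≡j)
      case (tri> _ _ j<i) = proj₁ (off-diagonal-< j i j<i) , λ k N≤k _ →
        subst (λ b → ∣ b ∣ ≤ seq ε k + fromℕ 2 * τ) (affine-sym ℓ k j i) (proj₂ (off-diagonal-< j i j<i) k N≤k)

  diagonal : Eventually λ k → ∀ i → 1ℚ - fromℕ 4 * τ ≤ B k i i
  diagonal = eventually-∀ {P = λ i k → 1ℚ - fromℕ 4 * τ ≤ B k i i} entry
    where
    entry : ∀ i → Eventually λ k → 1ℚ - fromℕ 4 * τ ≤ B k i i
    entry i =
      let N , h = eventually-× (g≈0 τ 0<τ) (proj₁ (g≈ i i i≤i) τ 0<τ)
      in N , λ k N≤k → bound k (h k N≤k)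
      where
      i≤i : i Fin.≤ i
      i≤i = ℕ.≤-refl
      g≈0 : g i i i≤i ≈ℝ 0ℝ
      g≈0 = ≈0-stable (g i i i≤i) λ g≉0 → Finₚ.<-irrefl {x = i} refl (Equivalence.to (support i i i≤i) g≉0)
      bound : ∀ k → ∣ seq (g i i i≤i) k - 0ℚ ∣ ≤ τ × ∣ seq (g i i i≤i) k - seq (re (sumOfSquares ℓ i i i≤i)) k ∣ ≤ τ →
        1ℚ - fromℕ 4 * τ ≤ B k i i
      bound k (z , s) = subst (1ℚ - fromℕ 4 * τ ≤_) (sym (affine-diag ℓ k i i≤i))
        (0≤-⇒≤ (subst (0ℚ ≤_)
          (solve 3 (λ γ S τ → con (fromℕ 2) :* ((γ :+ τ :- S) :+ (con 0ℚ :+ τ :- γ)) :=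
            con 1ℚ :- con (fromℕ 2) :* S :- (con 1ℚ :- con (fromℕ 4) :* τ)) refl γ S τ)
          (0≤*0≤ (0≤fromℕ 2) (≤-trans (≤⇒0≤- (∣p-q∣≤⇒q≤ {γ} {S} s)) (p≤p+q (≤⇒0≤- (∣p-q∣≤⇒p≤ {γ} {0ℚ} z)))))))
        where
        γ S : ℚ
        γ = seq (g i i i≤i) k
        S = seq (re (sumOfSquares ℓ i i i≤i)) k

-- The gap η of the strict hypothesis serves as the tolerance in the weak one. At one index this
-- gives 1/s ≤ ½ʲ for an approximation s of √n from below, whence 4ʲ ≤ s² ≤ n.
4^j≤n : ∀ n .{{_ : NonZero n}} ε j → ε <ℝ fromℚ (½ ^ j) → inv (√ n) (0<√ n) ≤ℝ ε → 2 ℕ.^ j ℕ.* 2 ℕ.^ j ℕ.≤ n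
4^j≤n n ε j (η , 0<η , N₁ , h₁) 1/√n≤ε =
  let N₂ , h₂ = 1/√n≤ε η 0<η
      δ , 0<δ , N₃ , h₃ = 0<ℝ-bound {√ n} (0<√ n)
      k = N₁ ℕ.⊔ N₂ ℕ.⊔ N₃
      s = sqrtApprox n k
      0<s = <-≤-trans 0<δ (h₃ k (ℕ.m≤n⊔m (N₁ ℕ.⊔ N₂) N₃))
      1/s≤ = ≤-trans (h₂ k (≤⊔ʳ {N₁} (ℕ.m≤m⊔n (N₁ ℕ.⊔ N₂) N₃))) (h₁ k (≤⊔ˡ {N₁} (ℕ.m≤m⊔n (N₁ ℕ.⊔ N₂) N₃)))
      2^j≤s : fromℕ (2 ℕ.^ j) ≤ s
      2^j≤s = subst₂ _≤_
        (trans (solve 3 (λ s u t → t :* s :* u := t :* (s :* u)) refl s (recip s) (fromℕ (2 ℕ.^ j)))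
          (trans (cong (fromℕ (2 ℕ.^ j) *_) (p*recip 0<s)) (*-identityʳ (fromℕ (2 ℕ.^ j)))))
        (trans (solve 3 (λ s u t → t :* s :* u := s :* (u :* t)) refl s (½ ^ j) (fromℕ (2 ℕ.^ j)))
          (trans (cong (s *_) (½^*2^ j)) (*-identityʳ s)))
        (*-monoˡ-≤-nonNeg (fromℕ (2 ℕ.^ j) * s)
          {{nonNegative (0≤*0≤ (0≤fromℕ (2 ℕ.^ j)) (<⇒≤ 0<s))}} 1/s≤)
  in fromℕ-cancel-≤ {2 ℕ.^ j ℕ.* 2 ℕ.^ j} {n} (subst (_≤ fromℕ n) (sym (fromℕ-* (2 ℕ.^ j) (2 ℕ.^ j)))
    (≤-trans (*-mono-≤ (0≤fromℕ (2 ℕ.^ j)) 2^j≤s (0≤fromℕ (2 ℕ.^ j)) 2^j≤s) (sqrtApprox-lower n k)))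

rank-lower : ∀ {n r} .{{_ : NonZero n}} ε (g : Form₂ ℝ n) → Admissible ε g → IsSumOfSquares (complexify g) r →
  ∀ p′ j k .{{_ : NonZero k}} → ε <ℝ fromℚ (½ ^ j) → Eventually (λ l → 0ℚ ≤ seq ε l) →
  2 ℕ.^ j ℕ.* 2 ℕ.^ j ≡ 4 ℕ.* suc p′ → (4 ℕ.* suc p′) ℕ.^ k ℕ.≤ n → suc p′ ℕ.* k ℕ.≤ 8 ℕ.* r
rank-lower {n} {r} ε g adm (ℓ , g≈) p′ j k (η , 0<η , N₀ , h₀) (N₁ , h₁) 4^j≡ Q≤n =
  approximate-identity-rank p′ j k r (left ℓ l) (right ℓ l) 4^j≡ Q≤n
    (λ i → <-≤-trans 0<½ (≤-trans ½≤ (diag i)))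
    (λ i i′ i≢i′ → ≤-trans (off i i′ i≢i′) (≤-trans ε+2τ≤
      (*-monoˡ-≤-nonNeg (½ ^ j) {{nonNegative (<⇒≤ (0<½^ j))}} (diag i))))
  where
  -- With ε + η ≤ t = ½ʲ and τ = η / 8, the bound ε + 2 τ ≤ t (1 - 4 τ) has slack at least η (1 - t)
  -- / 2 + η / 4. So dividing by the inexact diagonal entries still leaves ratios at most t.
  τ : ℚ
  τ = ½ ^ 3 * η
  0<τ : 0ℚ < τ
  0<τ = 0<*0< (0<½^ 3) 0<η
  B : ℕ → Matrix n
  B l = affine (left ℓ l) (right ℓ l)
  estimates : Eventually λ l → (∀ i j → i ≢ j → ∣ B l i j ∣ ≤ seq ε l + fromℕ 2 * τ) × (∀ i → 1ℚ - fromℕ 4 * τ ≤ B l i i)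
  estimates = eventually-× (off-diagonal ε g adm ℓ g≈ τ 0<τ) (diagonal ε g adm ℓ g≈ τ 0<τ)
  l : ℕ
  l = N₀ ℕ.⊔ N₁ ℕ.⊔ proj₁ estimates
  off = proj₁ (proj₂ estimates l (ℕ.m≤n⊔m (N₀ ℕ.⊔ N₁) _))
  diag = proj₂ (proj₂ estimates l (ℕ.m≤n⊔m (N₀ ℕ.⊔ N₁) _))
  ε+η≤ : seq ε l + η ≤ ½ ^ j
  ε+η≤ = h₀ l (≤⊔ˡ {N₀} (ℕ.m≤m⊔n (N₀ ℕ.⊔ N₁) _))
  0≤ε : 0ℚ ≤ seq ε l
  0≤ε = h₁ l (≤⊔ʳ {N₀} (ℕ.m≤m⊔n (N₀ ℕ.⊔ N₁) _))
  η≤1 : η ≤ 1ℚ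
  η≤1 = ≤-trans (subst (_≤ seq ε l + η) (+-identityˡ η) (+-monoˡ-≤ η 0≤ε)) (≤-trans ε+η≤ (½^-anti {0} {j} ℕ.z≤n))
  ½≤ : ½ ≤ 1ℚ - fromℕ 4 * τ
  ½≤ = 0≤-⇒≤ (subst (0ℚ ≤_) (solve 1 (λ η → con ½ :* (con 1ℚ :- η) := con 1ℚ :- con (fromℕ 4) :* (con (½ ^ 3) :* η) :- con ½) refl η)
    (0≤*0≤ (<⇒≤ 0<½) (≤⇒0≤- η≤1)))
  ε+2τ≤ : seq ε l + fromℕ 2 * τ ≤ ½ ^ j * (1ℚ - fromℕ 4 * τ)
  ε+2τ≤ = 0≤-⇒≤ (subst (0ℚ ≤_)
    (solve 3 (λ e η t → (t :- (e :+ η)) :+ (con ½ :* η :* (con 1ℚ :- t) :+ con (½ ^ 2) :* η) :=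
      t :* (con 1ℚ :- con (fromℕ 4) :* (con (½ ^ 3) :* η)) :- (e :+ con (fromℕ 2) :* (con (½ ^ 3) :* η))) refl (seq ε l) η (½ ^ j))
    (≤-trans (≤⇒0≤- ε+η≤) (p≤p+q (≤-trans
      (0≤*0≤ (0≤*0≤ (<⇒≤ 0<½) (<⇒≤ 0<η)) (≤⇒0≤- (½^-anti {0} {j} ℕ.z≤n)))
      (p≤p+q (0≤*0≤ (<⇒≤ (0<½^ 2)) (<⇒≤ 0<η)))))))

-- Conversion to logarithms and the constant of the lower bound

*recip≤ : ∀ {p q x} → 0ℚ < q → p ≤ x * q → p * recip q ≤ x
*recip≤ {p} {q} {x} 0<q p≤xq = subst (p * recip q ≤_)
  (trans (*-assoc x q (recip q)) (trans (cong (x *_) (p*recip 0<q)) (*-identityʳ x)))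
  (*-monoʳ-≤-nonNeg (recip q) {{nonNegative (<⇒≤ (0<recip 0<q))}} p≤xq)

-- Here ρ stands for 1 / ε, and A and A′ for artanh ((x - 1) / (x + 1)) at x = n and x = 1 / ε.
lower-estimate : ∀ {A A′ ρ} j k p a → 0ℚ ≤ A → A ≤ fromℕ (4 ℕ.* (j ℕ.* k)) →
  0ℚ ≤ ρ → ρ * ρ ≤ fromℕ (64 ℕ.* p) → 0ℚ < A′ → fromℕ j * ½ ^ 3 ≤ A′ → p ℕ.* k ℕ.≤ 8 ℕ.* a →
  ½ ^ 14 * (fromℕ 2 * A * (ρ * ρ) * recip (fromℕ 2 * A′)) ≤ fromℕ a
lower-estimate {A} {A′} {ρ} j k p a 0≤A A≤ 0≤ρ ρ²≤ 0<A′ jh≤A′ pk≤8a = subst (_≤ fromℕ a)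
  (*-assoc (½ ^ 14) (fromℕ 2 * A * (ρ * ρ)) (recip (fromℕ 2 * A′)))
  -- The quotient A ρ² / A′ is at most 4 j k · 64 p · 8 / j = 2¹¹ p k, and p k ≤ 8 a; this is the
  -- origin of 2⁻¹⁴.
  (*recip≤ (0<*0< (0<fromℕ 1) 0<A′) (begin
    c * (fromℕ 2 * A * (ρ * ρ))                               ≤⟨ *-monoˡ-≤-nonNeg c {{nonNegative (<⇒≤ (0<½^ 14))}}
      (*-mono-≤ (0≤*0≤ (0≤fromℕ 2) 0≤A) (*-monoˡ-≤-nonNeg (fromℕ 2) {{nonNegative (0≤fromℕ 2)}} A≤) (0≤*0≤ 0≤ρ 0≤ρ) ρ²≤) ⟩
    c * (fromℕ 2 * fromℕ (4 ℕ.* (j ℕ.* k)) * fromℕ (64 ℕ.* p)) ≡⟨ cong₂ (λ x y → c * (fromℕ 2 * x * y))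
      (trans (fromℕ-* 4 (j ℕ.* k)) (cong (fromℕ 4 *_) (fromℕ-* j k))) (fromℕ-* 64 p) ⟩
    c * (fromℕ 2 * (fromℕ 4 * (J * K)) * (fromℕ 64 * P))      ≡⟨ solve 3 (λ j k p →
      con (½ ^ 14) :* (con (fromℕ 2) :* (con (fromℕ 4) :* (j :* k)) :* (con (fromℕ 64) :* p)) := con (½ ^ 5) :* j :* (p :* k)) refl J K P ⟩
    ½ ^ 5 * J * (P * K)                                       ≡⟨ cong (½ ^ 5 * J *_) (fromℕ-* p k) ⟨
    ½ ^ 5 * J * fromℕ (p ℕ.* k)                               ≤⟨ *-monoˡ-≤-nonNeg (½ ^ 5 * J)
      {{nonNegative (0≤*0≤ (<⇒≤ (0<½^ 5)) (0≤fromℕ j))}} (fromℕ-mono pk≤8a) ⟩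
    ½ ^ 5 * J * fromℕ (8 ℕ.* a)                               ≡⟨ cong (½ ^ 5 * J *_) (fromℕ-* 8 a) ⟩
    ½ ^ 5 * J * (fromℕ 8 * fromℕ a)                           ≡⟨ solve 2 (λ j a →
      con (½ ^ 5) :* j :* (con (fromℕ 8) :* a) := a :* (con (fromℕ 2) :* (j :* con (½ ^ 3)))) refl J (fromℕ a) ⟩
    fromℕ a * (fromℕ 2 * (J * ½ ^ 3))                         ≤⟨ *-monoˡ-≤-nonNeg (fromℕ a) {{nonNegative (0≤fromℕ a)}}
      (*-monoˡ-≤-nonNeg (fromℕ 2) {{nonNegative (0≤fromℕ 2)}} jh≤A′) ⟩
    fromℕ a * (fromℕ 2 * A′)                                  ∎))
  where
  open ≤-Reasoning
  c J K P : ℚ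
  c = ½ ^ 14
  J = fromℕ j
  K = fromℕ k
  P = fromℕ p

≤⇒2^≤recip : ∀ {p} j → 0ℚ < p → p ≤ ½ ^ j → fromℕ (2 ℕ.^ j) ≤ recip p
≤⇒2^≤recip {p} j 0<p p≤ = subst (_≤ recip p)
  (trans (sym (*-identityˡ (recip (½ ^ j)))) (trans (cong (_* recip (½ ^ j)) (trans (sym (½^*2^ j)) (*-comm (½ ^ j) (fromℕ (2 ℕ.^ j)))))
    (trans (*-assoc (fromℕ (2 ℕ.^ j)) (½ ^ j) (recip (½ ^ j)))
      (trans (cong (fromℕ (2 ℕ.^ j) *_) (p*recip (0<½^ j))) (*-identityʳ (fromℕ (2 ℕ.^ j)))))))
  (recip-anti 0<p p≤)

½^≤⇒recip≤ : ∀ {p} j → ½ ^ j ≤ p → recip p ≤ fromℕ (2 ℕ.^ j)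
½^≤⇒recip≤ {p} j ≤p = subst (_≤ fromℕ (2 ℕ.^ j)) (*-identityˡ (recip p))
  (*recip≤ (<-≤-trans (0<½^ j) ≤p) (subst₂ _≤_ (½^*2^ j) (*-comm p (fromℕ (2 ℕ.^ j)))
    (*-monoʳ-≤-nonNeg (fromℕ (2 ℕ.^ j)) {{nonNegative (0≤fromℕ (2 ℕ.^ j))}} ≤p)))

-- For the l-th term of ε, this is definitionally the l-th term of the real number on the left of
-- `lower-bound`.
lowerTerm : ℕ → ℚ → ℕ → ℚ
lowerTerm n ε l = ½ ^ 14 * (fromℕ 2 * artanhSum l (cayleyℚ (fromℕ n)) * (recip ε * recip ε)
  * recip (fromℕ 2 * artanhSum l (cayleyℚ (recip ε))))

lowerTerm≤ : ∀ n′ ε (g : Form₂ ℝ (suc n′)) a → Admissible ε g → IsSumOfSquares (complexify g) a →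
  ∀ j′ κ′ → ε <ℝ fromℚ (½ ^ suc j′) → Eventually (λ l → ½ ^ (3 ℕ.+ j′) ≤ seq ε l) →
  (2 ℕ.^ suc j′ ℕ.* 2 ℕ.^ suc j′) ℕ.^ suc κ′ ℕ.≤ suc n′ →
  suc n′ ℕ.< (2 ℕ.^ suc j′ ℕ.* 2 ℕ.^ suc j′) ℕ.^ suc (suc κ′) →
  Eventually λ l → lowerTerm (suc n′) (seq ε l) l ≤ fromℕ a
lowerTerm≤ n′ ε g a adm sos j′ κ′ ε<½^j@(η , 0<η , N₁ , h₁) ½^≤ε@(N₂ , h₂) q^κ≤n n<q^κ+1 =
  N₁ ℕ.⊔ N₂ ℕ.⊔ N₃ , λ l N≤l → estimate l
    (≤-trans (p≤p+q (<⇒≤ 0<η)) (h₁ l (≤⊔ˡ {N₁} (≤⊔ˡ {N₁ ℕ.⊔ N₂} N≤l))))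
    (h₂ l (≤⊔ʳ {N₁} (≤⊔ˡ {N₁ ℕ.⊔ N₂} N≤l)))
    (≤⊔ʳ {N₁ ℕ.⊔ N₂} N≤l)
  where
  open ℕ-Solver using () renaming (_:+_ to _:+ᴺ_; _:*_ to _:*ᴺ_; _:=_ to _:=ᴺ_; con to conᴺ)
  ν j κ t p N₃ : ℕ
  ν = suc n′
  N₃ = proj₁ (artanhSum≥ (suc j′))
  j = suc j′
  κ = suc κ′
  t = 2 ℕ.^ j′
  p = t ℕ.* t
  suc-p : suc (ℕ.pred p) ≡ p
  suc-p = ℕ.suc-pred p {{ℕ.m*n≢0 t t {{ℕ.m^n≢0 2 j′}} {{ℕ.m^n≢0 2 j′}}}}
  q≡4p : 2 ℕ.^ j ℕ.* 2 ℕ.^ j ≡ 4 ℕ.* suc (ℕ.pred p)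
  q≡4p = trans (ℕ-Solver.solve 1 (λ t → conᴺ 2 :*ᴺ t :*ᴺ (conᴺ 2 :*ᴺ t) :=ᴺ conᴺ 4 :*ᴺ (t :*ᴺ t)) refl t)
    (cong (4 ℕ.*_) (sym suc-p))
  pk≤8a : p ℕ.* κ ℕ.≤ 8 ℕ.* a
  pk≤8a = subst (λ p → p ℕ.* κ ℕ.≤ 8 ℕ.* a) suc-p (rank-lower ε g adm sos (ℕ.pred p) j κ ε<½^j
    (proj₁ ½^≤ε , λ l N≤l → ≤-trans (<⇒≤ (0<½^ (2 ℕ.+ j))) (proj₂ ½^≤ε l N≤l))
    q≡4p (subst (λ q → q ℕ.^ κ ℕ.≤ ν) q≡4p q^κ≤n))
  1≤n : 1ℚ ≤ fromℕ ν
  1≤n = fromℕ-mono {1} {ν} (ℕ.s≤s ℕ.z≤n)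
  -- As κ ≥ 1, κ + 1 ≤ 2 κ, so n < 4^(j (κ + 1)) ≤ 2^(4 j κ).
  n≤2^ : fromℕ ν ≤ fromℕ (2 ℕ.^ (4 ℕ.* (j ℕ.* κ)))
  n≤2^ = fromℕ-mono (ℕ.≤-trans (ℕ.<⇒≤ n<q^κ+1) (ℕ.≤-trans (ℕ.≤-reflexive (trans
      (cong (ℕ._^ suc κ) (sym (ℕ.^-distribˡ-+-* 2 j j))) (ℕ.^-*-assoc 2 (j ℕ.+ j) (suc κ))))
    (ℕ.^-monoʳ-≤ 2 (subst ((j ℕ.+ j) ℕ.* suc κ ℕ.≤_)
      (ℕ-Solver.solve 2 (λ j k → (j :+ᴺ j) :*ᴺ (k :+ᴺ k) :=ᴺ conᴺ 4 :*ᴺ (j :*ᴺ k)) refl j κ)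
      (ℕ.*-monoʳ-≤ (j ℕ.+ j) (ℕ.+-monoˡ-≤ κ (ℕ.s≤s ℕ.z≤n)))))))
  square : fromℕ (2 ℕ.^ (2 ℕ.+ j)) * fromℕ (2 ℕ.^ (2 ℕ.+ j)) ≡ fromℕ (64 ℕ.* p)
  square = trans (sym (fromℕ-* (2 ℕ.^ (2 ℕ.+ j)) (2 ℕ.^ (2 ℕ.+ j)))) (cong fromℕ
    (ℕ-Solver.solve 1 (λ t → conᴺ 2 :*ᴺ (conᴺ 2 :*ᴺ (conᴺ 2 :*ᴺ t)) :*ᴺ (conᴺ 2 :*ᴺ (conᴺ 2 :*ᴺ (conᴺ 2 :*ᴺ t))) :=ᴺ
      conᴺ 64 :*ᴺ (t :*ᴺ t)) refl t))
  estimate : ∀ l → seq ε l ≤ ½ ^ j → ½ ^ (2 ℕ.+ j) ≤ seq ε l → N₃ ℕ.≤ l → lowerTerm ν (seq ε l) l ≤ fromℕ a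
  estimate l ε≤ ≤ε N₃≤l = lower-estimate {ρ = recip (seq ε l)} j κ p a
    (≤-trans (≤-reflexive (sym (artanhSum-0 l))) (artanhSum-mono ≤-refl (0≤cayleyℚ 1≤n) l))
    (artanhSum≤ (4 ℕ.* (j ℕ.* κ)) l 1≤n n≤2^)
    0≤ρ
    (subst (recip (seq ε l) * recip (seq ε l) ≤_) square (*-mono-≤ 0≤ρ ρ≤ 0≤ρ ρ≤))
    (<-≤-trans (0<*0< (0<fromℕ j′) (0<½^ 3)) j≤A′) j≤A′
    pk≤8a
    where
    0<ε : 0ℚ < seq ε l
    0<ε = <-≤-trans (0<½^ (2 ℕ.+ j)) ≤ε
    ρ≤ : recip (seq ε l) ≤ fromℕ (2 ℕ.^ (2 ℕ.+ j))
    ρ≤ = ½^≤⇒recip≤ (2 ℕ.+ j) ≤ε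
    0≤ρ : 0ℚ ≤ recip (seq ε l)
    0≤ρ = <⇒≤ (0<recip 0<ε)
    j≤A′ : fromℕ j * ½ ^ 3 ≤ artanhSum l (cayleyℚ (recip (seq ε l)))
    j≤A′ = proj₂ (artanhSum≥ j) l N₃≤l (recip (seq ε l)) (≤⇒2^≤recip j 0<ε ε≤)

1<4^ : ∀ j → 1 ℕ.< 2 ℕ.^ suc j ℕ.* 2 ℕ.^ suc j
1<4^ j = ℕ.*-mono-≤ {2} {_} {1} (ℕ.*-monoʳ-≤ 2 (ℕ.m^n>0 2 j)) (ℕ.m^n>0 2 (suc j))

lowerTerm-eventually≤ : ∀ n .{{_ : NonZero n}} ε → 0ℝ <ℝ ε → ε <ℝ ½ℝ → inv (√ n) (0<√ n) ≤ℝ ε →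
  ∀ a → A^ ε [ n ,2]≡ a → Eventually λ l → lowerTerm n (seq ε l) l ≤ fromℕ a
lowerTerm-eventually≤ n@(suc n′) ε 0<ε ε<½ 1/√n≤ε a ((g , adm , sos , _) , _) = by-scale (dyadic ε 0<ε 1 ε<½)
  where
  Goal : Set
  Goal = Eventually λ l → lowerTerm n (seq ε l) l ≤ fromℕ a
  by-exponent : ∀ j′ → ε <ℝ fromℚ (½ ^ suc j′) → Eventually (λ l → ½ ^ (3 ℕ.+ j′) ≤ seq ε l) →
    let q = 2 ℕ.^ suc j′ ℕ.* 2 ℕ.^ suc j′ in ∃[ κ ] q ℕ.^ κ ℕ.≤ n × n ℕ.< q ℕ.^ suc κ → Goal
  -- Exponent 0 would mean n < 4ʲ, which 1/√n ≤ ε < ½ʲ excludes.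
  by-exponent j′ ε< ≤ε (zero , _ , n<q) = ⊥-elim (ℕ.<⇒≱ n<q
    (subst (ℕ._≤ n) (sym (ℕ.*-identityʳ _)) (4^j≤n n ε (suc j′) ε< 1/√n≤ε)))
  by-exponent j′ ε< ≤ε (suc κ′ , lower , upper) = lowerTerm≤ n′ ε g a adm sos j′ κ′ ε< ≤ε lower upper
  by-scale : ∃[ j ] 1 ℕ.≤ j × ε <ℝ fromℚ (½ ^ j) × Eventually (λ l → ½ ^ (2 ℕ.+ j) ≤ seq ε l) → Goal
  by-scale (suc j′ , _ , ε< , ≤ε) = by-exponent j′ ε< ≤ε (⌊log⌋ _ (1<4^ j′) n′)

lower-bound : ∀ n .{{_ : NonZero n}} ε (0<ε : 0ℝ <ℝ ε) (ε<½ : ε <ℝ ½ℝ) →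
  inv (√ n) (0<√ n) ≤ℝ ε → ∀ a → A^ ε [ n ,2]≡ a →
  fromℚ (½ ^ 14) *ℝ ((log (ℕtoℝ n) (0<ℕtoℝ n) *ℝ (inv ε 0<ε *ℝ inv ε 0<ε))
    /ℝ log (inv ε 0<ε) (0<inv {ε} 0<ε)
       [ 0<log {inv ε 0<ε} (0<inv {ε} 0<ε) (1<inv {ε} 0<ε (<ℝ-trans {ε} {½ℝ} {1ℝ} ε<½ ½<1)) ])
  ≤ℝ ℕtoℝ a
lower-bound n ε 0<ε ε<½ 1/√n≤ε a A≡a δ 0<δ = proj₁ bound , λ l N≤l → ≤-trans (proj₂ bound l N≤l) (p≤p+q (<⇒≤ 0<δ))
  where
  bound : Eventually λ l → lowerTerm n (seq ε l) l ≤ fromℕ a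
  bound = lowerTerm-eventually≤ n ε 0<ε ε<½ 1/√n≤ε a A≡a

-- The upper bound

1+nx≤[1+x]^n : ∀ {x} → 0ℚ ≤ 1ℚ + x → ∀ n → 1ℚ + fromℕ n * x ≤ (1ℚ + x) ^ n
1+nx≤[1+x]^n {x} 0≤1+x zero    = ≤-reflexive (trans (cong (1ℚ +_) (*-zeroˡ x)) (+-identityʳ 1ℚ))
1+nx≤[1+x]^n {x} 0≤1+x (suc n) = ≤-trans
  (subst (_≤ (1ℚ + x) * (1ℚ + fromℕ n * x))
    (cong (λ N → 1ℚ + N * x) (sym (fromℕ-suc n)))
    (0≤-⇒≤ (subst (0ℚ ≤_)
      (solve 2 (λ n x → n :* (x :* x) := (con 1ℚ :+ x) :* (con 1ℚ :+ n :* x) :- (con 1ℚ :+ (con 1ℚ :+ n) :* x)) refl (fromℕ n) x)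
      (0≤*0≤ (0≤fromℕ n) (0≤² x)))))
  (*-monoˡ-≤-nonNeg (1ℚ + x) {{nonNegative 0≤1+x}} (1+nx≤[1+x]^n 0≤1+x n))

-- Nearly orthogonal sign vectors

IsSign : ℚ → Set
IsSign x = x ≡ 1ℚ ⊎ x ≡ - 1ℚ

IsSign-* : ∀ {x y} → IsSign x → IsSign y → IsSign (x * y)
IsSign-* (inj₁ refl) (inj₁ refl) = inj₁ refl
IsSign-* (inj₁ refl) (inj₂ refl) = inj₂ refl
IsSign-* (inj₂ refl) (inj₁ refl) = inj₂ refl
IsSign-* (inj₂ refl) (inj₂ refl) = inj₁ refl

IsSign-neg : ∀ {x} → IsSign x → IsSign (- x)
IsSign-neg (inj₁ refl) = inj₂ refl
IsSign-neg (inj₂ refl) = inj₁ refl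

IsSign-² : ∀ {x} → IsSign x → x * x ≡ 1ℚ
IsSign-² (inj₁ refl) = refl
IsSign-² (inj₂ refl) = refl

product : (Fin n → ℚ) → ℚ
product = foldr _*_ 1ℚ

-- Method of conditional expectations: for each coordinate, the two choices
-- of sign average out to the current value of the sum.
gain : ∀ {d s} → ℚ → (Fin s → ℚ) → (Fin s → Fin d → ℚ) → (Fin d → ℚ) → Fin s → ℚ
gain h P w x a = P a * product λ c → 1ℚ + h * (x c * w a c)

balanced-signs : ∀ {d s} h (P : Fin s → ℚ) (w : Fin s → Fin d → ℚ) →
  ∃[ x ] (∀ c → IsSign (x c)) × sum (gain h P w x) ≤ sum P
balanced-signs {zero}  h P w = (λ ()) , (λ ()) ,
  ≤-reflexive (sum-cong-≗ {x = gain h P w λ ()} {y = P} λ a → *-identityʳ (P a))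
balanced-signs {suc d} {s} h P w = extend choice (balanced-signs h (P′ (proj₁ choice)) (λ a → w a ∘ suc))
  where
  -- The factor of a coordinate already chosen is absorbed into the weights, which is why the
  -- induction runs over arbitrary P.
  P′ : ℚ → Fin s → ℚ
  P′ σ a = P a * (1ℚ + h * (σ * w a zero))
  average : sum (P′ 1ℚ) + sum (P′ (- 1ℚ)) ≡ sum P + sum P
  average = begin
    sum (P′ 1ℚ) + sum (P′ (- 1ℚ))        ≡⟨ ∑-distrib-+ (P′ 1ℚ) (P′ (- 1ℚ)) ⟨
    sum (λ a → P′ 1ℚ a + P′ (- 1ℚ) a)    ≡⟨ sum-cong-≗ (λ a → solve 3 (λ p h w →
      p :* (con 1ℚ :+ h :* (con 1ℚ :* w)) :+ p :* (con 1ℚ :+ h :* (con (- 1ℚ) :* w)) := p :+ p)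
      refl (P a) h (w a zero)) ⟩
    sum (λ a → P a + P a)                ≡⟨ ∑-distrib-+ P P ⟩
    sum P + sum P                        ∎
    where open ≡-Reasoning
  choice : ∃[ σ ] IsSign σ × sum (P′ σ) ≤ sum P
  choice with sum (P′ 1ℚ) ≤? sum P
  ... | yes ≤P = 1ℚ , inj₁ refl , ≤P
  ... | no  ≰P = - 1ℚ , inj₂ refl , ≮⇒≥ λ P< →
    <-irrefl (sym average) (+-mono-< (≰⇒> ≰P) P<)
  extend : ((σ , _) : ∃[ σ ] IsSign σ × sum (P′ σ) ≤ sum P) →
    ∃[ x ] (∀ c → IsSign (x c)) × sum (gain h (P′ σ) (λ a → w a ∘ suc) x) ≤ sum (P′ σ) →
    ∃[ x ] (∀ c → IsSign (x c)) × sum (gain h P w x) ≤ sum P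
  extend (σ , sign , ≤P) (x , signs , ≤P′) = x′ , signs′ , ≤-trans (≤-reflexive regroup) (≤-trans ≤P′ ≤P)
    where
    x′ : Fin (suc d) → ℚ
    x′ zero    = σ
    x′ (suc c) = x c
    signs′ : ∀ c → IsSign (x′ c)
    signs′ zero    = sign
    signs′ (suc c) = signs c
    regroup : sum (gain h P w x′) ≡ sum (gain h (P′ σ) (λ a → w a ∘ suc) x)
    regroup = sum-cong-≗ {x = gain h P w x′} {y = gain h (P′ σ) (λ a → w a ∘ suc) x} λ a →
      sym (*-assoc (P a) (1ℚ + h * (σ * w a zero)) (product λ c → 1ℚ + h * (x c * w a (suc c))))

sign-counts : ∀ {d} (σ : Fin d → ℚ) → (∀ c → IsSign (σ c)) → ∃[ p ] ∃[ q ]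
  p ℕ.+ q ≡ d × sum σ ≡ fromℕ p - fromℕ q ×
  (∀ h → product (λ c → 1ℚ + h * σ c) ≡ (1ℚ + h) ^ p * (1ℚ - h) ^ q)
sign-counts {zero}  σ signs = 0 , 0 , refl , refl , λ h → refl
sign-counts {suc d} σ signs with sign-counts (σ ∘ suc) (signs ∘ suc) | signs zero
... | p , q , p+q≡d , sum≡ , product≡ | inj₁ σ≡1 = suc p , q , cong suc p+q≡d ,
  trans (cong₂ _+_ σ≡1 sum≡) (trans (sym (+-assoc 1ℚ (fromℕ p) (- fromℕ q))) (cong (_- fromℕ q) (sym (fromℕ-suc p)))) ,
  λ h → trans (cong₂ _*_ (cong (1ℚ +_) (trans (cong (h *_) σ≡1) (*-identityʳ h))) (product≡ h))
    (sym (*-assoc (1ℚ + h) ((1ℚ + h) ^ p) ((1ℚ - h) ^ q)))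
... | p , q , p+q≡d , sum≡ , product≡ | inj₂ σ≡-1 = p , suc q , trans (ℕ.+-suc p q) (cong suc p+q≡d) ,
  trans (cong₂ _+_ σ≡-1 sum≡) (trans (solve 2 (λ p q → con (- 1ℚ) :+ (p :- q) := p :- (con 1ℚ :+ q)) refl (fromℕ p) (fromℕ q))
    (cong (λ z → fromℕ p - z) (sym (fromℕ-suc q)))) ,
  λ h → trans (cong₂ _*_ (cong (λ z → 1ℚ + h * z) σ≡-1) (product≡ h))
    (solve 3 (λ h x y → (con 1ℚ :+ h :* con (- 1ℚ)) :* (x :* y) := x :* ((con 1ℚ :- h) :* y)) refl
      h ((1ℚ + h) ^ p) ((1ℚ - h) ^ q))

fromℕ-cancel-< : fromℕ m < fromℕ n → m ℕ.< n
fromℕ-cancel-< h = ℕ.≰⇒> λ n≤m → <-irrefl refl (<-≤-trans h (fromℕ-mono n≤m))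

module _ (j U : ℕ) where

  private
    e d E N : ℕ
    e = 2 ℕ.^ j
    d = 4 ℕ.* (e ℕ.* e) ℕ.* U
    E = 2 ℕ.* e ℕ.* (2 ℕ.* U)
    N = 2 ℕ.* (e ℕ.* e) ℕ.* U
    h : ℚ
    h = ½ ^ suc j
    h≤½ : h ≤ ½
    h≤½ = subst (h ≤_) (*-identityʳ ½) (½^-anti {1} {suc j} (ℕ.s≤s ℕ.z≤n))
    ½+½ : 1ℚ ≡ ½ + ½
    ½+½ = refl
    h<1 : h < 1ℚ
    h<1 = subst (h <_) (sym ½+½) (≤-<-trans {h} {½} {½ + ½} h≤½ (p<p+q {½} {½} 0<½))
    0≤h : 0ℚ ≤ h
    0≤h = <⇒≤ (0<½^ (suc j))
    open ℕ-Solver using () renaming (_:+_ to _:+ᴺ_; _:*_ to _:*ᴺ_; _:=_ to _:=ᴺ_; con to conᴺ)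

  he≡½ : h * fromℕ e ≡ ½
  he≡½ = trans (*-assoc ½ (½ ^ j) (fromℕ e)) (cong (½ *_) (½^*2^ j))

  d½^j≡E : fromℕ d * ½ ^ j ≡ fromℕ E
  d½^j≡E = trans (cong (λ z → fromℕ z * ½ ^ j)
      (ℕ-Solver.solve 2 (λ e U → conᴺ 4 :*ᴺ (e :*ᴺ e) :*ᴺ U :=ᴺ conᴺ 2 :*ᴺ e :*ᴺ (conᴺ 2 :*ᴺ U) :*ᴺ e) refl e U))
    (trans (cong (_* ½ ^ j) (fromℕ-* E e)) (trans (*-assoc (fromℕ E) (fromℕ e) (½ ^ j))
      (trans (cong (fromℕ E *_) (trans (*-comm (fromℕ e) (½ ^ j)) (½^*2^ j))) (*-identityʳ (fromℕ E)))))

  -- Bernoulli gives (1 + h)^(2e) ≥ 1 + 2 e h = 2, and E = 2 e · 2 U.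
  [1+h]^E≥ : fromℕ 2 ^ (2 ℕ.* U) ≤ (1ℚ + h) ^ E
  [1+h]^E≥ = subst (fromℕ 2 ^ (2 ℕ.* U) ≤_) (^-assocʳ (1ℚ + h) (2 ℕ.* e) (2 ℕ.* U))
    (^-mono-≤ (0≤fromℕ 2) (subst (_≤ (1ℚ + h) ^ (2 ℕ.* e))
      (trans (cong (λ z → 1ℚ + z * h) (fromℕ-* 2 e)) (trans (solve 2 (λ h e → con 1ℚ :+ con (fromℕ 2) :* e :* h :=
        con 1ℚ :+ con (fromℕ 2) :* (h :* e)) refl h (fromℕ e)) (cong (λ z → 1ℚ + fromℕ 2 * z) he≡½)))
      (1+nx≤[1+x]^n (<⇒≤ (0<+0≤ 0<1 0≤h)) (2 ℕ.* e))) (2 ℕ.* U))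

  -- Bernoulli gives (1 - h²)^(2e²) ≥ 1 - 2 (h e)² = 1/2, and N = 2 e² U.
  [1-h²]^N≥ : ½ ^ U ≤ (1ℚ - h * h) ^ N
  [1-h²]^N≥ = subst (½ ^ U ≤_) (^-assocʳ (1ℚ - h * h) (2 ℕ.* (e ℕ.* e)) U)
    (^-mono-≤ (<⇒≤ 0<½) (subst (_≤ (1ℚ - h * h) ^ (2 ℕ.* (e ℕ.* e)))
      (trans (cong (λ z → 1ℚ + z * (- (h * h))) (trans (fromℕ-* 2 (e ℕ.* e)) (cong (fromℕ 2 *_) (fromℕ-* e e))))
        (trans (solve 2 (λ h e → con 1ℚ :+ con (fromℕ 2) :* (e :* e) :* (:- (h :* h)) :=
          con 1ℚ :- con (fromℕ 2) :* ((h :* e) :* (h :* e))) refl h (fromℕ e)) (cong (λ z → 1ℚ - fromℕ 2 * (z * z)) he≡½)))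
      (1+nx≤[1+x]^n 0≤1-h² (2 ℕ.* (e ℕ.* e)))) U)
    where
    0≤1-h² : 0ℚ ≤ 1ℚ - h * h
    0≤1-h² = ≤⇒0≤- (*-mono-≤ 0≤h (<⇒≤ h<1) 0≤h (<⇒≤ h<1))

  -- (1 + h)ᵖ (1 - h)^q = (1 - h²)^q (1 + h)ᵖ⁻^q with h = 1 / 2e, q ≤ 2e²U and p - q ≥ 4eU.
  sum-signs≤ : (σ : Fin d → ℚ) → (∀ c → IsSign (σ c)) → product (λ c → 1ℚ + h * σ c) < fromℕ 2 ^ U →
    sum σ ≤ fromℕ d * ½ ^ j
  sum-signs≤ σ signs product< with sign-counts σ signs
  ... | p , q , p+q≡d , sum≡ , product≡ = ≮⇒≥ λ E<sum → <-irrefl refl (<-≤-trans product< (large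
    (ℕ.<⇒≤ (fromℕ-cancel-< (subst₂ _<_
      (trans (cong (_+ fromℕ q) d½^j≡E) (sym (fromℕ-+ E q)))
      (trans (cong (_+ fromℕ q) sum≡) (solve 2 (λ p q → p :- q :+ q := p) refl (fromℕ p) (fromℕ q)))
      (+-monoˡ-< (fromℕ q) E<sum))))))
    where
    large : E ℕ.+ q ℕ.≤ p → fromℕ 2 ^ U ≤ product (λ c → 1ℚ + h * σ c)
    large E+q≤p = begin
      fromℕ 2 ^ U                                                ≡⟨ cong (_^ U) (refl {x = fromℕ 2}) ⟩
      (½ * fromℕ 2 ^ 2) ^ U                                      ≡⟨ ^-distrib-* ½ (fromℕ 2 ^ 2) U ⟩
      ½ ^ U * (fromℕ 2 ^ 2) ^ U                                  ≡⟨ cong (½ ^ U *_) (^-assocʳ (fromℕ 2) 2 U) ⟩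
      ½ ^ U * fromℕ 2 ^ (2 ℕ.* U)                                ≤⟨ *-mono-≤ (<⇒≤ (0<½^ U)) [1-h²]^N≥
                                                                     (0≤^ (0≤fromℕ 2) (2 ℕ.* U)) [1+h]^E≥ ⟩
      (1ℚ - h * h) ^ N * (1ℚ + h) ^ E                            ≤⟨ *-monoʳ-≤-nonNeg ((1ℚ + h) ^ E) {{nonNegative (0≤^ 0≤1+h E)}}
                                                                     (subst (λ z → (1ℚ - h * h) ^ z ≤ (1ℚ - h * h) ^ q) (ℕ.m∸n+n≡m q≤N)
                                                                       (^-anti 0≤1-h² 1-h²≤1 (N ℕ.∸ q) q)) ⟩
      (1ℚ - h * h) ^ q * (1ℚ + h) ^ E                            ≡⟨ cong (λ z → z ^ q * (1ℚ + h) ^ E)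
                                                                     (solve 1 (λ h → con 1ℚ :- h :* h := (con 1ℚ :+ h) :* (con 1ℚ :- h)) refl h) ⟩
      ((1ℚ + h) * (1ℚ - h)) ^ q * (1ℚ + h) ^ E                   ≡⟨ cong (_* (1ℚ + h) ^ E) (^-distrib-* (1ℚ + h) (1ℚ - h) q) ⟩
      (1ℚ + h) ^ q * (1ℚ - h) ^ q * (1ℚ + h) ^ E                 ≡⟨ solve 3 (λ a b c → a :* b :* c := c :* a :* b) refl
                                                                     ((1ℚ + h) ^ q) ((1ℚ - h) ^ q) ((1ℚ + h) ^ E) ⟩
      (1ℚ + h) ^ E * (1ℚ + h) ^ q * (1ℚ - h) ^ q                 ≡⟨ cong (_* (1ℚ - h) ^ q) (^-homo-* (1ℚ + h) E q) ⟨
      (1ℚ + h) ^ (E ℕ.+ q) * (1ℚ - h) ^ q                        ≤⟨ *-monoʳ-≤-nonNeg ((1ℚ - h) ^ q) {{nonNegative (0≤^ 0≤1-h q)}}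
                                                                     (^-increasing E+q≤p) ⟩
      (1ℚ + h) ^ p * (1ℚ - h) ^ q                                ≡⟨ product≡ h ⟨
      product (λ c → 1ℚ + h * σ c)                               ∎
      where
      open ≤-Reasoning
      0≤1+h : 0ℚ ≤ 1ℚ + h
      0≤1+h = <⇒≤ (0<+0≤ 0<1 0≤h)
      0≤1-h : 0ℚ ≤ 1ℚ - h
      0≤1-h = <⇒≤ (<⇒0<- h<1)
      0≤1-h² : 0ℚ ≤ 1ℚ - h * h
      0≤1-h² = ≤⇒0≤- (*-mono-≤ 0≤h (<⇒≤ h<1) 0≤h (<⇒≤ h<1))
      1-h²≤1 : 1ℚ - h * h ≤ 1ℚ
      1-h²≤1 = subst (1ℚ - h * h ≤_) (+-identityʳ 1ℚ) (+-monoʳ-≤ 1ℚ (neg-antimono-≤ (0≤² h)))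
      -- From q ≤ p it follows that 2 q ≤ p + q = d = 2 N.
      q≤N : q ℕ.≤ N
      q≤N = ℕ.*-cancelˡ-≤ 2 (ℕ.≤-trans (ℕ.+-monoʳ-≤ q (subst (ℕ._≤ p) (sym (ℕ.+-identityʳ q)) (ℕ.≤-trans (ℕ.m≤n+m q E) E+q≤p)))
        (ℕ.≤-reflexive (trans (ℕ.+-comm q p) (trans p+q≡d
          (ℕ-Solver.solve 2 (λ e U → conᴺ 4 :*ᴺ e :*ᴺ U :=ᴺ conᴺ 2 :*ᴺ (conᴺ 2 :*ᴺ e :*ᴺ U)) refl (e ℕ.* e) U)))))
      ^-increasing : ∀ {a b} → a ℕ.≤ b → (1ℚ + h) ^ a ≤ (1ℚ + h) ^ b
      ^-increasing {a} {b} a≤b = subst₂ _≤_ (*-identityʳ ((1ℚ + h) ^ a))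
        (trans (sym (^-homo-* (1ℚ + h) a (b ℕ.∸ a))) (cong ((1ℚ + h) ^_) (ℕ.m+[n∸m]≡n a≤b)))
        (*-monoˡ-≤-nonNeg ((1ℚ + h) ^ a) {{nonNegative (0≤^ 0≤1+h a)}}
          (subst (_≤ (1ℚ + h) ^ (b ℕ.∸ a)) (1^ (b ℕ.∸ a)) (^-mono-≤ (<⇒≤ 0<1) (p≤p+q {h} {1ℚ} 0≤h) (b ℕ.∸ a))))

0≤product : {f : Fin n → ℚ} → (∀ i → 0ℚ ≤ f i) → 0ℚ ≤ product f
0≤product {zero}  0≤f = <⇒≤ 0<1
0≤product {suc n} {f} 0≤f = 0≤*0≤ (0≤f zero) (0≤product {f = f ∘ suc} (0≤f ∘ suc))

term≤sum : {f : Fin n → ℚ} → (∀ i → 0ℚ ≤ f i) → ∀ i → f i ≤ sum f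
term≤sum {suc n} {f} 0≤f zero    = p≤p+q {sum (f ∘ suc)} {f zero} (0≤sum {f = f ∘ suc} (0≤f ∘ suc))
term≤sum {suc n} {f} 0≤f (suc i) = ≤-trans (term≤sum {f = f ∘ suc} (0≤f ∘ suc) i)
  (subst (_≤ f zero + sum (f ∘ suc)) (+-identityˡ (sum (f ∘ suc))) (+-monoˡ-≤ (sum (f ∘ suc)) (0≤f zero)))

interleave⁺ : ∀ {A : Set} {r} (Q : A → Set) {f g : Fin r → A} → (∀ b → Q (f b)) → (∀ b → Q (g b)) →
  ∀ a → Q (interleave f g a)
interleave⁺ {r = suc r} Q Qf Qg zero          = Qf zero
interleave⁺ {r = suc r} Q Qf Qg (suc zero)    = Qg zero
interleave⁺ {r = suc r} Q {f} {g} Qf Qg (suc (suc a)) = interleave⁺ Q {f ∘ suc} {g ∘ suc} (Qf ∘ suc) (Qg ∘ suc) a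

interleave⁻ : ∀ {A : Set} {r} (Q : A → Set) {f g : Fin r → A} → (∀ a → Q (interleave f g a)) →
  ∀ b → Q (f b) × Q (g b)
interleave⁻ {r = suc r} Q {f} {g} Qfg zero    = Qfg zero , Qfg (suc zero)
interleave⁻ {r = suc r} Q {f} {g} Qfg (suc b) = interleave⁻ Q {f ∘ suc} {g ∘ suc} (λ a → Qfg (suc (suc a))) b

inner : (v w : Fin n → ℚ) → ℚ
inner v w = sum λ c → v c * w c

module _ (j U : ℕ) where

  codeLength : ℕ
  codeLength = 4 ℕ.* (2 ℕ.^ j ℕ.* 2 ℕ.^ j) ℕ.* U

  private
    d : ℕ
    d = codeLength
    h : ℚ
    h = ½ ^ suc j
    0≤h : 0ℚ ≤ h
    0≤h = <⇒≤ (0<½^ (suc j))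
    h≤1 : h ≤ 1ℚ
    h≤1 = ½^-anti {0} {suc j} ℕ.z≤n

  0≤1+hσ : ∀ {σ} → IsSign σ → 0ℚ ≤ 1ℚ + h * σ
  0≤1+hσ (inj₁ refl) = subst (λ z → 0ℚ ≤ 1ℚ + z) (sym (*-identityʳ h)) (<⇒≤ (0<+0≤ 0<1 0≤h))
  0≤1+hσ (inj₂ refl) = subst (0ℚ ≤_) (solve 1 (λ h → con 1ℚ :- h := con 1ℚ :+ h :* con (- 1ℚ)) refl h) (≤⇒0≤- h≤1)

  -- Including the negatives of the vectors makes the one-sided `sum-signs≤` two-sided, hence 2 t
  -- products. They are nonnegative with total at most 2 t < 2ᵁ, so each one lies below 2ᵁ.
  nearly-orthogonal-signs : ∀ {t} (v : Fin t → Fin d → ℚ) → (∀ a c → IsSign (v a c)) →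
    fromℕ (t ℕ.* 2) < fromℕ 2 ^ U →
    ∃[ x ] (∀ c → IsSign (x c)) × (∀ a → ∣ inner x (v a) ∣ ≤ fromℕ d * ½ ^ j)
  nearly-orthogonal-signs {t} v signs t< = x , x-signs , λ a →
    let lower , upper = interleave⁻ Small {v} {v⁻} small a
    in ∣p∣≤ {inner x (v a)} (sum-signs≤ j U (λ c → x c * v a c) (λ c → IsSign-* (x-signs c) (signs a c)) lower)
         (subst (_≤ fromℕ d * ½ ^ j) (negate a)
           (sum-signs≤ j U (λ c → x c * v⁻ a c) (λ c → IsSign-* (x-signs c) (IsSign-neg (signs a c))) upper))
    where
    v⁻ : Fin t → Fin d → ℚ
    v⁻ a c = - v a c
    w : Fin (t ℕ.* 2) → Fin d → ℚ
    w = interleave v v⁻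
    w-signs : ∀ a c → IsSign (w a c)
    w-signs = interleave⁺ (λ y → ∀ c → IsSign (y c)) {v} {v⁻} signs (λ a c → IsSign-neg (signs a c))
    P : Fin (t ℕ.* 2) → ℚ
    P _ = 1ℚ
    choice : ∃[ x ] (∀ c → IsSign (x c)) × sum (gain h P w x) ≤ sum P
    choice = balanced-signs h P w
    x : Fin d → ℚ
    x = proj₁ choice
    x-signs : ∀ c → IsSign (x c)
    x-signs = proj₁ (proj₂ choice)
    Small : (Fin d → ℚ) → Set
    Small y = product (λ c → 1ℚ + h * (x c * y c)) < fromℕ 2 ^ U
    small : ∀ a → Small (w a)
    small a = ≤-<-trans (≤-trans
      (subst (_≤ sum (gain h P w x)) (*-identityˡ (product λ c → 1ℚ + h * (x c * w a c)))
        (term≤sum {f = gain h P w x} (λ a → 0≤*0≤ (<⇒≤ 0<1)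
          (0≤product {f = λ c → 1ℚ + h * (x c * w a c)} λ c → 0≤1+hσ (IsSign-* (x-signs c) (w-signs a c)))) a))
      (≤-trans (proj₂ (proj₂ choice)) (≤-reflexive (trans (sum-const (t ℕ.* 2) 1ℚ) (*-identityʳ (fromℕ (t ℕ.* 2))))))) t<
    negate : ∀ a → sum (λ c → x c * v⁻ a c) ≡ - inner x (v a)
    negate a = begin
      sum (λ c → x c * v⁻ a c)              ≡⟨ sum-cong-≗ (λ c → solve 2 (λ x v → x :* (:- v) := con (- 1ℚ) :* (x :* v)) refl (x c) (v a c)) ⟩
      sum (λ c → - 1ℚ * (x c * v a c))      ≡⟨ *-distribˡ-sum (- 1ℚ) (λ c → x c * v a c) ⟨
      - 1ℚ * inner x (v a)                  ≡⟨ solve 1 (λ s → con (- 1ℚ) :* s := :- s) refl (inner x (v a)) ⟩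
      - inner x (v a)                       ∎
      where open ≡-Reasoning

  IsCode : ∀ {t} → (Fin t → Fin d → ℚ) → Set
  IsCode v = (∀ a c → IsSign (v a c)) × (∀ a b → a ≢ b → ∣ inner (v a) (v b) ∣ ≤ fromℕ d * ½ ^ j)

  extend-code : ∀ {t} (v : Fin t → Fin d → ℚ) (x : Fin d → ℚ) → IsCode v → (∀ c → IsSign (x c)) →
    (∀ a → ∣ inner x (v a) ∣ ≤ fromℕ d * ½ ^ j) → IsCode {suc t} (x ∷ v)
  extend-code {t} v x (signs , orth) x-signs x-orth = signs′ , orth′
    where
    signs′ : ∀ a c → IsSign ((x ∷ v) a c)
    signs′ zero    = x-signs
    signs′ (suc a) = signs a
    orth′ : ∀ a b → a ≢ b → ∣ inner ((x ∷ v) a) ((x ∷ v) b) ∣ ≤ fromℕ d * ½ ^ j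
    orth′ zero    zero    a≢b = ⊥-elim (a≢b refl)
    orth′ zero    (suc b) a≢b = x-orth b
    orth′ (suc a) zero    a≢b = subst (λ z → ∣ z ∣ ≤ fromℕ d * ½ ^ j)
      (sum-cong-≗ {x = λ c → x c * v a c} {y = λ c → v a c * x c} λ c → *-comm (x c) (v a c)) (x-orth a)
    orth′ (suc a) (suc b) a≢b = orth a b (a≢b ∘ cong suc)

  code : ∀ t → fromℕ (t ℕ.* 2) < fromℕ 2 ^ U → Σ (Fin t → Fin d → ℚ) IsCode
  code zero    _  = (λ ()) , (λ ()) , λ ()
  code (suc t) t< = x ∷ v , extend-code v x v-code (proj₁ (proj₂ next)) (proj₂ (proj₂ next))
    where
    2t< : fromℕ (t ℕ.* 2) < fromℕ 2 ^ U
    2t< = ≤-<-trans {fromℕ (t ℕ.* 2)} {fromℕ (suc t ℕ.* 2)} (fromℕ-mono (ℕ.m≤n+m (t ℕ.* 2) 2)) t<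
    v : Fin t → Fin d → ℚ
    v = proj₁ (code t 2t<)
    v-code : IsCode v
    v-code = proj₂ (code t 2t<)
    next : ∃[ x ] (∀ c → IsSign (x c)) × (∀ a → ∣ inner x (v a) ∣ ≤ fromℕ d * ½ ^ j)
    next = nearly-orthogonal-signs v (proj₁ v-code) 2t<
    x : Fin d → ℚ
    x = proj₁ next

-- Rational forms as sums of complex squares

square : (Fin n → ℚ) → Matrix n
square y i j with i Finₚ.≟ j
... | yes _ = y i * y i
... | no  _ = y i * y j + y j * y i

square-≡ : (y : Fin n → ℚ) → ∀ i → square y i i ≡ y i * y i
square-≡ y i with i Finₚ.≟ i
... | yes _   = refl
... | no  i≢i = ⊥-elim (i≢i refl)

square-≢ : (y : Fin n → ℚ) → ∀ i j → i ≢ j → square y i j ≡ fromℕ 2 * (y i * y j)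
square-≢ y i j i≢j with i Finₚ.≟ j
... | yes i≡j = ⊥-elim (i≢j i≡j)
... | no  _   = solve 2 (λ a b → a :* b :+ b :* a := con (fromℕ 2) :* (a :* b)) refl (y i) (y j)

-- The equalities hold at every index of the Cauchy sequences, not merely in the limit, so sums are
-- assembled by exact algebra.
IsRationalSumOfSquares : Matrix n → ℕ → Set
IsRationalSumOfSquares {n} G r = Σ (Fin r → LinearForm n) λ ℓ → ∀ i j .(i≤j : i Fin.≤ j) l →
  seq (re (sumOfSquares ℓ i j i≤j)) l ≡ G i j × seq (im (sumOfSquares ℓ i j i≤j)) l ≡ 0ℚ

realSquare : ∀ c (y : Fin n → ℚ) i j .(i≤j : i Fin.≤ j) l →
  let ℓ = λ i → fromℚ (c * y i) +i 0ℝ in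
  seq (re ((ℓ · ℓ) i j i≤j)) l ≡ c * c * square y i j × seq (im ((ℓ · ℓ) i j i≤j)) l ≡ 0ℚ
realSquare c y i j i≤j l with i Finₚ.≟ j
... | yes _ =
  solve 2 (λ c y → c :* y :* (c :* y) :- con 0ℚ :* con 0ℚ := c :* c :* (y :* y)) refl c (y i) ,
  solve 1 (λ a → a :* con 0ℚ :+ con 0ℚ :* a := con 0ℚ) refl (c * y i)
... | no  _ =
  solve 3 (λ c x y → (c :* x :* (c :* y) :- con 0ℚ :* con 0ℚ) :+ (c :* y :* (c :* x) :- con 0ℚ :* con 0ℚ) :=
    c :* c :* (x :* y :+ y :* x)) refl c (y i) (y j) ,
  solve 2 (λ a b → (a :* con 0ℚ :+ con 0ℚ :* b) :+ (b :* con 0ℚ :+ con 0ℚ :* a) := con 0ℚ) refl (c * y i) (c * y j)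

imaginarySquare : ∀ c (y : Fin n → ℚ) i j .(i≤j : i Fin.≤ j) l →
  let ℓ = λ i → 0ℝ +i fromℚ (c * y i) in
  seq (re ((ℓ · ℓ) i j i≤j)) l ≡ - (c * c) * square y i j × seq (im ((ℓ · ℓ) i j i≤j)) l ≡ 0ℚ
imaginarySquare c y i j i≤j l with i Finₚ.≟ j
... | yes _ =
  solve 2 (λ c y → con 0ℚ :* con 0ℚ :- c :* y :* (c :* y) := (:- (c :* c)) :* (y :* y)) refl c (y i) ,
  solve 1 (λ a → con 0ℚ :* a :+ a :* con 0ℚ := con 0ℚ) refl (c * y i)
... | no  _ =
  solve 3 (λ c x y → (con 0ℚ :* con 0ℚ :- c :* x :* (c :* y)) :+ (con 0ℚ :* con 0ℚ :- c :* y :* (c :* x)) :=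
    (:- (c :* c)) :* (x :* y :+ y :* x)) refl c (y i) (y j) ,
  solve 2 (λ a b → (con 0ℚ :* b :+ a :* con 0ℚ) :+ (con 0ℚ :* a :+ b :* con 0ℚ) := con 0ℚ) refl (c * y i) (c * y j)

-- c y² = ((c + 1) / 2 y)² + (i (c - 1) / 2 y)², which avoids square roots.
IsRationalSumOfSquares-+ : ∀ c (y : Fin n → ℚ) {G : Matrix n} → IsRationalSumOfSquares G r →
  IsRationalSumOfSquares (λ i j → c * square y i j + G i j) (2 ℕ.+ r)
IsRationalSumOfSquares-+ {n} {r} c y {G} (ℓ , ℓ≡) = ℓ′ , λ i j i≤j l →
  let re₁ , im₁ = realSquare (½ * (c + 1ℚ)) y i j i≤j l
      re₂ , im₂ = imaginarySquare (½ * (c - 1ℚ)) y i j i≤j l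
      re₃ , im₃ = ℓ≡ i j i≤j l
  in trans (cong₂ _+_ re₁ (cong₂ _+_ re₂ re₃))
       (solve 3 (λ c s g → con ½ :* (c :+ con 1ℚ) :* (con ½ :* (c :+ con 1ℚ)) :* s :+
           ((:- (con ½ :* (c :- con 1ℚ) :* (con ½ :* (c :- con 1ℚ)))) :* s :+ g) := c :* s :+ g)
         refl c (square y i j) (G i j)) ,
     cong₂ _+_ im₁ (cong₂ _+_ im₂ im₃)
  where
  ℓ′ : Fin (2 ℕ.+ r) → LinearForm n
  ℓ′ zero          i = fromℚ (½ * (c + 1ℚ) * y i) +i 0ℝ
  ℓ′ (suc zero)    i = 0ℝ +i fromℚ (½ * (c - 1ℚ) * y i)
  ℓ′ (suc (suc a)) i = ℓ a i

IsRationalSumOfSquares-resp : {G H : Matrix n} → (∀ i j → G i j ≡ H i j) →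
  IsRationalSumOfSquares G r → IsRationalSumOfSquares H r
IsRationalSumOfSquares-resp G≡H (ℓ , ℓ≡) = ℓ , λ i j i≤j l →
  trans (proj₁ (ℓ≡ i j i≤j l)) (G≡H i j) , proj₂ (ℓ≡ i j i≤j l)

IsRationalSumOfSquares-sum : ∀ {d} c (y : Fin d → Fin n → ℚ) {G : Matrix n} → IsRationalSumOfSquares G r →
  IsRationalSumOfSquares (λ i j → sum (λ k → c * square (y k) i j) + G i j) (d ℕ.* 2 ℕ.+ r)
IsRationalSumOfSquares-sum {d = zero}  c y {G} sos = IsRationalSumOfSquares-resp
  (λ i j → sym (+-identityˡ (G i j))) sos
IsRationalSumOfSquares-sum {d = suc d} c y {G} sos = IsRationalSumOfSquares-resp
  (λ i j → sym (+-assoc (c * square (y zero) i j) (sum λ k → c * square (y (suc k)) i j) (G i j)))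
  (IsRationalSumOfSquares-+ c (y zero) (IsRationalSumOfSquares-sum c (y ∘ suc) sos))

-- Admissible rational forms and the minimum over them

rationalForm : Matrix n → Form₂ ℝ n
rationalForm G i j _ = fromℚ (G i j)

fromRational : {G : Matrix n} → IsRationalSumOfSquares G r → IsSumOfSquares (complexify (rationalForm G)) r
fromRational {G = G} (ℓ , ℓ≡) = ℓ , λ i j i≤j →
  (λ δ 0<δ → 0 , λ l _ → subst (λ z → ∣ G i j - z ∣ ≤ δ) (sym (proj₁ (ℓ≡ i j i≤j l))) (close (G i j) 0<δ)) ,
  (λ δ 0<δ → 0 , λ l _ → subst (λ z → ∣ 0ℚ - z ∣ ≤ δ) (sym (proj₂ (ℓ≡ i j i≤j l))) (close 0ℚ 0<δ))
  where
  close : ∀ q {δ} → 0ℚ < δ → ∣ q - q ∣ ≤ δ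
  close q {δ} 0<δ = subst (λ z → ∣ z ∣ ≤ δ) (sym (+-inverseʳ q)) (<⇒≤ 0<δ)

-- An inhabited P has a minimum only up to double negation. That suffices, since a ≤ r is decidable
-- and hence stable. In this way a sum of r squares bounds a without computing a Waring rank.
≤minimum⇒≤ : ∀ {P : ℕ → Set} r → P r → ∀ {a} → (∀ k → IsMinimum P k → a ℕ.≤ k) → a ℕ.≤ r
≤minimum⇒≤ {P} r Pr {a} a≤min = decidable-stable (a ℕ.≤? r) λ a≰r → no-minimum r r ℕ.≤-refl Pr
  λ k min k≤r → a≰r (ℕ.≤-trans (a≤min k min) k≤r)
  where
  -- The bound b decreases structurally while r drops to an arbitrary smaller element of P.
  no-minimum : ∀ b r → r ℕ.≤ b → P r → ¬ (∀ k → IsMinimum P k → ¬ k ℕ.≤ r)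
  no-minimum zero    zero _   Pr none = none 0 (Pr , λ _ _ → ℕ.z≤n) ℕ.≤-refl
  no-minimum (suc b) r    r≤b Pr none = none r (Pr , λ k Pk → ℕ.≮⇒≥ λ k<r →
    no-minimum b k (ℕ.s≤s⁻¹ (ℕ.≤-trans k<r r≤b)) Pk λ m min m≤k → none m min (ℕ.≤-trans m≤k (ℕ.<⇒≤ k<r))) ℕ.≤-refl

module _ (ε : ℝ) (j : ℕ) (1≤j : 1 ℕ.≤ j) (½^j≤ε : Eventually λ l → ½ ^ j ≤ seq ε l)
  (G : Matrix n) (G-diag : ∀ i → G i i ≡ 0ℚ) (G-off : ∀ i j′ → i ≢ j′ → ∣ 1ℚ - G i j′ ∣ ≤ ½ ^ j) where

  private
    diag≈0 : ∀ i j′ → i ≡ j′ → fromℚ (G i j′) ≈ℝ 0ℝ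
    diag≈0 i .i refl δ 0<δ = 0 , λ l _ → subst (λ z → ∣ z - 0ℚ ∣ ≤ δ) (sym (G-diag i)) (<⇒≤ 0<δ)
    -- Since j ≥ 1, the entry is at least 1/2, whereas being equal to 0 would put it below 1/4.
    off≉0 : ∀ i j′ → i ≢ j′ → ¬ fromℚ (G i j′) ≈ℝ 0ℝ
    off≉0 i j′ i≢j′ G≈0 = <-irrefl refl (<-≤-trans (positive⁻¹ (½ * ½)) (0≤-⇒≤ (subst (0ℚ ≤_)
      (solve 1 (λ g → (con ½ :- (con 1ℚ :- g)) :+ (con 0ℚ :+ con (½ * ½) :- g) := con 0ℚ :- con (½ * ½)) refl (G i j′))
      (≤-trans (≤⇒0≤- (≤-trans (p≤∣p∣ (1ℚ - G i j′)) (≤-trans (G-off i j′ i≢j′) (½^-anti {1} {j} 1≤j))))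
        (p≤p+q (≤⇒0≤- (∣p-q∣≤⇒p≤ {G i j′} {0ℚ} (proj₂ small (proj₁ small) ℕ.≤-refl))))))))
      where
      small : Eventually λ l → ∣ G i j′ - 0ℚ ∣ ≤ ½ * ½
      small = G≈0 (½ * ½) (positive⁻¹ (½ * ½))
    G-lower : ∀ i j′ → i ≢ j′ → 1ℝ -ℝ ε ≤ℝ fromℚ (G i j′)
    G-lower i j′ i≢j′ δ 0<δ = proj₁ ½^j≤ε , λ l N≤l → ≤-trans (0≤-⇒≤ {G i j′} {1ℚ - seq ε l} (subst (0ℚ ≤_)
      (solve 2 (λ e g → e :- (con 1ℚ :- g) := g :- (con 1ℚ :- e)) refl (seq ε l) (G i j′))
      (≤⇒0≤- (≤-trans (p≤∣p∣ (1ℚ - G i j′)) (≤-trans (G-off i j′ i≢j′) (proj₂ ½^j≤ε l N≤l)))))) (p≤p+q (<⇒≤ 0<δ))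
    G-upper : ∀ i j′ → i ≢ j′ → fromℚ (G i j′) ≤ℝ 1ℝ +ℝ ε
    G-upper i j′ i≢j′ δ 0<δ = proj₁ ½^j≤ε , λ l N≤l → ≤-trans (0≤-⇒≤ {1ℚ + seq ε l} {G i j′} (subst (0ℚ ≤_)
      (solve 2 (λ e g → e :- (:- (con 1ℚ :- g)) := con 1ℚ :+ e :- g) refl (seq ε l) (G i j′))
      (≤⇒0≤- (≤-trans (-p≤∣p∣ (1ℚ - G i j′)) (≤-trans (G-off i j′ i≢j′) (proj₂ ½^j≤ε l N≤l)))))) (p≤p+q (<⇒≤ 0<δ))

  rationalForm-admissible : Admissible ε (rationalForm G)
  rationalForm-admissible = record
    { support = λ i j′ i≤j′ → mk⇔
        (λ G≉0 → Finₚ.≤∧≢⇒< (recompute (i Finₚ.≤? j′) i≤j′) (λ i≡j′ → G≉0 (diag≈0 i j′ i≡j′)))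
        (λ i<j′ → off≉0 i j′ (λ i≡j′ → Finₚ.<-irrefl i≡j′ i<j′))
    ; range = λ i j′ i≤j′ G≉0 → let i≢j′ = λ i≡j′ → G≉0 (diag≈0 i j′ i≡j′) in G-lower i j′ i≢j′ , G-upper i j′ i≢j′
    }

A≤rank : ∀ {ε a} (G : Matrix n) → A^ ε [ n ,2]≡ a → Admissible ε (rationalForm G) → IsRationalSumOfSquares G r → a ℕ.≤ r
A≤rank {n} {r} G (_ , least) adm sos = ≤minimum⇒≤ {IsSumOfSquares (complexify (rationalForm G))} r (fromRational sos)
  λ k min → least k (rationalForm G , adm , min)

module _ (j U : ℕ) .{{_ : NonZero U}} {n} (v : Fin n → Fin (codeLength j U) → ℚ) (v-code : IsCode j U v) where

  private
    d : ℕ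
    d = codeLength j U
    D c : ℚ
    D = fromℕ d
    c = - (½ * recip D)
    0<D : 0ℚ < D
    0<D = fromℕ-mono-< {0} {d} (ℕ.>-nonZero⁻¹ d {{ℕ.m*n≢0 (4 ℕ.* (2 ℕ.^ j ℕ.* 2 ℕ.^ j)) U
      {{ℕ.m*n≢0 4 (2 ℕ.^ j ℕ.* 2 ℕ.^ j) {{_}} {{ℕ.m*n≢0 (2 ℕ.^ j) (2 ℕ.^ j) {{ℕ.m^n≢0 2 j}} {{ℕ.m^n≢0 2 j}}}}}}}})

  codeForm : Matrix n
  codeForm i i′ = ½ * square (λ _ → 1ℚ) i i′ + (sum (λ k → c * square (λ a → v a k) i i′) + 0ℚ)

  -- Each of the 1 + d weighted squares costs two complex squares, the price of avoiding square
  -- roots of the weights.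
  codeForm-sos : IsRationalSumOfSquares codeForm (2 ℕ.+ (d ℕ.* 2 ℕ.+ 0))
  codeForm-sos = IsRationalSumOfSquares-+ ½ (λ _ → 1ℚ)
    {G = λ i i′ → sum (λ k → c * square (λ a → v a k) i i′) + 0ℚ}
    (IsRationalSumOfSquares-sum c (λ k a → v a k) {G = λ _ _ → 0ℚ} ((λ ()) , λ _ _ _ _ → refl , refl))

  codeForm-diag : ∀ i → codeForm i i ≡ 0ℚ
  codeForm-diag i = begin
    ½ * square (λ _ → 1ℚ) i i + (sum (λ k → c * square (λ a → v a k) i i) + 0ℚ)  ≡⟨ cong₂ (λ x y → ½ * x + (y + 0ℚ))
      (square-≡ (λ _ → 1ℚ) i) (sum-cong-≗ λ k → cong (c *_) (trans (square-≡ (λ a → v a k) i) (IsSign-² (proj₁ v-code i k)))) ⟩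
    ½ * (1ℚ * 1ℚ) + (sum {d} (λ _ → c * 1ℚ) + 0ℚ)                                ≡⟨ cong (λ y → ½ * (1ℚ * 1ℚ) + (y + 0ℚ)) (sum-const d (c * 1ℚ)) ⟩
    ½ * (1ℚ * 1ℚ) + (D * (c * 1ℚ) + 0ℚ)                                          ≡⟨ solve 2 (λ D u →
      con ½ :* (con 1ℚ :* con 1ℚ) :+ (D :* ((:- (con ½ :* u)) :* con 1ℚ) :+ con 0ℚ) := con ½ :* (con 1ℚ :- D :* u)) refl D (recip D) ⟩
    ½ * (1ℚ - D * recip D)                                                       ≡⟨ cong (λ x → ½ * (1ℚ - x)) (p*recip 0<D) ⟩
    ½ * (1ℚ - 1ℚ)                                                                ≡⟨⟩
    0ℚ                                                                           ∎
    where open ≡-Reasoning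

  1-codeForm : ∀ i i′ → i ≢ i′ → 1ℚ - codeForm i i′ ≡ recip D * inner (v i) (v i′)
  1-codeForm i i′ i≢i′ = begin
    1ℚ - codeForm i i′                                                           ≡⟨ cong₂ (λ x y → 1ℚ - (½ * x + (y + 0ℚ)))
      (square-≢ (λ _ → 1ℚ) i i′ i≢i′)
      (trans (sum-cong-≗ λ k → trans (cong (c *_) (square-≢ (λ a → v a k) i i′ i≢i′)) (sym (*-assoc c (fromℕ 2) (v i k * v i′ k))))
        (sym (*-distribˡ-sum (c * fromℕ 2) (λ k → v i k * v i′ k)))) ⟩
    1ℚ - (½ * (fromℕ 2 * (1ℚ * 1ℚ)) + (c * fromℕ 2 * inner (v i) (v i′) + 0ℚ))   ≡⟨ solve 2 (λ u x →
      con 1ℚ :- (con ½ :* (con (fromℕ 2) :* (con 1ℚ :* con 1ℚ)) :+ ((:- (con ½ :* u)) :* con (fromℕ 2) :* x :+ con 0ℚ)) := u :* x)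
      refl (recip D) (inner (v i) (v i′)) ⟩
    recip D * inner (v i) (v i′)                                                 ∎
    where open ≡-Reasoning

  codeForm-off : ∀ i i′ → i ≢ i′ → ∣ 1ℚ - codeForm i i′ ∣ ≤ ½ ^ j
  codeForm-off i i′ i≢i′ = begin
    ∣ 1ℚ - codeForm i i′ ∣                     ≡⟨ cong ∣_∣ (1-codeForm i i′ i≢i′) ⟩
    ∣ recip D * inner (v i) (v i′) ∣           ≡⟨ ∣p*q∣≡∣p∣*∣q∣ (recip D) (inner (v i) (v i′)) ⟩
    ∣ recip D ∣ * ∣ inner (v i) (v i′) ∣       ≡⟨ cong (_* ∣ inner (v i) (v i′) ∣) (0≤p⇒∣p∣≡p (<⇒≤ (0<recip 0<D))) ⟩
    recip D * ∣ inner (v i) (v i′) ∣           ≤⟨ *-monoˡ-≤-nonNeg (recip D) {{nonNegative (<⇒≤ (0<recip 0<D))}} (proj₂ v-code i i′ i≢i′) ⟩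
    recip D * (D * ½ ^ j)                      ≡⟨ solve 3 (λ u D t → u :* (D :* t) := D :* u :* t) refl (recip D) D (½ ^ j) ⟩
    D * recip D * ½ ^ j                        ≡⟨ cong (_* ½ ^ j) (p*recip 0<D) ⟩
    1ℚ * ½ ^ j                                 ≡⟨ *-identityˡ (½ ^ j) ⟩
    ½ ^ j                                      ∎
    where open ≤-Reasoning

A≤codeLength : ∀ {n} ε j U .{{_ : NonZero U}} a → 1 ℕ.≤ j → Eventually (λ l → ½ ^ j ≤ seq ε l) → n ℕ.* 2 ℕ.< 2 ℕ.^ U →
  A^ ε [ n ,2]≡ a → a ℕ.≤ 2 ℕ.+ (codeLength j U ℕ.* 2 ℕ.+ 0)
A≤codeLength {n} ε j U a 1≤j ½^j≤ε 2n<2^U A≡a = A≤rank {ε = ε} (codeForm j U v v-code) A≡a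
  (rationalForm-admissible ε j 1≤j ½^j≤ε (codeForm j U v v-code) (codeForm-diag j U v v-code) (codeForm-off j U v v-code))
  (codeForm-sos j U v v-code)
  where
  codewords : Σ (Fin n → Fin (codeLength j U) → ℚ) (IsCode j U)
  codewords = code j U n (subst (fromℕ (n ℕ.* 2) <_) (fromℕ-^ 2 U) (fromℕ-mono-< 2n<2^U))
  v : Fin n → Fin (codeLength j U) → ℚ
  v = proj₁ codewords
  v-code : IsCode j U v
  v-code = proj₂ codewords

-- For n = 1 the upper bound is 0 because log 1 = 0, so no constant number of squares is affordable.
-- The zero form is admissible, there being no off-diagonal monomial.
A≤0 : ∀ ε j a → 1 ℕ.≤ j → Eventually (λ l → ½ ^ j ≤ seq ε l) → A^ ε [ 1 ,2]≡ a → a ℕ.≤ 0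
A≤0 ε j a 1≤j ½^j≤ε A≡a = A≤rank {ε = ε} (λ _ _ → 0ℚ) A≡a
  (rationalForm-admissible ε j 1≤j ½^j≤ε (λ _ _ → 0ℚ) (λ _ → refl) λ { zero zero i≢i → ⊥-elim (i≢i refl) })
  ((λ ()) , λ _ _ _ _ → refl , refl)

-- The constant of the upper bound

upperTerm : ℕ → ℚ → ℕ → ℚ
upperTerm n ε l = fromℕ 1664 * (fromℕ 2 * artanhSum l (cayleyℚ (fromℕ n)) * (recip ε * recip ε))

-- Here t = 2ⁱ ≤ 1 / ε, while the code is built at the finer scale 4 t. With L = L′ + 1 ≥ 1, the
-- count 2 + 128 t² (L + 2) is at most 416 t² L, and L ≤ 8 A turns 416 into 3328 = 2 · 1664.
upper-estimate : ∀ {A ρ} t L′ a → a ℕ.≤ 2 ℕ.+ (4 ℕ.* (4 ℕ.* t ℕ.* (4 ℕ.* t)) ℕ.* (3 ℕ.+ L′) ℕ.* 2 ℕ.+ 0) → 1 ℕ.≤ t →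
  fromℕ (suc L′) * ½ ^ 3 ≤ A → fromℕ t ≤ ρ → fromℕ a ≤ fromℕ 1664 * (fromℕ 2 * A * (ρ * ρ))
upper-estimate {A} {ρ} t@(suc t′) L′ a a≤ _ L≤A t≤ρ = begin
  fromℕ a                                               ≤⟨ fromℕ-mono a≤416tL ⟩
  fromℕ (416 ℕ.* (t ℕ.* t ℕ.* L))                       ≡⟨ trans (fromℕ-* 416 (t ℕ.* t ℕ.* L)) (cong (fromℕ 416 *_)
                                                             (trans (fromℕ-* (t ℕ.* t) L) (cong (_* fromℕ L) (fromℕ-* t t)))) ⟩
  fromℕ 416 * (T * T * fromℕ L)                         ≡⟨ solve 2 (λ T L → con (fromℕ 416) :* (T :* T :* L) :=
                                                             con (fromℕ 3328) :* ((L :* con (½ ^ 3)) :* (T :* T))) refl T (fromℕ L) ⟩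
  fromℕ 3328 * ((fromℕ L * ½ ^ 3) * (T * T))            ≤⟨ *-monoˡ-≤-nonNeg (fromℕ 3328) {{nonNegative (0≤fromℕ 3328)}}
                                                             (*-mono-≤ (0≤*0≤ (0≤fromℕ L) (<⇒≤ (0<½^ 3))) L≤A (0≤*0≤ 0≤T 0≤T)
                                                               (*-mono-≤ 0≤T t≤ρ 0≤T t≤ρ)) ⟩
  fromℕ 3328 * (A * (ρ * ρ))                            ≡⟨ solve 2 (λ A r → con (fromℕ 3328) :* (A :* (r :* r)) :=
                                                             con (fromℕ 1664) :* (con (fromℕ 2) :* A :* (r :* r))) refl A ρ ⟩
  fromℕ 1664 * (fromℕ 2 * A * (ρ * ρ))                  ∎
  where
  open ≤-Reasoning
  open ℕ-Solver using () renaming (_:+_ to _:+ᴺ_; _:*_ to _:*ᴺ_; _:=_ to _:=ᴺ_; con to conᴺ)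
  L : ℕ
  L = suc L′
  T : ℚ
  T = fromℕ t
  0≤T : 0ℚ ≤ T
  0≤T = 0≤fromℕ t
  a≤416tL : a ℕ.≤ 416 ℕ.* (t ℕ.* t ℕ.* L)
  a≤416tL = ℕ.≤-trans a≤ (ℕ.≤-trans (ℕ.m≤m+n _ (30 ℕ.+ 32 ℕ.* x ℕ.+ 288 ℕ.* L′ ℕ.+ 288 ℕ.* (x ℕ.* L′)))
    (ℕ.≤-reflexive (ℕ-Solver.solve 2 (λ t L → let x = t :+ᴺ t :+ᴺ t :*ᴺ t in
      conᴺ 2 :+ᴺ (conᴺ 4 :*ᴺ (conᴺ 4 :*ᴺ (conᴺ 1 :+ᴺ t) :*ᴺ (conᴺ 4 :*ᴺ (conᴺ 1 :+ᴺ t))) :*ᴺ (conᴺ 3 :+ᴺ L) :*ᴺ conᴺ 2 :+ᴺ conᴺ 0) :+ᴺ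
        (conᴺ 30 :+ᴺ conᴺ 32 :*ᴺ x :+ᴺ conᴺ 288 :*ᴺ L :+ᴺ conᴺ 288 :*ᴺ (x :*ᴺ L)) :=ᴺ
      conᴺ 416 :*ᴺ ((conᴺ 1 :+ᴺ t) :*ᴺ (conᴺ 1 :+ᴺ t) :*ᴺ (conᴺ 1 :+ᴺ L))) refl t′ L′)))
    where
    x : ℕ
    x = t′ ℕ.+ t′ ℕ.+ t′ ℕ.* t′

≤upperTerm-eventually : ∀ n .{{_ : NonZero n}} ε → 0ℝ <ℝ ε → ε <ℝ 1ℝ →
  ∀ a → A^ ε [ n ,2]≡ a → Eventually λ l → fromℕ a ≤ upperTerm n (seq ε l) l
≤upperTerm-eventually n@(suc n′) ε 0<ε ε<1 a A≡a = by-scale (dyadic ε 0<ε 0 ε<1)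
  where
  1≤n : 1ℚ ≤ fromℕ n
  1≤n = fromℕ-mono {1} {n} (ℕ.s≤s ℕ.z≤n)
  Goal : Set
  Goal = Eventually λ l → fromℕ a ≤ upperTerm n (seq ε l) l
  by-exponent : ∀ i → ε <ℝ fromℚ (½ ^ i) → Eventually (λ l → ½ ^ (2 ℕ.+ i) ≤ seq ε l) →
    ∃[ L ] 2 ℕ.^ L ℕ.≤ n × n ℕ.< 2 ℕ.^ suc L → Goal
  by-exponent i _ ½^≤ε (zero , _ , n<2) = 0 , λ l _ → ≤-trans (fromℕ-mono {a} {0} a≤0)
    (0≤*0≤ (0≤fromℕ 1664) (0≤*0≤ (0≤*0≤ (0≤fromℕ 2)
      (≤-trans (≤-reflexive (sym (artanhSum-0 l))) (artanhSum-mono ≤-refl (0≤cayleyℚ 1≤n) l))) (0≤² (recip (seq ε l)))))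
    where
    a≤0 : a ℕ.≤ 0
    a≤0 = A≤0 ε (2 ℕ.+ i) a (ℕ.s≤s ℕ.z≤n) ½^≤ε
      (subst (λ n → A^ ε [ n ,2]≡ a) (ℕ.≤-antisym (ℕ.s≤s⁻¹ n<2) (ℕ.s≤s ℕ.z≤n)) A≡a)
  by-exponent i (η , 0<η , N₁ , h₁) ½^≤ε@(N₂ , h₂) (suc L′ , lower , upper) =
    N₁ ℕ.⊔ N₂ ℕ.⊔ proj₁ (artanhSum≥ (suc L′)) , λ l N≤l →
      upper-estimate (2 ℕ.^ i) L′ a a≤ (ℕ.m^n>0 2 i)
        (proj₂ (artanhSum≥ (suc L′)) l (≤⊔ʳ {N₁ ℕ.⊔ N₂} N≤l) (fromℕ n) (fromℕ-mono lower))
        (≤⇒2^≤recip i (<-≤-trans (0<½^ (2 ℕ.+ i)) (h₂ l (≤⊔ʳ {N₁} (≤⊔ˡ {N₁ ℕ.⊔ N₂} N≤l))))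
          (≤-trans (p≤p+q (<⇒≤ 0<η)) (h₁ l (≤⊔ˡ {N₁} (≤⊔ˡ {N₁ ℕ.⊔ N₂} N≤l)))))
    where
    -- `upper` is n < 2^(L′ + 2). One more factor 2 makes room for the vectors together with their
    -- negatives, so U = L′ + 3.
    2n<2^U : n ℕ.* 2 ℕ.< 2 ℕ.^ (3 ℕ.+ L′)
    2n<2^U = subst (n ℕ.* 2 ℕ.<_) (ℕ.*-comm (2 ℕ.^ suc (suc L′)) 2) (ℕ.*-monoˡ-< 2 upper)
    a≤ : a ℕ.≤ 2 ℕ.+ (4 ℕ.* (4 ℕ.* 2 ℕ.^ i ℕ.* (4 ℕ.* 2 ℕ.^ i)) ℕ.* (3 ℕ.+ L′) ℕ.* 2 ℕ.+ 0)
    a≤ = subst (λ e → a ℕ.≤ 2 ℕ.+ (4 ℕ.* (e ℕ.* e) ℕ.* (3 ℕ.+ L′) ℕ.* 2 ℕ.+ 0)) (sym (ℕ.*-assoc 2 2 (2 ℕ.^ i)))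
      (A≤codeLength ε (2 ℕ.+ i) (3 ℕ.+ L′) a (ℕ.s≤s ℕ.z≤n) ½^≤ε 2n<2^U A≡a)
  by-scale : ∃[ i ] 0 ℕ.≤ i × ε <ℝ fromℚ (½ ^ i) × Eventually (λ l → ½ ^ (2 ℕ.+ i) ≤ seq ε l) → Goal
  by-scale (i , _ , ε< , ½^≤ε) = by-exponent i ε< ½^≤ε (⌊log⌋ 2 (ℕ.s≤s (ℕ.s≤s ℕ.z≤n)) n′)

upper-bound : ∀ n .{{_ : NonZero n}} ε (0<ε : 0ℝ <ℝ ε) → ε <ℝ 1ℝ → ∀ a → A^ ε [ n ,2]≡ a →
  ℕtoℝ a ≤ℝ fromℚ (fromℕ 1664) *ℝ (log (ℕtoℝ n) (0<ℕtoℝ n) *ℝ (inv ε 0<ε *ℝ inv ε 0<ε))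
upper-bound n ε 0<ε ε<1 a A≡a δ 0<δ = proj₁ bound , λ l N≤l → ≤-trans (proj₂ bound l N≤l) (p≤p+q (<⇒≤ 0<δ))
  where
  bound : Eventually λ l → fromℕ a ≤ upperTerm n (seq ε l) l
  bound = ≤upperTerm-eventually n ε 0<ε ε<1 a A≡a

0<fromℚ : ∀ {q} → 0ℚ < q → 0ℝ <ℝ fromℚ q
0<fromℚ {q} 0<q = bound-0<ℝ {fromℚ q} (q , 0<q , 0 , λ _ _ → ≤-refl)

proposition35 : (∃[ c ] 0ℝ <ℝ c ×
    (∀ (n : ℕ) .{{_ : NonZero n}} (ε : ℝ) (0<ε : 0ℝ <ℝ ε) (ε<½ : ε <ℝ ½ℝ) →
    inv (√ n) (0<√ n) ≤ℝ ε →
    ∀ a → A^ ε [ n ,2]≡ a →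
    c *ℝ ((log (ℕtoℝ n) (0<ℕtoℝ n) *ℝ (inv ε 0<ε *ℝ inv ε 0<ε))
    /ℝ log (inv ε 0<ε) (0<inv {ε} 0<ε)
    [ 0<log {inv ε 0<ε} (0<inv {ε} 0<ε) (1<inv {ε} 0<ε (<ℝ-trans {ε} {½ℝ} {1ℝ} ε<½ ½<1)) ])
    ≤ℝ ℕtoℝ a))
    ×
    (∃[ C ] 0ℝ <ℝ C ×
    (∀ (n : ℕ) .{{_ : NonZero n}} (ε : ℝ) (0<ε : 0ℝ <ℝ ε) → ε <ℝ 1ℝ →
    ∀ a → A^ ε [ n ,2]≡ a →
    ℕtoℝ a ≤ℝ C *ℝ (log (ℕtoℝ n) (0<ℕtoℝ n) *ℝ (inv ε 0<ε *ℝ inv ε 0<ε))))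
proposition35 =
  (fromℚ (½ ^ 14) , 0<fromℚ (0<½^ 14) , lower-bound) ,
  (fromℚ (fromℕ 1664) , 0<fromℚ (0<fromℕ 1663) , upper-bound)
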